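{- Let $n\geq 2$ and let $\lambda = (\lambda_{1}, \ldots, \lambda_{r}) \vdash n$ be a partition of $n$ (with $\lambda_1\ge\cdots\ge\lambda_r\ge 1$). Let $\eta_\lambda(1)$ be the eigenvalue of the $1$-point fixing graph $\mathcal{F}(n,1)$ indexed by $\lambda$. Then: (a) $\eta_\lambda (1)=0$ if and only if $\lambda= (n-1,1)$ or $\lambda=(2,1^{n-2})$. (b) If $r=1$ and $\lambda\neq (2)$, then $\eta_\lambda (1)>0$. (c) If $r\geq 2$ and $\lambda$ is neither $(n-1,1)$ nor $(2,1^{n-2})$, then $$\operatorname{sign}(\eta_{\lambda}(1)) = (-1)^{|\lambda|-\lambda_{1}-1} = (-1)^{(\#\text{ cells under the first row of }\lambda)-1},$$ where $\operatorname{sign}(\eta_\lambda(1))$ is $1$ if $\eta_{\lambda}(1)$ is positive and $-1$ if $\eta_{\lambda}(1)$ is negative.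
   Context: $\mathcal{S}_n$ is the symmetric group on $[n]=\{1,\dots,n\}$. For $0\le k<n$, $\mathcal{S}(n,k)$ is the set of all $\sigma\in\mathcal{S}_n$ fixing exactly $k$ points. The $k$-point fixing graph $\mathcal{F}(n,k)$ is the Cayley graph $\Gamma(\mathcal{S}_n,\mathcal{S}(n,k))$: its vertex set is $\mathcal{S}_n$, and $g,h$ are adjacent iff $gh^{ -1}$ fixes exactly $k$ points. For $\lambda\vdash n$, let $\chi_\lambda$ be the irreducible (complex) character of $\mathcal{S}_n$ indexed by $\lambda$ in the standard way (so $\chi_{(n)}$ is the trivial character). Since $\mathcal{S}(n,k)$ is closed under conjugation, the eigenvalues of $\mathcal{F}(n,k)$ are indexed by partitions $\lambda\vdash n$ and are the integers $$\eta_\lambda(k)=\frac{1}{\chi_\lambda(1)}\sum_{\sigma\in\mathcal{S}(n,k)}\chi_\lambda(\sigma).$$ An exponent in a partition denotes multiplicity of a part, e.g. $(2,1^{n-2})$ has one part $2$ and $n-2$ parts equal to $1$. $|\lambda|=n$ is the size of $\lambda$; cells refer to boxes of the Ferrers diagram of $\lambda$. -}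

module Defs where

open import Data.Bool.Base using (if_then_else_)
open import Data.Fin.Base using (Fin; toℕ)
import Data.Fin.Base as Fin
import Data.Fin.Properties as Finₚ
open import Data.Fin.Permutation
  using (Permutation′; _⟨$⟩ʳ_; flip; insert) renaming (id to idₚ)
open import Data.Integer.Base using (ℤ; +0; +[1+_]; -[1+_]; 0ℤ; 1ℤ; -1ℤ)
import Data.Integer.Base as ℤ
open import Data.List.Base
  using (List; []; _∷_; map; foldr; filter; length; lookup; concatMap;
         cartesianProduct; allFin)
import Data.List.Base as List
open import Data.List.Relation.Unary.All using (All)
open import Data.List.Relation.Unary.Linked using (Linked)
open import Data.Maybe.Base using (fromMaybe)
open import Data.Nat.Base using (ℕ; zero; suc; _≤_; _≥_)
import Data.Nat.ListAction as ListAction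
import Data.Nat.Properties as ℕₚ
open import Data.Product.Base using (Σ; ∃; _×_; _,_; proj₁; proj₂)
open import Data.Rational.Base
  using (ℚ; 0ℚ; 1ℚ; _+_; _*_; _÷_; _/_; mkℚ; ≢-nonZero; +-0-rawMonoid)
import Data.Rational.Properties as ℚₚ
open import Algebra.Definitions.RawMonoid +-0-rawMonoid using (sum)
open import Function.Bundles using (_↔_; Inverse)
open import Function.Properties.Inverse using (↔-trans)
open import Relation.Binary.PropositionalEquality using (_≡_)
open import Relation.Nullary.Decidable using (Dec; yes; no; ⌊_⌋; _×-dec_)

------------------------------------------------------------------------
-- Rational numbers

∑ : ∀ {a} {A : Set a} → List A → (A → ℚ) → ℚ
∑ xs f = foldr (λ x s → f x + s) 0ℚ xs

-- Total division, with p ÷₀ 0 = 0.  It is only used to divide by the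
-- degree of a nonzero representation.
_÷₀_ : ℚ → ℚ → ℚ
p ÷₀ q with q ℚₚ.≟ 0ℚ
... | yes _  = 0ℚ
... | no q≢0 = _÷_ p q {{≢-nonZero q≢0}}

signum : ℚ → ℤ
signum (mkℚ +0       _ _) = 0ℤ
signum (mkℚ +[1+ _ ] _ _) = 1ℤ
signum (mkℚ -[1+ _ ] _ _) = -1ℤ

------------------------------------------------------------------------
-- The symmetric group

-- Every permutation of Fin n, once each up to pointwise equality:
-- insert zero j π sends zero to j and is π (relabelled) elsewhere.
permutations : ∀ n → List (Permutation′ n)
permutations zero    = idₚ ∷ []
permutations (suc n) =
  concatMap (λ j → map (insert Fin.zero j) (permutations n)) (allFin (suc n))

inversions : ∀ {n} → Permutation′ n → ℕ
inversions {n} σ = length (filter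
  (λ (i , j) → (i Finₚ.<? j) ×-dec ((σ ⟨$⟩ʳ j) Finₚ.<? (σ ⟨$⟩ʳ i)))
  (cartesianProduct (allFin n) (allFin n)))

sgn : ∀ {n} → Permutation′ n → ℚ
sgn σ = (-1ℤ ℤ.^ inversions σ) / 1

#fixed : ∀ {n} → Permutation′ n → ℕ
#fixed {n} σ = length (filter (λ i → (σ ⟨$⟩ʳ i) Finₚ.≟ i) (allFin n))

-- The connection set S(n,k) of the k-point fixing graph.
𝒮 : ∀ n → ℕ → List (Permutation′ n)
𝒮 n k = filter (λ σ → #fixed σ ℕₚ.≟ k) (permutations n)

------------------------------------------------------------------------
-- Partitions and Ferrers diagrams

record Partition (n : ℕ) : Set where
  field
    parts    : List ℕ
    sorted   : Linked _≥_ parts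
    positive : All (1 ≤_) parts
    size     : ListAction.sum parts ≡ n

open Partition public

firstPart : ∀ {n} → Partition n → ℕ
firstPart μ = fromMaybe 0 (List.head (parts μ))

#parts : ∀ {n} → Partition n → ℕ
#parts μ = length (parts μ)

-- Rows and columns of the diagram are numbered from 0.
Cell : ∀ {n} → Partition n → Set
Cell μ = Σ (Fin (#parts μ)) λ i → Fin (lookup (parts μ) i)

cells : ∀ {n} (μ : Partition n) → List (Cell μ)
cells μ = concatMap (λ i → map (i ,_) (allFin _)) (allFin _)

#cellsUnderFirstRow : ∀ {n} → Partition n → ℕ
#cellsUnderFirstRow μ =
  length (filter (λ (i , _) → 1 ℕₚ.≤? toℕ i) (cells μ))

------------------------------------------------------------------------
-- Specht modules

module _ {n : ℕ} (μ : Partition n) where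

  Tableau : Set
  Tableau = Cell μ ↔ Fin n

  -- The left action of the symmetric group on entries.
  _·ₜ_ : Permutation′ n → Tableau → Tableau
  σ ·ₜ T = ↔-trans T σ

  rowOf : Tableau → Fin n → Fin (#parts μ)
  rowOf T x = proj₁ (Inverse.from T x)

  columnOf : Tableau → Fin n → ℕ
  columnOf T x = toℕ (proj₂ (Inverse.from T x))

  -- Row equivalence; its classes are the tabloids.
  _∼_ : Tableau → Tableau → Set
  T ∼ T′ = ∀ x → rowOf T x ≡ rowOf T′ x

  _∼?_ : ∀ T T′ → Dec (T ∼ T′)
  T ∼? T′ = Finₚ.all? λ x → rowOf T x Finₚ.≟ rowOf T′ x

  PreservesColumns : Tableau → Permutation′ n → Set
  PreservesColumns T q = ∀ x → columnOf T (q ⟨$⟩ʳ x) ≡ columnOf T x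

  preservesColumns? : ∀ T q → Dec (PreservesColumns T q)
  preservesColumns? T q =
    Finₚ.all? λ x → columnOf T (q ⟨$⟩ʳ x) ℕₚ.≟ columnOf T x

  columnStabiliser : Tableau → List (Permutation′ n)
  columnStabiliser T = filter (preservesColumns? T) (permutations n)

  -- The permutation module M^μ on tabloids consists of the functions on
  -- tableaux that are constant on row-equivalence classes.  Everything
  -- below takes place in the linear span of the indicator functions of
  -- these classes, so the constancy is not imposed on the ambient type.
  Vector : Set
  Vector = Tableau → ℚ

  _≈_ : Vector → Vector → Set
  v ≈ w = ∀ T → v T ≡ w T

  -- With this action, σ · tabloid T ≈ tabloid (σ ·ₜ T).
  _·_ : Permutation′ n → Vector → Vector
  (σ · v) T = v (flip σ ·ₜ T)

  tabloid : Tableau → Vector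
  tabloid T T′ = if ⌊ T ∼? T′ ⌋ then 1ℚ else 0ℚ

  polytabloid : Tableau → Vector
  polytabloid T T′ =
    ∑ (columnStabiliser T) λ q → sgn q * tabloid (q ·ₜ T) T′

  -- Membership in the Specht module S^μ, the span of the polytabloids.
  InSpecht : Vector → Set
  InSpecht v = ∃ λ (cs : List (ℚ × Tableau)) →
    v ≈ λ T′ → ∑ cs λ (c , T) → c * polytabloid T T′

  combination : ∀ {d} → (Fin d → Vector) → (Fin d → ℚ) → Vector
  combination b c T = sum λ i → c i * b i T

  -- The matrices of the symmetric group acting on S^μ, relative to some
  -- basis.  They are determined by the basis, and σ ↦ matrix σ is then
  -- a homomorphism.  S^μ over ℚ is absolutely irreducible, so its
  -- character is the irreducible complex character χ_μ; for μ = (n) it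
  -- is the trivial one.
  record SpechtRepresentation : Set where
    field
      dim         : ℕ
      basis       : Fin dim → Vector
      inSpecht    : ∀ j → InSpecht (basis j)
      independent : ∀ c → combination basis c ≈ (λ _ → 0ℚ) → ∀ i → c i ≡ 0ℚ
      spanning    : ∀ v → InSpecht v → ∃ λ c → v ≈ combination basis c
      matrix      : Permutation′ n → Fin dim → Fin dim → ℚ
      action      : ∀ σ j →
        (σ · basis j) ≈ combination basis (λ i → matrix σ i j)

------------------------------------------------------------------------
-- Characters and eigenvalues

module _ {n : ℕ} {μ : Partition n} (V : SpechtRepresentation μ) where
  open SpechtRepresentation V

  χ : Permutation′ n → ℚ
  χ σ = sum λ i → matrix σ i i

  -- The eigenvalue η_μ(k) of the k-point fixing graph.
  η : ℕ → ℚ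
  η k = ∑ (𝒮 n k) χ ÷₀ χ idₚ

{-# OPTIONS --safe #-}

-- Let T be a tableau of shape λ.  The class sum of S(n,1) is central, so it
-- sends the polytabloid of T to a vector that is antisymmetric under the
-- column group of T; by the basic combinatorial lemma such a vector is a
-- multiple c of the polytabloid, and c = η_λ(1).  Explicitly c is the sum of
-- sgn q over the row permutations p and column permutations q for which
-- p q⁻¹ fixes one point, and the fixed points of p q⁻¹ correspond to the
-- common fixed points of p and q.
--
-- With y = x - 1, the sum of sgn q x^#(common fixed points) over all p and q
-- is Σ_U y^(n - |U|) Π uᵢ!, where U runs over the sets of cells with at most
-- one cell in each column and uᵢ is the number of cells of U in row i.
-- Adding the rows from bottom to top, this is y^(n - λ₁) G_λ(x), where
-- G_∅ = 1 and G_λ(s) = (1 - d/ds)⁻¹ (s - 1)^(λ₁ - λ₂) G_μ(s), μ = (λ₂, λ₃, …).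
-- Taking x = ε with ε² = 0 gives c = (-1)^(m - 1) (m G_λ(0) - G_λ′(0)) for
-- m = n - λ₁.
--
-- Since (1 - D)⁻¹ (s - 1) = (s + (1 - D)⁻¹ D) (1 - D)⁻¹ for D = d/ds, the
-- coefficients of G_λ are natural numbers.  Moreover
-- G_λ(0) = G_λ′(0) + (-1)^(λ₁ - λ₂) G_μ(0), which leaves a comparison of
-- m G_λ(0) with G_λ(0) ± G_μ(0); only λ₁ = λ₂ + 1 is delicate.

module Submission where

open import Algebra.Bundles using (CommutativeSemiring)
import Algebra.Definitions.RawMonoid
import Algebra.Properties.Group
import Algebra.Solver.Ring.NaturalCoefficients.Default
open import Algebra.Structures using (IsCommutativeSemiring; IsCommutativeRing)
open import Algebra.Structures.Biased using (isCommutativeSemiringˡ)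
open import Data.Bool.Base using (if_then_else_)
open import Data.Fin.Base as Fin
  using (Fin; zero; suc; toℕ; fromℕ<; punchIn; punchOut; splitAt; _↑ˡ_; _↑ʳ_)
import Data.Fin.Induction as Finᵢ
open import Data.Fin.Permutation
  using (Permutation′; _⟨$⟩ʳ_; _⟨$⟩ˡ_; inverseˡ; inverseʳ; flip; _∘ₚ_; insert; remove;
         punchIn-permute; permutation; transpose; _≈_)
  renaming (id to idₚ)
import Data.Fin.Properties as Finₚ
open import Data.Integer.Base as ℤ using (ℤ; 0ℤ; 1ℤ; -1ℤ; +0; +[1+_]; -[1+_])
import Data.Integer.Properties as ℤₚ
open import Data.List.Base as List
  using (List; []; _∷_; _++_; map; filter; length; lookup; concatMap; replicate;
         cartesianProduct; allFin; tabulate)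
import Data.List.Membership.DecPropositional
open import Data.List.Membership.Propositional using (_∈_; _∉_; find)
open import Data.List.Membership.Propositional.Properties
  using (∈-lookup; ∈-++⁺ˡ; ∈-++⁺ʳ; ∈-++⁻; ∈-map⁺; ∈-allFin)
import Data.List.Properties as Listₚ
open import Data.List.Relation.Unary.All as All using (All; []; _∷_)
import Data.List.Relation.Unary.All.Properties as Allₚ
open import Data.List.Relation.Unary.AllPairs as AllPairs using (AllPairs; []; _∷_)
import Data.List.Relation.Unary.AllPairs.Properties as AllPairsₚ
open import Data.List.Relation.Unary.Any as Any using (Any; here; there)
open import Data.List.Relation.Unary.Linked as Linked using (Linked; []; [-]; _∷_)
open import Data.List.Relation.Unary.Linked.Properties using (Linked⇒AllPairs)
open import Data.List.Relation.Unary.Unique.Propositional using (Unique)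
import Data.List.Relation.Unary.Unique.Propositional.Properties as Uniqueₚ
open import Data.Maybe.Base using (fromMaybe)
open import Data.Nat.Base as ℕ using (ℕ; zero; suc; _≥_; _∸_; s≤s; z≤n)
import Data.Nat.ListAction as ListAction
import Data.Nat.Properties as ℕₚ
open import Data.Nat.Tactic.RingSolver using (solve-∀)
open import Data.Product.Base using (Σ; ∃; ∃₂; _×_; _,_; proj₁; proj₂)
open import Data.Rational.Base as ℚ using (ℚ; 0ℚ; 1ℚ; ½; mkℚ)
import Data.Rational.Properties as ℚₚ
open import Data.Rational.Solver using (module +-*-Solver)
open import Data.Sum.Base using (_⊎_; inj₁; inj₂; [_,_]′)
open import Function.Base using (_∘_; id)
open import Function.Bundles using (_↔_; _⇔_; Inverse; mk↔ₛ′; mk⇔)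
open import Induction.WellFounded using (Acc; acc)
open import Relation.Binary.Definitions using (tri<; tri≈; tri>)
open import Relation.Binary.PropositionalEquality
open import Relation.Nullary.Decidable using (Dec; yes; no; ⌊_⌋; _×-dec_; _⊎-dec_; ¬?)
open import Relation.Nullary.Negation using (¬_; contradiction)

-- Write x as 1 + y at every entry. Then U is the set of entries not forced to be common fixed
-- points. If U has two cells in one column, their transposition pairs off the column permutations
-- supported on U with opposite signs; otherwise only the identity is left. The product of the uᵢ!
-- counts the row permutations supported on U.
--
-- (1 - d/ds)⁻¹ sends p(s) to the expectation of p(s + t) for an exponential variable t, whose
-- moments are the factorials. A row with f free cells contributes the expectation of (y + t)ᶠ, and
-- y = s - 1 at s = x; this is where the recursion for G_λ comes from.
--
-- The obstacle is λ₁ = λ₂ + 1, where G_μ(0) < (|μ| - 1) G_λ(0) has to be shown. For μ₁ ≥ 2 one has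
-- G_λ(0) ≥ G_μ′(0) + 2, so it is enough to compare G_μ(0) with G_μ′(0). The plain bound G_μ(0) ≤
-- (|μ| - 1) G_μ′(0) fails for μ = (2), where G_μ = s² + 1. Hence the induction carries a slack: 1
-- added to G_μ(0) and 2 added to G_μ′(0), as soon as μ₁ ≥ 2.

-- Finite sums and products over a commutative semiring

module Summation where

  -- One development serves three semirings: ℕ for counting and for the final inequalities, ℚ for
  -- characters, and the dual numbers for the generating function.
  record ≡-CommutativeSemiring : Set₁ where
    infixl 6 _+_
    infixl 7 _*_
    field
      R       : Set
      _+_ _*_ : R → R → R
      0# 1#   : R
      isCommutativeSemiring : IsCommutativeSemiring _≡_ _+_ _*_ 0# 1#

  module Sums (S : ≡-CommutativeSemiring) where
    open ≡-CommutativeSemiring S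

    commutativeSemiring : CommutativeSemiring _ _
    commutativeSemiring = record { isCommutativeSemiring = isCommutativeSemiring }

    module Solver = Algebra.Solver.Ring.NaturalCoefficients.Default commutativeSemiring

    open IsCommutativeSemiring isCommutativeSemiring public
      using (+-assoc; +-comm; +-identityˡ; +-identityʳ;
             *-assoc; *-comm; *-identityˡ; *-identityʳ;
             distribˡ; distribʳ; zeroˡ; zeroʳ)
    open ≡-Reasoning

    +-exchange : ∀ a b c d → (a + b) + (c + d) ≡ (a + c) + (b + d)
    +-exchange a b c d = begin
      (a + b) + (c + d)  ≡⟨ +-assoc a b (c + d) ⟩
      a + (b + (c + d))  ≡⟨ cong (a +_) (sym (+-assoc b c d)) ⟩
      a + ((b + c) + d)  ≡⟨ cong (λ z → a + (z + d)) (+-comm b c) ⟩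
      a + ((c + b) + d)  ≡⟨ cong (a +_) (+-assoc c b d) ⟩
      a + (c + (b + d))  ≡⟨ sym (+-assoc a c (b + d)) ⟩
      (a + c) + (b + d)  ∎

    *-swapˡ : ∀ a b c → a * (b * c) ≡ b * (a * c)
    *-swapˡ a b c = begin
      a * (b * c)  ≡⟨ sym (*-assoc a b c) ⟩
      (a * b) * c  ≡⟨ cong (_* c) (*-comm a b) ⟩
      (b * a) * c  ≡⟨ *-assoc b a c ⟩
      b * (a * c)  ∎

    ∑ : ∀ {a} {A : Set a} → List A → (A → R) → R
    ∑ []       f = 0#
    ∑ (x ∷ xs) f = f x + ∑ xs f

    ∏ : ∀ {a} {A : Set a} → List A → (A → R) → R
    ∏ []       f = 1#
    ∏ (x ∷ xs) f = f x * ∏ xs f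

    nat : ℕ → R
    nat zero    = 0#
    nat (suc k) = 1# + nat k

    pow : R → ℕ → R
    pow x zero    = 1#
    pow x (suc k) = x * pow x k

    ⟦_⟧ : ∀ {p} {P : Set p} → Dec P → R
    ⟦ d ⟧ = if ⌊ d ⌋ then 1# else 0#

    nat-+ : ∀ j k → nat (j ℕ.+ k) ≡ nat j + nat k
    nat-+ zero    k = sym (+-identityˡ _)
    nat-+ (suc j) k = trans (cong (1# +_) (nat-+ j k)) (sym (+-assoc _ _ _))

    nat-* : ∀ j k → nat (j ℕ.* k) ≡ nat j * nat k
    nat-* zero    k = sym (zeroˡ _)
    nat-* (suc j) k = begin
      nat (k ℕ.+ j ℕ.* k)          ≡⟨ nat-+ k (j ℕ.* k) ⟩
      nat k + nat (j ℕ.* k)        ≡⟨ cong₂ _+_ (sym (*-identityˡ _)) (nat-* j k) ⟩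
      1# * nat k + nat j * nat k   ≡⟨ sym (distribʳ _ _ _) ⟩
      (1# + nat j) * nat k         ∎

    pow-+ : ∀ x j k → pow x (j ℕ.+ k) ≡ pow x j * pow x k
    pow-+ x zero    k = sym (*-identityˡ _)
    pow-+ x (suc j) k = trans (cong (x *_) (pow-+ x j k)) (sym (*-assoc _ _ _))

    module _ {p} {P : Set p} where

      ⟦⟧-yes : (d : Dec P) → P → ⟦ d ⟧ ≡ 1#
      ⟦⟧-yes (yes _) _ = refl
      ⟦⟧-yes (no ¬p) p = contradiction p ¬p

      ⟦⟧-no : (d : Dec P) → ¬ P → ⟦ d ⟧ ≡ 0#
      ⟦⟧-no (yes p) ¬p = contradiction p ¬p
      ⟦⟧-no (no _)  _  = refl

      ⟦⟧*-cong : (d : Dec P) {x y : R} → (P → x ≡ y) → ⟦ d ⟧ * x ≡ ⟦ d ⟧ * y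
      ⟦⟧*-cong (yes p) e = cong (1# *_) (e p)
      ⟦⟧*-cong (no _)  e = trans (zeroˡ _) (sym (zeroˡ _))

    module _ {p q} {P : Set p} {Q : Set q} where

      ⟦⟧-cong : (d : Dec P) (e : Dec Q) → (P → Q) → (Q → P) → ⟦ d ⟧ ≡ ⟦ e ⟧
      ⟦⟧-cong (yes p) e f g = sym (⟦⟧-yes e (f p))
      ⟦⟧-cong (no ¬p) e f g = sym (⟦⟧-no e (¬p ∘ g))

      ⟦⟧-× : (d : Dec P) (e : Dec Q) → ⟦ d ×-dec e ⟧ ≡ ⟦ d ⟧ * ⟦ e ⟧
      ⟦⟧-× (yes _) (yes _) = sym (*-identityˡ _)
      ⟦⟧-× (yes _) (no  _) = sym (*-identityˡ _)
      ⟦⟧-× (no  _) e       = sym (zeroˡ _)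

    module _ {a} {A : Set a} where

      ∑-cong : (xs : List A) {f g : A → R} → (∀ x → f x ≡ g x) → ∑ xs f ≡ ∑ xs g
      ∑-cong []       e = refl
      ∑-cong (x ∷ xs) e = cong₂ _+_ (e x) (∑-cong xs e)

      ∑-zero : (xs : List A) {f : A → R} → (∀ x → f x ≡ 0#) → ∑ xs f ≡ 0#
      ∑-zero []       e = refl
      ∑-zero (x ∷ xs) e = trans (cong₂ _+_ (e x) (∑-zero xs e)) (+-identityˡ _)

      ∑-+ : (xs : List A) (f g : A → R) → ∑ xs (λ x → f x + g x) ≡ ∑ xs f + ∑ xs g
      ∑-+ []       f g = sym (+-identityˡ _)
      ∑-+ (x ∷ xs) f g = trans (cong (_ +_) (∑-+ xs f g)) (+-exchange _ _ _ _)

      ∑-*ˡ : (xs : List A) (c : R) (f : A → R) → ∑ xs (λ x → c * f x) ≡ c * ∑ xs f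
      ∑-*ˡ []       c f = sym (zeroʳ c)
      ∑-*ˡ (x ∷ xs) c f = trans (cong (_ +_) (∑-*ˡ xs c f)) (sym (distribˡ _ _ _))

      ∑-*ʳ : (xs : List A) (c : R) (f : A → R) → ∑ xs (λ x → f x * c) ≡ ∑ xs f * c
      ∑-*ʳ xs c f = trans (∑-cong xs λ x → *-comm (f x) c)
                          (trans (∑-*ˡ xs c f) (*-comm c _))

      ∑-++ : (xs ys : List A) (f : A → R) → ∑ (xs ++ ys) f ≡ ∑ xs f + ∑ ys f
      ∑-++ []       ys f = sym (+-identityˡ _)
      ∑-++ (x ∷ xs) ys f = trans (cong (_ +_) (∑-++ xs ys f)) (sym (+-assoc _ _ _))

      ∑-filter : ∀ {p} {P : A → Set p} (P? : ∀ x → Dec (P x)) (xs : List A) (f : A → R) →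
        ∑ (filter P? xs) f ≡ ∑ xs (λ x → ⟦ P? x ⟧ * f x)
      ∑-filter P? []       f = refl
      ∑-filter P? (x ∷ xs) f with P? x
      ... | yes _ = cong₂ _+_ (sym (*-identityˡ _)) (∑-filter P? xs f)
      ... | no  _ = trans (∑-filter P? xs f)
                          (sym (trans (cong (_+ ∑ xs (λ z → ⟦ P? z ⟧ * f z)) (zeroˡ _)) (+-identityˡ _)))

    module _ {a b} {A : Set a} {B : Set b} where

      ∑-map : (h : A → B) (xs : List A) (f : B → R) → ∑ (map h xs) f ≡ ∑ xs (f ∘ h)
      ∑-map h []       f = refl
      ∑-map h (x ∷ xs) f = cong (_ +_) (∑-map h xs f)

      ∑-concatMap : (h : A → List B) (xs : List A) (f : B → R) →
        ∑ (concatMap h xs) f ≡ ∑ xs (λ x → ∑ (h x) f)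
      ∑-concatMap h []       f = refl
      ∑-concatMap h (x ∷ xs) f =
        trans (∑-++ (h x) (concatMap h xs) f) (cong (_ +_) (∑-concatMap h xs f))

      ∑-swap : (xs : List A) (ys : List B) (f : A → B → R) →
        ∑ xs (λ x → ∑ ys (f x)) ≡ ∑ ys (λ y → ∑ xs (λ x → f x y))
      ∑-swap []       ys f = sym (∑-zero ys λ _ → refl)
      ∑-swap (x ∷ xs) ys f = trans (cong (_ +_) (∑-swap xs ys f)) (sym (∑-+ ys _ _))

      -- A relation all of whose row and column sums are 1 is a bijection
      -- between the indices.
      ∑-reindex : (xs : List A) (ys : List B) {f : A → R} {g : B → R}
        {_∼_ : A → B → Set} (_∼?_ : ∀ x y → Dec (x ∼ y)) →
        (∀ x → ∑ ys (λ y → ⟦ x ∼? y ⟧) ≡ 1#) →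
        (∀ y → ∑ xs (λ x → ⟦ x ∼? y ⟧) ≡ 1#) →
        (∀ x y → x ∼ y → f x ≡ g y) →
        ∑ xs f ≡ ∑ ys g
      ∑-reindex xs ys {f} {g} _∼?_ rows cols e = begin
        ∑ xs f
          ≡⟨ ∑-cong xs (λ x → sym (trans (cong (_* f x) (rows x)) (*-identityˡ _))) ⟩
        ∑ xs (λ x → ∑ ys (λ y → ⟦ x ∼? y ⟧) * f x)
          ≡⟨ ∑-cong xs (λ x → sym (∑-*ʳ ys (f x) _)) ⟩
        ∑ xs (λ x → ∑ ys (λ y → ⟦ x ∼? y ⟧ * f x))
          ≡⟨ ∑-cong xs (λ x → ∑-cong ys λ y → ⟦⟧*-cong (x ∼? y) (e x y)) ⟩
        ∑ xs (λ x → ∑ ys (λ y → ⟦ x ∼? y ⟧ * g y))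
          ≡⟨ ∑-swap xs ys _ ⟩
        ∑ ys (λ y → ∑ xs (λ x → ⟦ x ∼? y ⟧ * g y))
          ≡⟨ ∑-cong ys (λ y → ∑-*ʳ xs (g y) _) ⟩
        ∑ ys (λ y → ∑ xs (λ x → ⟦ x ∼? y ⟧) * g y)
          ≡⟨ ∑-cong ys (λ y → trans (cong (_* g y) (cols y)) (*-identityˡ _)) ⟩
        ∑ ys g ∎

    ∑-tabulate : ∀ {a} {A : Set a} n (h : Fin n → A) (f : A → R) →
      ∑ (tabulate h) f ≡ ∑ (allFin n) (f ∘ h)
    ∑-tabulate n h f = trans (cong (λ z → ∑ z f) (sym (Listₚ.map-tabulate id h)))
                             (∑-map h (allFin n) f)

    ∑-allFin-suc : ∀ n (f : Fin (suc n) → R) →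
      ∑ (allFin (suc n)) f ≡ f zero + ∑ (allFin n) (f ∘ suc)
    ∑-allFin-suc n f = cong (f zero +_) (∑-tabulate n suc f)

    ∑-allFin-≟ : ∀ {n} (j : Fin n) → ∑ (allFin n) (λ i → ⟦ i Finₚ.≟ j ⟧) ≡ 1#
    ∑-allFin-≟ {suc n} zero = trans (∑-allFin-suc n _)
      (trans (cong (1# +_) (∑-zero (allFin n) λ i → ⟦⟧-no (suc i Finₚ.≟ zero) λ ()))
             (+-identityʳ _))
    ∑-allFin-≟ {suc n} (suc j) = trans (∑-allFin-suc n _)
      (trans (+-identityˡ _)
      (trans (∑-cong (allFin n) λ i →
               ⟦⟧-cong (suc i Finₚ.≟ suc j) (i Finₚ.≟ j) Finₚ.suc-injective (cong suc))
             (∑-allFin-≟ j)))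

    ∑-allFin-≟′ : ∀ {n} (j : Fin n) → ∑ (allFin n) (λ i → ⟦ j Finₚ.≟ i ⟧) ≡ 1#
    ∑-allFin-≟′ j = trans (∑-cong (allFin _) λ i → ⟦⟧-cong (j Finₚ.≟ i) (i Finₚ.≟ j) sym sym)
                          (∑-allFin-≟ j)

    ∑-allFin-only : ∀ {n} (j : Fin n) (f : Fin n → R) →
      ∑ (allFin n) (λ i → ⟦ i Finₚ.≟ j ⟧ * f i) ≡ f j
    ∑-allFin-only {n} j f = begin
      ∑ (allFin n) (λ i → ⟦ i Finₚ.≟ j ⟧ * f i)
        ≡⟨ ∑-cong (allFin n) (λ i → ⟦⟧*-cong (i Finₚ.≟ j) (cong f)) ⟩
      ∑ (allFin n) (λ i → ⟦ i Finₚ.≟ j ⟧ * f j)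
        ≡⟨ ∑-*ʳ (allFin n) (f j) _ ⟩
      ∑ (allFin n) (λ i → ⟦ i Finₚ.≟ j ⟧) * f j
        ≡⟨ trans (cong (_* f j) (∑-allFin-≟ j)) (*-identityˡ _) ⟩
      f j ∎

-- Sums over the symmetric group and the sign character

module Permutations where
  open Summation
  open import Defs using (permutations; inversions; sgn; #fixed)

  infix 4 _≈?_

  _≈?_ : ∀ {n} (σ τ : Permutation′ n) → Dec (σ ≈ τ)
  σ ≈? τ = Finₚ.all? λ i → (σ ⟨$⟩ʳ i) Finₚ.≟ (τ ⟨$⟩ʳ i)

  permute-injective : ∀ {n} (σ : Permutation′ n) {x y} → σ ⟨$⟩ʳ x ≡ σ ⟨$⟩ʳ y → x ≡ y
  permute-injective σ e = trans (sym (inverseˡ σ)) (trans (cong (σ ⟨$⟩ˡ_) e) (inverseˡ σ))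

  ≡⇒≡ˡ : ∀ {n} (σ : Permutation′ n) {x y} → σ ⟨$⟩ʳ x ≡ y → x ≡ σ ⟨$⟩ˡ y
  ≡⇒≡ˡ σ e = trans (sym (inverseˡ σ)) (cong (σ ⟨$⟩ˡ_) e)

  ≡ˡ⇒≡ : ∀ {n} (σ : Permutation′ n) {x y} → x ≡ σ ⟨$⟩ˡ y → σ ⟨$⟩ʳ x ≡ y
  ≡ˡ⇒≡ σ e = trans (cong (σ ⟨$⟩ʳ_) e) (inverseʳ σ)

  module PermutationSums (S : ≡-CommutativeSemiring) where
    open ≡-CommutativeSemiring S
    open Sums S
    open ≡-Reasoning

    -- A permutation is determined by the image of zero and by what is left after removing zero, and
    -- `insert` runs through exactly these pairs. All reindexing of sums over the group rests on
    -- this.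
    ∑-permutations-≈ : ∀ {n} (τ : Permutation′ n) →
      ∑ (permutations n) (λ σ → ⟦ σ ≈? τ ⟧) ≡ 1#
    ∑-permutations-≈ {zero}  τ = +-identityʳ _
    ∑-permutations-≈ {suc n} τ = begin
      ∑ (permutations (suc n)) (λ σ → ⟦ σ ≈? τ ⟧)
        ≡⟨ ∑-concatMap (λ j → map (insert zero j) (permutations n)) (allFin (suc n)) _ ⟩
      ∑ (allFin (suc n)) (λ j → ∑ (map (insert zero j) (permutations n)) λ σ → ⟦ σ ≈? τ ⟧)
        ≡⟨ ∑-cong (allFin (suc n)) (λ j → ∑-map (insert zero j) (permutations n) _) ⟩
      ∑ (allFin (suc n)) (λ j → ∑ (permutations n) λ π → ⟦ insert zero j π ≈? τ ⟧)
        ≡⟨ ∑-cong (allFin (suc n)) (λ j → ∑-cong (permutations n) λ π →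
             trans (⟦⟧-cong (insert zero j π ≈? τ) ((j Finₚ.≟ j₀) ×-dec (π ≈? τ₀))
                            (split j π) (λ (e , e′) → join j π e e′))
                   (⟦⟧-× (j Finₚ.≟ j₀) (π ≈? τ₀))) ⟩
      ∑ (allFin (suc n)) (λ j → ∑ (permutations n) λ π → ⟦ j Finₚ.≟ j₀ ⟧ * ⟦ π ≈? τ₀ ⟧)
        ≡⟨ ∑-cong (allFin (suc n)) (λ j → ∑-*ˡ (permutations n) _ _) ⟩
      ∑ (allFin (suc n)) (λ j → ⟦ j Finₚ.≟ j₀ ⟧ * ∑ (permutations n) (λ π → ⟦ π ≈? τ₀ ⟧))
        ≡⟨ ∑-allFin-only j₀ _ ⟩
      ∑ (permutations n) (λ π → ⟦ π ≈? τ₀ ⟧)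
        ≡⟨ ∑-permutations-≈ τ₀ ⟩
      1# ∎
      where
      j₀ = τ ⟨$⟩ʳ zero
      τ₀ = remove zero τ

      split : ∀ j π → insert zero j π ≈ τ → (j ≡ j₀) × (π ≈ τ₀)
      split j π e = e zero , λ k → Finₚ.punchIn-injective j₀ _ _ (begin
        punchIn j₀ (π ⟨$⟩ʳ k)   ≡⟨ cong (λ i → punchIn i (π ⟨$⟩ʳ k)) (sym (e zero)) ⟩
        punchIn j (π ⟨$⟩ʳ k)    ≡⟨ e (suc k) ⟩
        τ ⟨$⟩ʳ suc k            ≡⟨ punchIn-permute τ zero k ⟩
        punchIn j₀ (τ₀ ⟨$⟩ʳ k)  ∎)

      join : ∀ j π → j ≡ j₀ → π ≈ τ₀ → insert zero j π ≈ τ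
      join j π e e′ zero    = e
      join j π e e′ (suc k) = begin
        punchIn j (π ⟨$⟩ʳ k)    ≡⟨ cong₂ punchIn e (e′ k) ⟩
        punchIn j₀ (τ₀ ⟨$⟩ʳ k)  ≡⟨ sym (punchIn-permute τ zero k) ⟩
        τ ⟨$⟩ʳ suc k            ∎

    -- A permutation carries its inverse and proofs, so pointwise equal permutations need not be
    -- equal. A sum can be reindexed only if its summand sees nothing but the values.
    Extensional : ∀ {n} → (Permutation′ n → R) → Set
    Extensional f = ∀ {σ τ} → σ ≈ τ → f σ ≡ f τ

    ∑-permutations-reindex : ∀ {n} (φ φ⁻¹ : Permutation′ n → Permutation′ n) →
      (∀ {σ τ} → φ σ ≈ τ → σ ≈ φ⁻¹ τ) → (∀ {σ τ} → σ ≈ φ⁻¹ τ → φ σ ≈ τ) →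
      (f : Permutation′ n → R) → Extensional f →
      ∑ (permutations n) (f ∘ φ) ≡ ∑ (permutations n) f
    ∑-permutations-reindex {n} φ φ⁻¹ to from f ext =
      ∑-reindex (permutations n) (permutations n) (λ σ τ → φ σ ≈? τ)
        (λ σ → trans (∑-cong (permutations n) λ τ →
                 ⟦⟧-cong (φ σ ≈? τ) (τ ≈? φ σ) (λ e i → sym (e i)) (λ e i → sym (e i)))
               (∑-permutations-≈ (φ σ)))
        (λ τ → trans (∑-cong (permutations n) λ σ →
                 ⟦⟧-cong (φ σ ≈? τ) (σ ≈? φ⁻¹ τ) to from)
               (∑-permutations-≈ (φ⁻¹ τ)))
        (λ σ τ → ext)

    ∑-permutations-∘ʳ : ∀ {n} (t : Permutation′ n) (f : Permutation′ n → R) → Extensional f →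
      ∑ (permutations n) (λ σ → f (σ ∘ₚ t)) ≡ ∑ (permutations n) f
    ∑-permutations-∘ʳ t = ∑-permutations-reindex (_∘ₚ t) (_∘ₚ flip t)
      (λ e i → ≡⇒≡ˡ t (e i)) (λ e i → ≡ˡ⇒≡ t (e i))

    ∑-permutations-∘ˡ : ∀ {n} (t : Permutation′ n) (f : Permutation′ n → R) → Extensional f →
      ∑ (permutations n) (λ σ → f (t ∘ₚ σ)) ≡ ∑ (permutations n) f
    ∑-permutations-∘ˡ t = ∑-permutations-reindex (t ∘ₚ_) (flip t ∘ₚ_)
      (λ {σ} e i → trans (cong (σ ⟨$⟩ʳ_) (sym (inverseʳ t))) (e (t ⟨$⟩ˡ i)))
      (λ {σ} {τ} e i → trans (e (t ⟨$⟩ʳ i)) (cong (τ ⟨$⟩ʳ_) (inverseˡ t)))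

    ∑-permutations-only-id : ∀ {n} (f : Permutation′ n → R) → Extensional f →
      ∑ (permutations n) (λ σ → ⟦ σ ≈? idₚ ⟧ * f σ) ≡ f idₚ
    ∑-permutations-only-id {n} f ext = begin
      ∑ (permutations n) (λ σ → ⟦ σ ≈? idₚ ⟧ * f σ)
        ≡⟨ ∑-cong (permutations n) (λ σ → ⟦⟧*-cong (σ ≈? idₚ) ext) ⟩
      ∑ (permutations n) (λ σ → ⟦ σ ≈? idₚ ⟧ * f idₚ)
        ≡⟨ ∑-*ʳ (permutations n) _ _ ⟩
      ∑ (permutations n) (λ σ → ⟦ σ ≈? idₚ ⟧) * f idₚ
        ≡⟨ trans (cong (_* f idₚ) (∑-permutations-≈ (idₚ {n}))) (*-identityˡ _) ⟩
      f idₚ ∎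

    ∑-allFin-permute : ∀ {n} (t : Permutation′ n) (f : Fin n → R) →
      ∑ (allFin n) (λ i → f (t ⟨$⟩ʳ i)) ≡ ∑ (allFin n) f
    ∑-allFin-permute {n} t f =
      ∑-reindex (allFin n) (allFin n) (λ i j → (t ⟨$⟩ʳ i) Finₚ.≟ j)
        (λ i → ∑-allFin-≟′ (t ⟨$⟩ʳ i))
        (λ j → trans (∑-cong (allFin n) λ i →
                 ⟦⟧-cong ((t ⟨$⟩ʳ i) Finₚ.≟ j) (i Finₚ.≟ (t ⟨$⟩ˡ j)) (≡⇒≡ˡ t) (≡ˡ⇒≡ t))
               (∑-allFin-≟ (t ⟨$⟩ˡ j)))
        (λ i j → cong f)

  ℕ-semiring : ≡-CommutativeSemiring
  ℕ-semiring = record { isCommutativeSemiring = ℕₚ.+-*-isCommutativeSemiring }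

  ℚ-semiring : ≡-CommutativeSemiring
  ℚ-semiring = record
    { isCommutativeSemiring = IsCommutativeRing.isCommutativeSemiring ℚₚ.+-*-isCommutativeRing }

  module Σℕ where
    open Sums ℕ-semiring public
    open PermutationSums ℕ-semiring public

  module Σℚ where
    open Sums ℚ-semiring public
    open PermutationSums ℚ-semiring public

  length-filter : ∀ {a p} {A : Set a} {P : A → Set p} (P? : ∀ x → Dec (P x)) (xs : List A) →
    length (filter P? xs) ≡ Σℕ.∑ xs (λ x → Σℕ.⟦ P? x ⟧)
  length-filter P? []       = refl
  length-filter P? (x ∷ xs) with P? x
  ... | yes _ = cong suc (length-filter P? xs)
  ... | no  _ = length-filter P? xs

  ∑-cartesianProduct : ∀ {a b} {A : Set a} {B : Set b} (xs : List A) (ys : List B)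
    (f : A × B → ℕ) →
    Σℕ.∑ (cartesianProduct xs ys) f ≡ Σℕ.∑ xs (λ x → Σℕ.∑ ys (λ y → f (x , y)))
  ∑-cartesianProduct []       ys f = refl
  ∑-cartesianProduct (x ∷ xs) ys f =
    trans (Σℕ.∑-++ (map (x ,_) ys) (cartesianProduct xs ys) f)
          (cong₂ ℕ._+_ (Σℕ.∑-map (x ,_) ys f) (∑-cartesianProduct xs ys f))

  #fixed-∑ : ∀ {n} (σ : Permutation′ n) →
    #fixed σ ≡ Σℕ.∑ (allFin n) (λ i → Σℕ.⟦ (σ ⟨$⟩ʳ i) Finₚ.≟ i ⟧)
  #fixed-∑ {n} σ = length-filter (λ i → (σ ⟨$⟩ʳ i) Finₚ.≟ i) (allFin n)

  module _ where
    open Σℕ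
    open import Data.Nat.Base using (_+_; _*_)

    private
      lt : ∀ {n} → Fin n → Fin n → ℕ
      lt i j = ⟦ i Finₚ.<? j ⟧

      ∑∑ : ∀ {n} → (Fin n → Fin n → ℕ) → ℕ
      ∑∑ {n} f = ∑ (allFin n) λ i → ∑ (allFin n) (f i)

      ∑∑-cong : ∀ {n} {f g : Fin n → Fin n → ℕ} → (∀ i j → f i j ≡ g i j) → ∑∑ f ≡ ∑∑ g
      ∑∑-cong {n} e = ∑-cong (allFin n) λ i → ∑-cong (allFin n) (e i)

      ∑∑-+ : ∀ {n} (f g : Fin n → Fin n → ℕ) → ∑∑ (λ i j → f i j + g i j) ≡ ∑∑ f + ∑∑ g
      ∑∑-+ {n} f g = trans (∑-cong (allFin n) λ i → ∑-+ (allFin n) (f i) (g i))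
                           (∑-+ (allFin n) _ _)

      ∑∑-transpose : ∀ {n} (f : Fin n → Fin n → ℕ) → ∑∑ f ≡ ∑∑ (λ i j → f j i)
      ∑∑-transpose {n} f = ∑-swap (allFin n) (allFin n) f

      ∑∑-permute : ∀ {n} (t : Permutation′ n) (f : Fin n → Fin n → ℕ) →
        ∑∑ (λ i j → f (t ⟨$⟩ʳ i) (t ⟨$⟩ʳ j)) ≡ ∑∑ f
      ∑∑-permute {n} t f =
        trans (∑-cong (allFin n) λ i → ∑-allFin-permute t (f (t ⟨$⟩ʳ i)))
              (∑-allFin-permute t (λ i → ∑ (allFin n) (f i)))

      OneOf : ℕ → ℕ → Set
      OneOf x x′ = (x ≡ 1 × x′ ≡ 0) ⊎ (x ≡ 0 × x′ ≡ 1)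

      lt-total : ∀ {n} {i j : Fin n} → i ≢ j → OneOf (lt i j) (lt j i)
      lt-total {i = i} {j} i≢j with Finₚ.<-cmp i j
      ... | tri< a _ c = inj₁ (⟦⟧-yes (i Finₚ.<? j) a , ⟦⟧-no (j Finₚ.<? i) c)
      ... | tri≈ _ b _ = contradiction b i≢j
      ... | tri> a _ c = inj₂ (⟦⟧-no (i Finₚ.<? j) a , ⟦⟧-yes (j Finₚ.<? i) c)

      lt-irrefl : ∀ {n} (i : Fin n) → lt i i ≡ 0
      lt-irrefl i = ⟦⟧-no (i Finₚ.<? i) (ℕₚ.<-irrefl refl)

      lt-asym : ∀ {n} (i j : Fin n) → lt i j * lt j i ≡ 0
      lt-asym i j with i Finₚ.≟ j
      ... | yes refl = trans (cong (_* lt i i) (lt-irrefl i)) refl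
      ... | no i≢j   = product (lt-total i≢j)
        where
        product : ∀ {x x′} → OneOf x x′ → x * x′ ≡ 0
        product (inj₁ (refl , refl)) = refl
        product (inj₂ (refl , refl)) = refl

    inversions-∑ : ∀ {n} (σ : Permutation′ n) →
      inversions σ ≡ ∑∑ (λ i j → lt i j * lt (σ ⟨$⟩ʳ j) (σ ⟨$⟩ʳ i))
    inversions-∑ {n} σ =
      trans (length-filter _ (cartesianProduct (allFin n) (allFin n)))
      (trans (∑-cartesianProduct (allFin n) (allFin n) _)
             (∑∑-cong λ i j → ⟦⟧-× (i Finₚ.<? j) ((σ ⟨$⟩ʳ j) Finₚ.<? (σ ⟨$⟩ʳ i))))

    -- The pair {i,j} is inverted by σ after τ iff exactly one of τ, σ
    -- inverts it along the way; h tells whether σ inverts the pair {a,b}.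
    inversions-∘ : ∀ {n} (τ σ : Permutation′ n) →
      ∃ λ k → inversions (τ ∘ₚ σ) + (k + k) ≡ inversions τ + inversions σ
    inversions-∘ {n} τ σ = k , (begin
      inversions (τ ∘ₚ σ) + (k + k)
        ≡⟨ cong (_+ (k + k)) (inversions-∑ (τ ∘ₚ σ)) ⟩
      ∑∑ (λ i j → lt i j * lt (στ j) (στ i)) + (k + k)
        ≡⟨ sym (trans (∑∑-+ (λ i j → lt i j * lt (στ j) (στ i)) (λ i j → m i j + m i j))
                     (cong (∑∑ (λ i j → lt i j * lt (στ j) (στ i)) +_) (∑∑-+ m m))) ⟩
      ∑∑ (λ i j → lt i j * lt (στ j) (στ i) + (m i j + m i j))
        ≡⟨ ∑∑-cong pointwise ⟩
      ∑∑ (λ i j → lt i j * lt (τ ⟨$⟩ʳ j) (τ ⟨$⟩ʳ i) + lt i j * hτ i j)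
        ≡⟨ ∑∑-+ (λ i j → lt i j * lt (τ ⟨$⟩ʳ j) (τ ⟨$⟩ʳ i)) (λ i j → lt i j * hτ i j) ⟩
      ∑∑ (λ i j → lt i j * lt (τ ⟨$⟩ʳ j) (τ ⟨$⟩ʳ i)) + ∑∑ (λ i j → lt i j * hτ i j)
        ≡⟨ cong₂ _+_ (sym (inversions-∑ τ)) crossed ⟩
      inversions τ + inversions σ ∎)
      where
      open ≡-Reasoning
      στ = (τ ∘ₚ σ) ⟨$⟩ʳ_

      h hτ m : Fin n → Fin n → ℕ
      h a b = lt a b * lt (σ ⟨$⟩ʳ b) (σ ⟨$⟩ʳ a) + lt b a * lt (σ ⟨$⟩ʳ a) (σ ⟨$⟩ʳ b)
      hτ i j = h (τ ⟨$⟩ʳ i) (τ ⟨$⟩ʳ j)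
      -- A pair inverted by `τ` and inverted back by `σ` counts twice on the right and is no
      -- inversion of the composite.
      m i j = lt i j * lt (τ ⟨$⟩ʳ j) (τ ⟨$⟩ʳ i) * hτ i j

      k = ∑∑ m

      h-sym : ∀ a b → h a b ≡ h b a
      h-sym a b = ℕₚ.+-comm (lt a b * _) _

      pointwise : ∀ i j → lt i j * lt (στ j) (στ i) + (m i j + m i j) ≡
                          lt i j * lt (τ ⟨$⟩ʳ j) (τ ⟨$⟩ʳ i) + lt i j * hτ i j
      pointwise i j with i Finₚ.<? j
      ... | no  _ = refl
      ... | yes i<j = arith
          (lt-total {i = τ ⟨$⟩ʳ i} {τ ⟨$⟩ʳ j} (i≢j ∘ permute-injective τ))
          (lt-total {i = στ j} {στ i} (i≢j ∘ sym ∘ permute-injective (τ ∘ₚ σ)))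
        where
        i≢j : i ≢ j
        i≢j e = ℕₚ.<-irrefl (cong toℕ e) i<j

        arith : ∀ {x x′ s s′} → OneOf x x′ → OneOf s s′ →
          1 * s + (1 * x′ * (x * s + x′ * s′) + 1 * x′ * (x * s + x′ * s′)) ≡
          1 * x′ + 1 * (x * s + x′ * s′)
        arith (inj₁ (refl , refl)) (inj₁ (refl , refl)) = refl
        arith (inj₁ (refl , refl)) (inj₂ (refl , refl)) = refl
        arith (inj₂ (refl , refl)) (inj₁ (refl , refl)) = refl
        arith (inj₂ (refl , refl)) (inj₂ (refl , refl)) = refl

      double-injective : ∀ {a b} → a + a ≡ b + b → a ≡ b
      double-injective {a} {b} e = ℕₚ.*-cancelˡ-≡ a b 2
        (trans (cong (a +_) (ℕₚ.+-identityʳ a)) (trans e (cong (b +_) (sym (ℕₚ.+-identityʳ b)))))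

      both-orders : ∀ i j → lt i j * hτ i j + lt j i * hτ j i ≡ hτ i j
      both-orders i j with i Finₚ.≟ j
      ... | yes refl = trans (cong (λ z → z * hτ i i + z * hτ i i) (lt-irrefl i)) (sym h-irrefl)
        where
        h-irrefl : hτ i i ≡ 0
        h-irrefl = cong₂ (λ y z → y * lt (στ i) (στ i) + z * lt (στ i) (στ i))
                         (lt-irrefl (τ ⟨$⟩ʳ i)) (lt-irrefl (τ ⟨$⟩ʳ i))
      ... | no i≢j = trans (cong (λ z → lt i j * hτ i j + lt j i * z) (h-sym (τ ⟨$⟩ʳ j) (τ ⟨$⟩ʳ i)))
                           (arith (lt-total i≢j))
        where
        arith : ∀ {x x′ z} → OneOf x x′ → x * z + x′ * z ≡ z
        arith (inj₁ (refl , refl)) = trans (ℕₚ.+-identityʳ _) (ℕₚ.+-identityʳ _)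
        arith (inj₂ (refl , refl)) = ℕₚ.+-identityʳ _

      -- The condition i < j is not invariant under `τ`. Doubling the sum removes it, because `h` is
      -- symmetric, and then `τ` can be substituted away.
      crossed : ∑∑ (λ i j → lt i j * hτ i j) ≡ inversions σ
      crossed = double-injective (begin
        ∑∑ (λ i j → lt i j * hτ i j) + ∑∑ (λ i j → lt i j * hτ i j)
          ≡⟨ cong (∑∑ (λ i j → lt i j * hτ i j) +_) (∑∑-transpose (λ i j → lt i j * hτ i j)) ⟩
        ∑∑ (λ i j → lt i j * hτ i j) + ∑∑ (λ i j → lt j i * hτ j i)
          ≡⟨ sym (∑∑-+ (λ i j → lt i j * hτ i j) (λ i j → lt j i * hτ j i)) ⟩
        ∑∑ (λ i j → lt i j * hτ i j + lt j i * hτ j i)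
          ≡⟨ ∑∑-cong both-orders ⟩
        ∑∑ hτ
          ≡⟨ ∑∑-permute τ h ⟩
        ∑∑ h
          ≡⟨ ∑∑-+ (λ a b → lt a b * lt (σ ⟨$⟩ʳ b) (σ ⟨$⟩ʳ a)) _ ⟩
        ∑∑ (λ a b → lt a b * lt (σ ⟨$⟩ʳ b) (σ ⟨$⟩ʳ a)) +
        ∑∑ (λ a b → lt b a * lt (σ ⟨$⟩ʳ a) (σ ⟨$⟩ʳ b))
          ≡⟨ cong₂ _+_ (sym (inversions-∑ σ))
               (trans (∑∑-transpose (λ a b → lt b a * lt (σ ⟨$⟩ʳ a) (σ ⟨$⟩ʳ b)))
                      (sym (inversions-∑ σ))) ⟩
        inversions σ + inversions σ ∎)

    inversions-id : ∀ n → inversions (idₚ {n}) ≡ 0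
    inversions-id n = trans (inversions-∑ (idₚ {n}))
      (∑-zero (allFin n) λ i → ∑-zero (allFin n) λ j → lt-asym i j)

    inversions-cong : ∀ {n} {σ τ : Permutation′ n} → σ ≈ τ → inversions σ ≡ inversions τ
    inversions-cong {σ = σ} {τ} e = trans (inversions-∑ σ)
      (trans (∑∑-cong λ i j → cong₂ (λ x y → lt i j * lt x y) (e j) (e i)) (sym (inversions-∑ τ)))

    inversions-transpose01 : ∀ n → inversions (transpose {suc (suc n)} zero (suc zero)) ≡ 1
    inversions-transpose01 n = trans (inversions-∑ t)
      (trans (∑-allFin-suc (suc n) (λ i → ∑ (allFin (suc (suc n))) (F i)))
      (cong₂ _+_ row0
        (trans (∑-allFin-suc n (λ i → ∑ (allFin (suc (suc n))) (F (suc i)))) (cong₂ _+_ row1 (∑-zero (allFin n) row2+)))))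
      where
      t = transpose {suc (suc n)} zero (suc zero)
      F : Fin (suc (suc n)) → Fin (suc (suc n)) → ℕ
      F i j = lt i j * lt (t ⟨$⟩ʳ j) (t ⟨$⟩ʳ i)
      split : ∀ i → ∑ (allFin (suc (suc n))) (F i) ≡
        F i zero + (F i (suc zero) + ∑ (allFin n) (λ j → F i (suc (suc j))))
      split i = trans (∑-allFin-suc (suc n) (F i)) (cong (F i zero +_) (∑-allFin-suc n _))
      row0 : ∑ (allFin (suc (suc n))) (F zero) ≡ 1
      row0 = trans (split zero) (cong suc (∑-zero (allFin n) λ j → refl))
      row1 : ∑ (allFin (suc (suc n))) (F (suc zero)) ≡ 0
      row1 = trans (split (suc zero)) (∑-zero (allFin n) λ j → refl)
      row2+ : ∀ i → ∑ (allFin (suc (suc n))) (F (suc (suc i))) ≡ 0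
      row2+ i = trans (split (suc (suc i))) (∑-zero (allFin n) λ j → lt-asym (suc (suc i)) (suc (suc j)))

  private
    sign : ℕ → ℚ
    sign k = (-1ℤ ℤ.^ k) ℚ./ 1

    sign-suc² : ∀ k → sign (suc (suc k)) ≡ sign k
    sign-suc² k = cong (ℚ._/ 1)
      (trans (sym (ℤₚ.*-assoc -1ℤ -1ℤ (-1ℤ ℤ.^ k))) (ℤₚ.*-identityˡ (-1ℤ ℤ.^ k)))

    sign-suc : ∀ k → sign (suc k) ≡ sign 1 ℚ.* sign k
    sign-suc zero          = refl
    sign-suc (suc zero)    = refl
    sign-suc (suc (suc k)) = trans (sign-suc² (suc k))
      (trans (sign-suc k) (cong (sign 1 ℚ.*_) (sym (sign-suc² k))))

    sign-+ : ∀ j k → sign (j ℕ.+ k) ≡ sign j ℚ.* sign k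
    sign-+ zero          k = sym (ℚₚ.*-identityˡ (sign k))
    sign-+ (suc zero)    k = sign-suc k
    sign-+ (suc (suc j)) k = trans (sign-suc² (j ℕ.+ k))
      (trans (sign-+ j k) (cong (ℚ._* sign k) (sym (sign-suc² j))))

    sign-square : ∀ k → sign k ℚ.* sign k ≡ 1ℚ
    sign-square zero          = refl
    sign-square (suc zero)    = refl
    sign-square (suc (suc k)) = trans (cong₂ ℚ._*_ (sign-suc² k) (sign-suc² k)) (sign-square k)

  sgn-cong : ∀ {n} {σ τ : Permutation′ n} → σ ≈ τ → sgn σ ≡ sgn τ
  sgn-cong {σ = σ} {τ} e = cong sign (inversions-cong {σ = σ} {τ} e)

  sgn-∘ : ∀ {n} (τ σ : Permutation′ n) → sgn (τ ∘ₚ σ) ≡ sgn τ ℚ.* sgn σ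
  sgn-∘ τ σ with inversions-∘ τ σ
  ... | k , e = begin
    sign (inversions (τ ∘ₚ σ))                       ≡⟨ sym (ℚₚ.*-identityʳ _) ⟩
    sign (inversions (τ ∘ₚ σ)) ℚ.* 1ℚ                ≡⟨ cong (sgn (τ ∘ₚ σ) ℚ.*_) (sym (trans (sign-+ k k) (sign-square k))) ⟩
    sign (inversions (τ ∘ₚ σ)) ℚ.* sign (k ℕ.+ k)    ≡⟨ sym (sign-+ (inversions (τ ∘ₚ σ)) (k ℕ.+ k)) ⟩
    sign (inversions (τ ∘ₚ σ) ℕ.+ (k ℕ.+ k))         ≡⟨ cong sign e ⟩
    sign (inversions τ ℕ.+ inversions σ)             ≡⟨ sign-+ (inversions τ) (inversions σ) ⟩
    sgn τ ℚ.* sgn σ                                  ∎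
    where open ≡-Reasoning

  sgn-id : ∀ n → sgn (idₚ {n}) ≡ 1ℚ
  sgn-id n = cong sign (inversions-id n)

  sgn-square : ∀ {n} (σ : Permutation′ n) → sgn σ ℚ.* sgn σ ≡ 1ℚ
  sgn-square σ = sign-square (inversions σ)

  sgn-flip : ∀ {n} (σ : Permutation′ n) → sgn σ ℚ.* sgn (flip σ) ≡ 1ℚ
  sgn-flip {n} σ = trans (sym (sgn-∘ σ (flip σ)))
    (trans (sgn-cong {σ = σ ∘ₚ flip σ} {idₚ} (λ i → inverseˡ σ)) (sgn-id n))

  module _ {n : ℕ} where

    transpose-left : (x y : Fin n) → transpose x y ⟨$⟩ʳ x ≡ y
    transpose-left x y with x Finₚ.≟ x
    ... | yes _  = refl
    ... | no x≢x = contradiction refl x≢x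

    transpose-right : (x y : Fin n) → transpose x y ⟨$⟩ʳ y ≡ x
    transpose-right x y with y Finₚ.≟ x
    ... | yes y≡x = y≡x
    ... | no _ with y Finₚ.≟ y
    ...   | yes _  = refl
    ...   | no y≢y = contradiction refl y≢y

    transpose-other : {x y : Fin n} {z : Fin n} → z ≢ x → z ≢ y → transpose x y ⟨$⟩ʳ z ≡ z
    transpose-other {x} {y} {z} z≢x z≢y with z Finₚ.≟ x
    ... | yes z≡x = contradiction z≡x z≢x
    ... | no _ with z Finₚ.≟ y
    ...   | yes z≡y = contradiction z≡y z≢y
    ...   | no _    = refl

    transpose-preserves : ∀ {a} {A : Set a} (f : Fin n → A) {x y : Fin n} → f x ≡ f y →
      ∀ z → f (transpose x y ⟨$⟩ʳ z) ≡ f z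
    transpose-preserves f {x} {y} e z with z Finₚ.≟ x
    ... | yes refl = sym e
    ... | no _ with z Finₚ.≟ y
    ...   | yes refl = e
    ...   | no _     = refl

  -- Every transposition is conjugate to (0 1), which has one inversion.
  sgn-transpose : ∀ {n} {x y : Fin n} → x ≢ y → sgn (transpose x y) ≡ ℚ.- 1ℚ
  sgn-transpose {suc zero}    {zero} {zero} x≢y = contradiction refl x≢y
  sgn-transpose {suc (suc n)} {x}    {y}    x≢y = begin
    sgn (transpose x y)
      ≡⟨ sgn-cong {σ = transpose x y} {flip ρ ∘ₚ (t ∘ₚ ρ)} conjugate ⟩
    sgn (flip ρ ∘ₚ (t ∘ₚ ρ))
      ≡⟨ trans (sgn-∘ (flip ρ) (t ∘ₚ ρ)) (cong (sgn (flip ρ) ℚ.*_) (sgn-∘ t ρ)) ⟩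
    sgn (flip ρ) ℚ.* (sgn t ℚ.* sgn ρ)
      ≡⟨ Σℚ.*-swapˡ (sgn (flip ρ)) (sgn t) (sgn ρ) ⟩
    sgn t ℚ.* (sgn (flip ρ) ℚ.* sgn ρ)
      ≡⟨ cong₂ ℚ._*_ (cong sign (inversions-transpose01 n))
                     (trans (ℚₚ.*-comm (sgn (flip ρ)) (sgn ρ)) (sgn-flip ρ)) ⟩
    sign 1 ℚ.* 1ℚ
      ≡⟨⟩
    ℚ.- 1ℚ ∎
    where
    open ≡-Reasoning
    t = transpose {suc (suc n)} zero (suc zero)
    -- The first transposition may already have moved 1, so the second one starts from where 1 is
    -- now.
    w = transpose zero x ⟨$⟩ʳ suc zero
    ρ = transpose zero x ∘ₚ transpose w y

    x≢w : x ≢ w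
    x≢w e with permute-injective (transpose zero x) {zero} {suc zero} (trans (transpose-left zero x) e)
    ... | ()

    ρ0 : ρ ⟨$⟩ʳ zero ≡ x
    ρ0 = trans (cong (transpose w y ⟨$⟩ʳ_) (transpose-left zero x)) (transpose-other x≢w x≢y)

    ρ1 : ρ ⟨$⟩ʳ suc zero ≡ y
    ρ1 = transpose-left w y

    on-image : ∀ u → transpose x y ⟨$⟩ʳ (ρ ⟨$⟩ʳ u) ≡ ρ ⟨$⟩ʳ (t ⟨$⟩ʳ u)
    on-image zero          = trans (cong (transpose x y ⟨$⟩ʳ_) ρ0) (trans (transpose-left x y) (sym ρ1))
    on-image (suc zero)    = trans (cong (transpose x y ⟨$⟩ʳ_) ρ1) (trans (transpose-right x y) (sym ρ0))
    on-image (suc (suc u)) = transpose-other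
      (λ e → contradiction (permute-injective ρ {suc (suc u)} {zero} (trans e (sym ρ0))) λ ())
      (λ e → contradiction (permute-injective ρ {suc (suc u)} {suc zero} (trans e (sym ρ1))) λ ())

    conjugate : transpose x y ≈ flip ρ ∘ₚ (t ∘ₚ ρ)
    conjugate z = trans (cong (transpose x y ⟨$⟩ʳ_) (sym (inverseʳ ρ {z}))) (on-image (ρ ⟨$⟩ˡ z))

-- Tableaux and the basic combinatorial lemma

module Tableaux where
  open Permutations
  open import Defs

  injective⇒surjective : ∀ {m} (f : Fin m → Fin m) → (∀ {x y} → f x ≡ f y → x ≡ y) →
    ∀ y → ∃ λ x → f x ≡ y
  injective⇒surjective {suc k} f inj y with Finₚ.any? (λ x → f x Finₚ.≟ y)
  ... | yes hit = hit
  ... | no miss = contradiction (inj (Finₚ.punchOut-injective (y≢f i) (y≢f j) same))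
                              (ℕₚ.<⇒≢ i<j ∘ cong toℕ)
    where
    y≢f : ∀ x → y ≢ f x
    y≢f x e = miss (x , sym e)
    collision = Finₚ.pigeonhole (ℕₚ.n<1+n k) (λ x → punchOut (y≢f x))
    i = proj₁ collision
    j = proj₁ (proj₂ collision)
    i<j = proj₁ (proj₂ (proj₂ collision))
    same = proj₂ (proj₂ (proj₂ collision))

  injective⇒permutation : ∀ {m} (f : Fin m → Fin m) → (∀ {x y} → f x ≡ f y → x ≡ y) →
    Permutation′ m
  injective⇒permutation f inj = permutation f (proj₁ ∘ surj) (proj₂ ∘ surj)
                                            (λ x → inj (proj₂ (surj (f x))))
    where surj = injective⇒surjective f inj

  lookup-antitone : ∀ {ps} → Linked _≥_ ps → ∀ i j → i Fin.≤ j → lookup ps j ℕ.≤ lookup ps i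
  lookup-antitone linked = go (Linked⇒AllPairs (λ p q → ℕₚ.≤-trans q p) linked)
    where
    go : ∀ {ps} → AllPairs _≥_ ps → ∀ i j → i Fin.≤ j → lookup ps j ℕ.≤ lookup ps i
    go (p ∷ ps) zero    zero    _   = ℕₚ.≤-refl
    go (p ∷ ps) zero    (suc j) _   = All.lookup p (∈-lookup j)
    go (p ∷ ps) (suc i) (suc j) i≤j = go ps i j (ℕ.s≤s⁻¹ i≤j)

  module _ {n : ℕ} (μ : Partition n) where

    rowLength : Fin (#parts μ) → ℕ
    rowLength i = lookup (parts μ) i

    private
      cell-≡ : (c d : Cell μ) → proj₁ c ≡ proj₁ d → toℕ (proj₂ c) ≡ toℕ (proj₂ d) → c ≡ d
      cell-≡ (i , j) (i , j′) refl e = cong (i ,_) (Finₚ.toℕ-injective e)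

    position-injective : (T : Tableau μ) → ∀ {x z} →
      rowOf μ T x ≡ rowOf μ T z → columnOf μ T x ≡ columnOf μ T z → x ≡ z
    position-injective T {x} {z} e e′ = trans (sym (Inverse.strictlyInverseˡ T x))
      (trans (cong (Inverse.to T) (cell-≡ _ _ e e′)) (Inverse.strictlyInverseˡ T z))

    columnOf<rowLength : (T : Tableau μ) → ∀ x → columnOf μ T x ℕ.< rowLength (rowOf μ T x)
    columnOf<rowLength T x = Finₚ.toℕ<n (proj₂ (Inverse.from T x))

    rowOf-to : (T : Tableau μ) (c : Cell μ) → rowOf μ T (Inverse.to T c) ≡ proj₁ c
    rowOf-to T c = cong proj₁ (Inverse.strictlyInverseʳ T c)

    columnOf-to : (T : Tableau μ) (c : Cell μ) → columnOf μ T (Inverse.to T c) ≡ toℕ (proj₂ c)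
    columnOf-to T c = cong (toℕ ∘ proj₂) (Inverse.strictlyInverseʳ T c)

    module _ (T T′ : Tableau μ) where
      private
        col  = columnOf μ T
        row′ = rowOf μ T′

        entry : ∀ {i j} → j ℕ.< rowLength i → Fin n
        entry {i} j<λᵢ = Inverse.to T (i , fromℕ< j<λᵢ)

        row-entry : ∀ {i j} (j<λᵢ : j ℕ.< rowLength i) → rowOf μ T (entry j<λᵢ) ≡ i
        row-entry j<λᵢ = rowOf-to T _

        col-entry : ∀ {i j} (j<λᵢ : j ℕ.< rowLength i) → col (entry j<λᵢ) ≡ j
        col-entry j<λᵢ = trans (columnOf-to T _) (Finₚ.toℕ-fromℕ< j<λᵢ)

      module _ (separated : ∀ {x z} → col x ≡ col z → row′ x ≡ row′ z → x ≡ z) where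

        -- Downward induction on the row of T′: an injective map of column j
        -- of the diagram to itself hits row i, so every column j < λᵢ of T
        -- meets row i of T′, and then row i of T′ has no room for others.
        inDiagram-acc : ∀ {i} → Acc Fin._>_ i → ∀ {x} → row′ x ≡ i → col x ℕ.< rowLength i
        inDiagram-acc {i} (acc below) {x} refl = conclusion
          where
          column : ∀ j → j ℕ.< rowLength i → ∀ {z} → col z ≡ j → j ℕ.< rowLength (row′ z)
          column j j<λᵢ {z} refl with Finₚ.<-cmp i (row′ z)
          ... | tri< i<r _ _  = inDiagram-acc (below i<r) refl
          ... | tri≈ _ e _ = subst (λ r → j ℕ.< rowLength r) e j<λᵢ
          ... | tri> _ _ r<i  =
            ℕₚ.<-≤-trans j<λᵢ (lookup-antitone (sorted μ) (row′ z) i (ℕₚ.<⇒≤ r<i))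

          module _ (j : ℕ) (j<λᵢ : j ℕ.< rowLength i) where
            move : Fin (#parts μ) → Fin (#parts μ)
            move k with j ℕₚ.<? rowLength k
            ... | yes j<λₖ = row′ (entry j<λₖ)
            -- Being the identity off the column makes this an endomap of all row indices, to which
            -- the pigeonhole principle applies directly.
            ... | no _     = k

            move-injective : ∀ {k l} → move k ≡ move l → k ≡ l
            move-injective {k} {l} e with j ℕₚ.<? rowLength k | j ℕₚ.<? rowLength l
            ... | yes p | yes q = trans (sym (row-entry p)) (trans
                  (cong (rowOf μ T) (separated (trans (col-entry p) (sym (col-entry q))) e)) (row-entry q))
            ... | yes p | no ¬q = contradiction (subst (λ z → j ℕ.< rowLength z) e (column j j<λᵢ (col-entry p))) ¬q
            ... | no ¬p | yes q = contradiction (subst (λ z → j ℕ.< rowLength z) (sym e) (column j j<λᵢ (col-entry q))) ¬p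
            ... | no _  | no _  = e

            column-meets-row : ∃ λ z → row′ z ≡ i × col z ≡ j
            column-meets-row with injective⇒surjective move move-injective i
            ... | k , e with j ℕₚ.<? rowLength k
            ...   | yes p = entry p , e , col-entry p
            ...   | no ¬p = contradiction (subst (λ z → j ℕ.< rowLength z) (sym e) j<λᵢ) ¬p

          meet : (j : Fin (rowLength i)) → ∃ λ z → row′ z ≡ i × col z ≡ toℕ j
          meet j = column-meets-row (toℕ j) (Finₚ.toℕ<n j)

          place : (j : Fin (rowLength i)) → columnOf μ T′ (proj₁ (meet j)) ℕ.< rowLength i
          place j = subst (λ r → columnOf μ T′ (proj₁ (meet j)) ℕ.< rowLength r)
                          (proj₁ (proj₂ (meet j))) (columnOf<rowLength T′ (proj₁ (meet j)))

          place-injective : ∀ {j l} → fromℕ< (place j) ≡ fromℕ< (place l) → j ≡ l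
          place-injective {j} {l} e = Finₚ.toℕ-injective
            (trans (sym (proj₂ (proj₂ (meet j)))) (trans (cong col same) (proj₂ (proj₂ (meet l)))))
            where
            same : proj₁ (meet j) ≡ proj₁ (meet l)
            same = position-injective T′
              (trans (proj₁ (proj₂ (meet j))) (sym (proj₁ (proj₂ (meet l)))))
              (trans (sym (Finₚ.toℕ-fromℕ< (place j))) (trans (cong toℕ e) (Finₚ.toℕ-fromℕ< (place l))))

          conclusion : col x ℕ.< rowLength i
          conclusion with injective⇒surjective (λ j → fromℕ< (place j)) place-injective
                            (fromℕ< (columnOf<rowLength T′ x))
          ... | j , e = subst (ℕ._< rowLength i)
                          (trans (sym (proj₂ (proj₂ (meet j)))) (cong col same)) (Finₚ.toℕ<n j)
            where
            same : proj₁ (meet j) ≡ x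
            same = position-injective T′ (proj₁ (proj₂ (meet j)))
              (trans (sym (Finₚ.toℕ-fromℕ< (place j)))
                (trans (cong toℕ e) (Finₚ.toℕ-fromℕ< (columnOf<rowLength T′ x))))

        inDiagram : ∀ x → col x ℕ.< rowLength (row′ x)
        inDiagram x = inDiagram-acc (Finᵢ.>-wellFounded (row′ x)) refl

        -- Send each entry to the cell in its own column of `T` and its own row of `T′`. That cell
        -- exists by `inDiagram`, and `separated` makes the map injective. Its inverse is the column
        -- permutation wanted.
        sortColumns : ∃ λ t → PreservesColumns μ T t × (∀ x → row′ (t ⟨$⟩ʳ x) ≡ rowOf μ T x)
        sortColumns = flip π
          , (λ x → trans (sym (col-entry (inDiagram (π ⟨$⟩ˡ x)))) (cong col (inverseʳ π {x})))
          , (λ x → trans (sym (row-entry (inDiagram (π ⟨$⟩ˡ x)))) (cong (rowOf μ T) (inverseʳ π {x})))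
          where
          π : Permutation′ n
          π = injective⇒permutation (λ x → entry (inDiagram x)) λ {x} {z} e → separated
            (trans (sym (col-entry (inDiagram x))) (trans (cong col e) (col-entry (inDiagram z))))
            (trans (sym (row-entry (inDiagram x))) (trans (cong (rowOf μ T) e) (row-entry (inDiagram z))))

      -- In either alternative the value at `T′` of a vector antisymmetric under the column group of
      -- `T` is forced: it is zero after a collision, and a sign times the value at `T` otherwise.
      collision⊎sortable :
        (∃₂ λ x z → x ≢ z × col x ≡ col z × row′ x ≡ row′ z) ⊎
        (∃ λ t → PreservesColumns μ T t × (∀ x → row′ (t ⟨$⟩ʳ x) ≡ rowOf μ T x))
      collision⊎sortable with Finₚ.any? (λ x → Finₚ.any? λ z →
        ¬? (x Finₚ.≟ z) ×-dec ((col x ℕₚ.≟ col z) ×-dec (row′ x Finₚ.≟ row′ z)))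
      ... | yes pair = inj₁ pair
      ... | no  none = inj₂ (sortColumns separated)
        where
        separated : ∀ {x z} → col x ≡ col z → row′ x ≡ row′ z → x ≡ z
        separated {x} {z} e e′ with x Finₚ.≟ z
        ... | yes x≡z = x≡z
        ... | no x≢z  = contradiction (x , z , x≢z , e , e′) none

-- Polytabloids as eigenvectors of the class sums

module Polytabloids where
  open Summation
  open Permutations
  open Tableaux
  open import Defs hiding (∑; _≈_)
  import Defs
  open import Data.Rational.Base using (_+_; _*_; +-0-rawMonoid)
  open import Algebra.Definitions.RawMonoid +-0-rawMonoid using (sum)

  open Σℚ

  Defs-∑ : ∀ {a} {A : Set a} (xs : List A) (f : A → ℚ) → Defs.∑ xs f ≡ ∑ xs f
  Defs-∑ []       f = refl
  Defs-∑ (x ∷ xs) f = cong (f x +_) (Defs-∑ xs f)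

  sum-∑ : ∀ {d} (f : Fin d → ℚ) → sum f ≡ ∑ (allFin d) f
  sum-∑ {zero}  f = refl
  sum-∑ {suc d} f = trans (cong (f zero +_) (sum-∑ (f ∘ suc))) (sym (∑-allFin-suc d f))

  ≡-neg⇒≡0 : ∀ x → x ≡ (ℚ.- 1ℚ) * x → x ≡ 0ℚ
  ≡-neg⇒≡0 x e = begin
    x                ≡⟨ sym (ℚₚ.*-identityˡ x) ⟩
    (½ + ½) * x      ≡⟨ ℚₚ.*-distribʳ-+ x ½ ½ ⟩
    ½ * x + ½ * x    ≡⟨ sym (ℚₚ.*-distribˡ-+ ½ x x) ⟩
    ½ * (x + x)      ≡⟨ cong (½ *_) (trans (cong (x +_) e) (cong (_+ (ℚ.- 1ℚ) * x) (sym (ℚₚ.*-identityˡ x)))) ⟩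
    ½ * (1ℚ * x + (ℚ.- 1ℚ) * x)  ≡⟨ cong (½ *_) (sym (ℚₚ.*-distribʳ-+ x 1ℚ (ℚ.- 1ℚ))) ⟩
    ½ * (0ℚ * x)     ≡⟨ cong (½ *_) (ℚₚ.*-zeroˡ x) ⟩
    0ℚ               ∎
    where open ≡-Reasoning

  #fixed-cong : ∀ {n} {σ τ : Permutation′ n} → σ ≈ τ → #fixed σ ≡ #fixed τ
  #fixed-cong {n} {σ} {τ} e = trans (#fixed-∑ σ) (trans
    (Σℕ.∑-cong (allFin n) λ i → cong (λ z → Σℕ.⟦ z Finₚ.≟ i ⟧) (e i)) (sym (#fixed-∑ τ)))

  #fixed-conjugate : ∀ {n} (t σ : Permutation′ n) → #fixed (flip t ∘ₚ (σ ∘ₚ t)) ≡ #fixed σ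
  #fixed-conjugate {n} t σ = begin
    #fixed (flip t ∘ₚ (σ ∘ₚ t))
      ≡⟨ #fixed-∑ (flip t ∘ₚ (σ ∘ₚ t)) ⟩
    Σℕ.∑ (allFin n) (λ i → Σℕ.⟦ tσt⁻¹ i Finₚ.≟ i ⟧)
      ≡⟨ sym (Σℕ.∑-allFin-permute t _) ⟩
    Σℕ.∑ (allFin n) (λ i → Σℕ.⟦ tσt⁻¹ (t ⟨$⟩ʳ i) Finₚ.≟ (t ⟨$⟩ʳ i) ⟧)
      ≡⟨ Σℕ.∑-cong (allFin n) (λ i → Σℕ.⟦⟧-cong (_ Finₚ.≟ _) (_ Finₚ.≟ _)
           (λ e → trans (sym (back i)) (permute-injective t e))
           (λ e → cong (t ⟨$⟩ʳ_) (trans (back i) e))) ⟩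
    Σℕ.∑ (allFin n) (λ i → Σℕ.⟦ (σ ⟨$⟩ʳ i) Finₚ.≟ i ⟧)
      ≡⟨ sym (#fixed-∑ σ) ⟩
    #fixed σ ∎
    where
    open ≡-Reasoning
    tσt⁻¹ = (flip t ∘ₚ (σ ∘ₚ t)) ⟨$⟩ʳ_
    back : ∀ i → σ ⟨$⟩ʳ (t ⟨$⟩ˡ (t ⟨$⟩ʳ i)) ≡ σ ⟨$⟩ʳ i
    back i = cong (σ ⟨$⟩ʳ_) (inverseˡ t)

  module _ {n : ℕ} (μ : Partition n) where
    open ≡-Reasoning

    private
      -- A tabloid is determined by the rows of its entries, and on such row assignments
      -- permutations act by precomposition.
      Rows : Set
      Rows = Fin n → Fin (#parts μ)

    module _ (T : Tableau μ) where

      matches? : (r : Rows) (q : Permutation′ n) → Dec (∀ x → rowOf μ T x ≡ r (q ⟨$⟩ʳ x))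
      matches? r q = Finₚ.all? λ x → rowOf μ T x Finₚ.≟ r (q ⟨$⟩ʳ x)

      -- The polytabloid of T, as a function of the rows of the entries.
      ϕ : Rows → ℚ
      ϕ r = ∑ (permutations n) λ q → ⟦ preservesColumns? μ T q ⟧ * (sgn q * ⟦ matches? r q ⟧)

      -- The class sum of S(n,k) applied to the polytabloid of T.
      Φ : ℕ → Rows → ℚ
      Φ k r = ∑ (permutations n) λ σ → ⟦ #fixed σ ℕₚ.≟ k ⟧ * ϕ (λ x → r (σ ⟨$⟩ʳ x))

      polytabloid-ϕ : ∀ T′ → polytabloid μ T T′ ≡ ϕ (rowOf μ T′)
      polytabloid-ϕ T′ = trans (Defs-∑ (columnStabiliser μ T) _)
        (trans (∑-filter (preservesColumns? μ T) (permutations n) _)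
        (∑-cong (permutations n) λ q → cong (λ z → ⟦ preservesColumns? μ T q ⟧ * (sgn q * z))
          (⟦⟧-cong (_∼?_ μ (_·ₜ_ μ q T) T′) (matches? (rowOf μ T′) q)
            (λ e x → trans (cong (rowOf μ T) (sym (inverseˡ q))) (e (q ⟨$⟩ʳ x)))
            (λ e x → trans (e (q ⟨$⟩ˡ x)) (cong (rowOf μ T′) (inverseʳ q))))))

      ϕ-cong : ∀ {r s} → r ≗ s → ϕ r ≡ ϕ s
      ϕ-cong {r} {s} e = ∑-cong (permutations n) λ q →
        cong (λ z → ⟦ preservesColumns? μ T q ⟧ * (sgn q * z))
          (⟦⟧-cong (matches? r q) (matches? s q)
            (λ f x → trans (f x) (e _)) (λ f x → trans (f x) (sym (e _))))

      Φ-cong : ∀ k {r s} → r ≗ s → Φ k r ≡ Φ k s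
      Φ-cong k {r} {s} e = ∑-cong (permutations n) λ σ →
        cong (⟦ #fixed σ ℕₚ.≟ k ⟧ *_) (ϕ-cong (λ x → e (σ ⟨$⟩ʳ x)))

      module _ (t : Permutation′ n) (t∈C : PreservesColumns μ T t) where

        -- Replacing `q` by `q ∘ₚ t` permutes the column group and multiplies each sign by `sgn t`.
        ϕ-antisymmetric : ∀ r → ϕ (λ x → r (t ⟨$⟩ʳ x)) ≡ sgn t * ϕ r
        ϕ-antisymmetric r = begin
          ∑ (permutations n) (λ q → ⟦ preservesColumns? μ T q ⟧ * (sgn q * ⟦ matches? r (q ∘ₚ t) ⟧))
            ≡⟨ ∑-cong (permutations n) summand ⟩
          ∑ (permutations n) (λ q → sgn t * g (q ∘ₚ t))
            ≡⟨ ∑-*ˡ (permutations n) (sgn t) (λ q → g (q ∘ₚ t)) ⟩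
          sgn t * ∑ (permutations n) (λ q → g (q ∘ₚ t))
            ≡⟨ cong (sgn t *_) (∑-permutations-∘ʳ t g (λ {σ} {τ} → g-ext {σ} {τ})) ⟩
          sgn t * ϕ r ∎
          where
          g : Permutation′ n → ℚ
          g q = ⟦ preservesColumns? μ T q ⟧ * (sgn q * ⟦ matches? r q ⟧)

          g-ext : Extensional g
          g-ext {σ} {τ} e = cong₂ _*_
            (⟦⟧-cong (preservesColumns? μ T σ) (preservesColumns? μ T τ)
              (λ c x → trans (cong (columnOf μ T) (sym (e x))) (c x))
              (λ c x → trans (cong (columnOf μ T) (e x)) (c x)))
            (cong₂ _*_ (sgn-cong {σ = σ} {τ} e)
              (⟦⟧-cong (matches? r σ) (matches? r τ)
                (λ m x → trans (m x) (cong r (e x)))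
                (λ m x → trans (m x) (cong r (sym (e x))))))

          summand : ∀ q → ⟦ preservesColumns? μ T q ⟧ * (sgn q * ⟦ matches? r (q ∘ₚ t) ⟧) ≡
                          sgn t * g (q ∘ₚ t)
          summand q = begin
            ⟦ preservesColumns? μ T q ⟧ * (sgn q * m)
              ≡⟨ cong₂ (λ u v → u * (v * m))
                   (⟦⟧-cong (preservesColumns? μ T q) (preservesColumns? μ T (q ∘ₚ t))
                     (λ c x → trans (t∈C _) (c x)) (λ c x → trans (sym (t∈C _)) (c x)))
                   (sym sgn-q) ⟩
            C * ((sgn t * sgn (q ∘ₚ t)) * m)
              ≡⟨ cong (C *_) (*-assoc (sgn t) (sgn (q ∘ₚ t)) m) ⟩
            C * (sgn t * (sgn (q ∘ₚ t) * m))
              ≡⟨ *-swapˡ C (sgn t) (sgn (q ∘ₚ t) * m) ⟩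
            sgn t * g (q ∘ₚ t) ∎
            where
            m = ⟦ matches? r (q ∘ₚ t) ⟧
            C = ⟦ preservesColumns? μ T (q ∘ₚ t) ⟧
            sgn-q : sgn t * sgn (q ∘ₚ t) ≡ sgn q
            sgn-q = begin
              sgn t * sgn (q ∘ₚ t)     ≡⟨ cong (sgn t *_) (sgn-∘ q t) ⟩
              sgn t * (sgn q * sgn t)  ≡⟨ *-swapˡ (sgn t) (sgn q) (sgn t) ⟩
              sgn q * (sgn t * sgn t)  ≡⟨ cong (sgn q *_) (sgn-square t) ⟩
              sgn q * 1ℚ               ≡⟨ *-identityʳ (sgn q) ⟩
              sgn q                    ∎

        -- Conjugation by `t` permutes S(n,k), so `t` can be carried past the class sum to `ϕ`.
        Φ-antisymmetric : ∀ k r → Φ k (λ x → r (t ⟨$⟩ʳ x)) ≡ sgn t * Φ k r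
        Φ-antisymmetric k r = begin
          ∑ (permutations n) (λ σ → ⟦ #fixed σ ℕₚ.≟ k ⟧ * ϕ (λ x → r (t ⟨$⟩ʳ (σ ⟨$⟩ʳ x))))
            ≡⟨ ∑-cong (permutations n) summand ⟩
          ∑ (permutations n) (λ σ → sgn t * h (flip t ∘ₚ (σ ∘ₚ t)))
            ≡⟨ ∑-*ˡ (permutations n) (sgn t) (λ σ → h (flip t ∘ₚ (σ ∘ₚ t))) ⟩
          sgn t * ∑ (permutations n) (λ σ → h (flip t ∘ₚ (σ ∘ₚ t)))
            ≡⟨ cong (sgn t *_) (∑-permutations-∘ʳ t (λ σ → h (flip t ∘ₚ σ))
                 (λ {σ} {τ} e → h-ext {flip t ∘ₚ σ} {flip t ∘ₚ τ} (λ i → e (t ⟨$⟩ˡ i)))) ⟩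
          sgn t * ∑ (permutations n) (λ σ → h (flip t ∘ₚ σ))
            ≡⟨ cong (sgn t *_) (∑-permutations-∘ˡ (flip t) h (λ {σ} {τ} → h-ext {σ} {τ})) ⟩
          sgn t * Φ k r ∎
          where
          h : Permutation′ n → ℚ
          h σ = ⟦ #fixed σ ℕₚ.≟ k ⟧ * ϕ (λ x → r (σ ⟨$⟩ʳ x))

          h-ext : Extensional h
          h-ext {σ} {τ} e = cong₂ _*_ (cong (λ z → ⟦ z ℕₚ.≟ k ⟧) (#fixed-cong {σ = σ} {τ} e))
                                      (ϕ-cong (λ x → cong r (e x)))

          summand : ∀ σ → ⟦ #fixed σ ℕₚ.≟ k ⟧ * ϕ (λ x → r (t ⟨$⟩ʳ (σ ⟨$⟩ʳ x))) ≡
                          sgn t * h (flip t ∘ₚ (σ ∘ₚ t))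
          summand σ = trans
            (cong₂ _*_ (cong (λ z → ⟦ z ℕₚ.≟ k ⟧) (sym (#fixed-conjugate t σ)))
              (trans (ϕ-cong (λ x → cong (λ z → r (t ⟨$⟩ʳ (σ ⟨$⟩ʳ z))) (sym (inverseˡ t {x}))))
                     (ϕ-antisymmetric (λ x → r ((flip t ∘ₚ (σ ∘ₚ t)) ⟨$⟩ʳ x)))))
            (*-swapˡ ⟦ #fixed (flip t ∘ₚ (σ ∘ₚ t)) ℕₚ.≟ k ⟧ (sgn t)
                      (ϕ (λ x → r ((flip t ∘ₚ (σ ∘ₚ t)) ⟨$⟩ʳ x))))

      -- Only the identity preserves both the rows and the columns of `T`. With this normalisation
      -- the eigenvalue is the value of `Φ k` at `T` itself.
      ϕ-self : ϕ (rowOf μ T) ≡ 1ℚ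
      ϕ-self = trans (∑-cong (permutations n) summand)
        (trans (∑-permutations-only-id {n} sgn (λ {σ} {τ} → sgn-cong {σ = σ} {τ})) (sgn-id n))
        where
        summand : ∀ q → ⟦ preservesColumns? μ T q ⟧ * (sgn q * ⟦ matches? (rowOf μ T) q ⟧) ≡
                        ⟦ q ≈? idₚ ⟧ * sgn q
        summand q = begin
          C * (sgn q * m)   ≡⟨ cong (C *_) (*-comm (sgn q) m) ⟩
          C * (m * sgn q)   ≡⟨ sym (*-assoc C m (sgn q)) ⟩
          C * m * sgn q     ≡⟨ cong (_* sgn q) (sym (⟦⟧-× (preservesColumns? μ T q) (matches? (rowOf μ T) q))) ⟩
          ⟦ preservesColumns? μ T q ×-dec matches? (rowOf μ T) q ⟧ * sgn q
            ≡⟨ cong (_* sgn q) (⟦⟧-cong (preservesColumns? μ T q ×-dec matches? (rowOf μ T) q) (q ≈? idₚ)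
                 (λ (c , m) x → position-injective μ T (sym (m x)) (c x))
                 (λ e → (λ x → cong (columnOf μ T) (e x)) , (λ x → cong (rowOf μ T) (sym (e x))))) ⟩
          ⟦ q ≈? idₚ ⟧ * sgn q ∎
          where
          C = ⟦ preservesColumns? μ T q ⟧
          m = ⟦ matches? (rowOf μ T) q ⟧

      -- `ϕ` and `Φ k` are both antisymmetric. After a collision a transposition of sign -1 fixes
      -- the row assignment, so both vanish there; after sorting both are `sgn t` times their values
      -- at `T`, where `ϕ` is 1.
      Φ-eigenvector : ∀ k T′ → Φ k (rowOf μ T′) ≡ Φ k (rowOf μ T) * ϕ (rowOf μ T′)
      Φ-eigenvector k T′ with collision⊎sortable μ T T′
      ... | inj₁ (x , z , x≢z , sameCol , sameRow) =
        trans (vanishes (Φ-cong k fixed) (Φ-antisymmetric t t∈C k (rowOf μ T′)))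
          (sym (trans (cong (Φ k (rowOf μ T) *_)
                        (vanishes (ϕ-cong fixed) (ϕ-antisymmetric t t∈C (rowOf μ T′))))
                      (ℚₚ.*-zeroʳ (Φ k (rowOf μ T)))))
        where
        t = transpose x z
        t∈C : PreservesColumns μ T t
        t∈C = transpose-preserves (columnOf μ T) sameCol
        fixed : ∀ y → rowOf μ T′ (t ⟨$⟩ʳ y) ≡ rowOf μ T′ y
        fixed = transpose-preserves (rowOf μ T′) sameRow
        vanishes : ∀ {a b} → b ≡ a → b ≡ sgn t * a → a ≡ 0ℚ
        vanishes {a} e f = ≡-neg⇒≡0 a (trans (sym e) (trans f (cong (_* a) (sgn-transpose x≢z))))
      ... | inj₂ (t , t∈C , sorts) = begin
        Φ k r′                    ≡⟨ invert (Φ-antisymmetric t t∈C k r′) (Φ-cong k sorts) ⟩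
        sgn t * Φ k (rowOf μ T)   ≡⟨ *-comm (sgn t) _ ⟩
        Φ k (rowOf μ T) * sgn t   ≡⟨ cong (Φ k (rowOf μ T) *_) (sym (trans
                                       (invert (ϕ-antisymmetric t t∈C r′) (trans (ϕ-cong sorts) ϕ-self))
                                       (*-identityʳ (sgn t)))) ⟩
        Φ k (rowOf μ T) * ϕ r′    ∎
        where
        r′ = rowOf μ T′
        invert : ∀ {a b c} → b ≡ sgn t * a → b ≡ c → a ≡ sgn t * c
        invert {a} {b} {c} e f = begin
          a                    ≡⟨ sym (*-identityˡ a) ⟩
          1ℚ * a               ≡⟨ cong (_* a) (sym (sgn-square t)) ⟩
          sgn t * sgn t * a    ≡⟨ *-assoc (sgn t) (sgn t) a ⟩
          sgn t * (sgn t * a)  ≡⟨ cong (sgn t *_) (trans (sym e) f) ⟩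
          sgn t * c            ∎

-- From a scalar action on polytabloids to the eigenvalue

module Trace where
  open Permutations
  open Polytabloids
  open import Defs hiding (∑) renaming (_≈_ to _≈ᵥ_)
  import Defs
  open import Data.Rational.Base using (_+_; _*_; +-0-rawMonoid)
  open import Algebra.Definitions.RawMonoid +-0-rawMonoid using (sum)
  open import Algebra.Properties.Group ℚₚ.+-0-group using () renaming (∙-cancelʳ to +-cancelʳ)

  open Σℚ

  *-÷₀-cancel : ∀ c d → d ≢ 0ℚ → (c * d) ÷₀ d ≡ c
  *-÷₀-cancel c d d≢0 with d ℚₚ.≟ 0ℚ
  ... | yes d≡0 = contradiction d≡0 d≢0
  ... | no d≢0′ = trans (ℚₚ.*-assoc c d _)
    (trans (cong (c *_) (ℚₚ.*-inverseʳ d {{ℚ.≢-nonZero d≢0′}})) (ℚₚ.*-identityʳ c))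

  nat>0 : ∀ k → 0ℚ ℚ.< nat (suc k)
  nat>0 zero    = ℚₚ.positive⁻¹ 1ℚ
  nat>0 (suc k) = ℚₚ.<-trans (nat>0 k)
    (subst (ℚ._< nat (suc (suc k))) (ℚₚ.+-identityˡ (nat (suc k)))
           (ℚₚ.+-monoˡ-< (nat (suc k)) (ℚₚ.positive⁻¹ 1ℚ)))

  ∑-ones : ∀ {a} {A : Set a} (xs : List A) → ∑ xs (λ _ → 1ℚ) ≡ nat (length xs)
  ∑-ones []       = refl
  ∑-ones (x ∷ xs) = cong (1ℚ +_) (∑-ones xs)

  module _ {n : ℕ} {μ : Partition n} (V : SpechtRepresentation μ) where
    open SpechtRepresentation V
    open ≡-Reasoning

    ActsAs : List (Permutation′ n) → ℚ → Set
    ActsAs L c = ∀ T T′ →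
      ∑ L (λ σ → polytabloid μ T (_·ₜ_ μ (flip σ) T′)) ≡ c * polytabloid μ T T′

    private
      combination-∑ : ∀ {d} (b : Fin d → Vector μ) c T →
        combination μ b c T ≡ ∑ (allFin d) (λ i → c i * b i T)
      combination-∑ b c T = sum-∑ (λ i → c i * b i T)

    module _ {L : List (Permutation′ n)} {c : ℚ} (acts : ActsAs L c) where

      acts-on-Specht : ∀ {v} → InSpecht μ v → ∀ T′ → ∑ L (λ σ → (_·_ μ σ v) T′) ≡ c * v T′
      acts-on-Specht {v} (cs , e) T′ = begin
        ∑ L (λ σ → v (_·ₜ_ μ (flip σ) T′))
          ≡⟨ ∑-cong L (λ σ → expand (_·ₜ_ μ (flip σ) T′)) ⟩
        ∑ L (λ σ → ∑ cs λ (a , T) → a * polytabloid μ T (_·ₜ_ μ (flip σ) T′))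
          ≡⟨ ∑-swap L cs _ ⟩
        ∑ cs (λ (a , T) → ∑ L λ σ → a * polytabloid μ T (_·ₜ_ μ (flip σ) T′))
          ≡⟨ ∑-cong cs (λ (a , T) → trans (∑-*ˡ L a _)
               (trans (cong (a *_) (acts T T′)) (*-swapˡ a c (polytabloid μ T T′)))) ⟩
        ∑ cs (λ (a , T) → c * (a * polytabloid μ T T′))
          ≡⟨ ∑-*ˡ cs c _ ⟩
        c * ∑ cs (λ (a , T) → a * polytabloid μ T T′)
          ≡⟨ cong (c *_) (sym (expand T′)) ⟩
        c * v T′ ∎
        where
        expand : ∀ T′ → v T′ ≡ ∑ cs λ (a , T) → a * polytabloid μ T T′
        expand T′ = trans (e T′) (Defs-∑ cs _)

      private
        M : Fin dim → Fin dim → ℚ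
        M i j = ∑ L λ σ → matrix σ i j

        δ : Fin dim → Fin dim → ℚ
        δ i j = ⟦ i Finₚ.≟ j ⟧

      -- Column j of either matrix expresses `c` times the basis vector j in the basis, and linear
      -- independence identifies the coefficients.
      M≡cδ : ∀ i j → M i j ≡ c * δ i j
      M≡cδ i j = +-cancelʳ (ℚ.- (c * δ i j)) _ _
        (trans (independent (λ k → M k j + ℚ.- (c * δ k j)) relation i)
               (sym (ℚₚ.+-inverseʳ (c * δ i j))))
        where
        relation : _≈ᵥ_ μ (combination μ basis (λ k → M k j + ℚ.- (c * δ k j))) (λ _ → 0ℚ)
        relation T = begin
          combination μ basis (λ k → M k j + ℚ.- (c * δ k j)) T
            ≡⟨ combination-∑ basis (λ k → M k j + ℚ.- (c * δ k j)) T ⟩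
          ∑ (allFin dim) (λ k → (M k j + ℚ.- (c * δ k j)) * basis k T)
            ≡⟨ ∑-cong (allFin dim) (λ k → trans (ℚₚ.*-distribʳ-+ (basis k T) (M k j) (ℚ.- (c * δ k j)))
                 (cong₂ _+_ (sym (∑-*ʳ L (basis k T) _))
                   (trans (cong (_* basis k T) (ℚₚ.neg-distribˡ-* c (δ k j)))
                          (*-assoc (ℚ.- c) (δ k j) (basis k T))))) ⟩
          ∑ (allFin dim) (λ k → ∑ L (λ σ → matrix σ k j * basis k T) + ℚ.- c * (δ k j * basis k T))
            ≡⟨ ∑-+ (allFin dim) _ _ ⟩
          ∑ (allFin dim) (λ k → ∑ L (λ σ → matrix σ k j * basis k T)) +
          ∑ (allFin dim) (λ k → ℚ.- c * (δ k j * basis k T))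
            ≡⟨ cong₂ _+_
                 (trans (∑-swap (allFin dim) L _)
                   (trans (∑-cong L λ σ → sym (trans (action σ j T) (combination-∑ basis (λ i → matrix σ i j) T)))
                          (acts-on-Specht (inSpecht j) T)))
                 (trans (∑-*ˡ (allFin dim) (ℚ.- c) _)
                        (cong (ℚ.- c *_) (∑-allFin-only j (λ k → basis k T)))) ⟩
          c * basis j T + ℚ.- c * basis j T
            ≡⟨ sym (ℚₚ.*-distribʳ-+ (basis j T) c (ℚ.- c)) ⟩
          (c + ℚ.- c) * basis j T
            ≡⟨ trans (cong (_* basis j T) (ℚₚ.+-inverseʳ c)) (ℚₚ.*-zeroˡ (basis j T)) ⟩
          0ℚ ∎

      ∑χ : ∑ L (χ V) ≡ c * nat dim
      ∑χ = begin
        ∑ L (λ σ → sum λ i → matrix σ i i)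
          ≡⟨ ∑-cong L (λ σ → sum-∑ (λ i → matrix σ i i)) ⟩
        ∑ L (λ σ → ∑ (allFin dim) λ i → matrix σ i i)
          ≡⟨ ∑-swap L (allFin dim) _ ⟩
        ∑ (allFin dim) (λ i → M i i)
          ≡⟨ ∑-cong (allFin dim) (λ i → trans (M≡cδ i i) (cong (c *_) (⟦⟧-yes (i Finₚ.≟ i) refl))) ⟩
        ∑ (allFin dim) (λ i → c * 1ℚ)
          ≡⟨ ∑-*ˡ (allFin dim) c (λ _ → 1ℚ) ⟩
        c * ∑ (allFin dim) (λ _ → 1ℚ)
          ≡⟨ cong (c *_) (trans (∑-ones (allFin dim)) (cong nat (Listₚ.length-tabulate {n = dim} (λ i → i)))) ⟩
        c * nat dim ∎

    -- The matrix of `idₚ` is known only through its action, so the degree is read off from `∑χ` for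
    -- the one-element list of `idₚ` with scalar 1.
    χ-id : χ V idₚ ≡ nat dim
    χ-id = trans (sym (ℚₚ.+-identityʳ _)) (trans (∑χ {idₚ ∷ []} {1ℚ} id-acts) (ℚₚ.*-identityˡ _))
      where
      id-acts : ActsAs (idₚ ∷ []) 1ℚ
      id-acts T T′ = trans (ℚₚ.+-identityʳ _) (trans (polytabloid-ϕ μ T (_·ₜ_ μ (flip idₚ) T′))
        (trans (ϕ-cong μ T {rowOf μ (_·ₜ_ μ (flip idₚ) T′)} {rowOf μ T′} (λ x → refl)) (trans (sym (polytabloid-ϕ μ T T′)) (sym (ℚₚ.*-identityˡ _)))))

    -- `polytabloid μ T` has value 1 at `T`, which an empty basis cannot produce. This keeps `_÷₀_`
    -- away from its default value.
    dim≢0 : Tableau μ → nat dim ≢ 0ℚ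
    dim≢0 T = helper dim basis spanning
      where
      one : polytabloid μ T T ≡ 1ℚ
      one = trans (polytabloid-ϕ μ T T) (ϕ-self μ T)
      helper : ∀ d (b : Fin d → Vector μ) →
        (∀ v → InSpecht μ v → ∃ λ c → _≈ᵥ_ μ v (combination μ b c)) → nat d ≢ 0ℚ
      helper zero b span e with span (polytabloid μ T)
        ((1ℚ , T) ∷ [] , λ T′ → sym (trans (ℚₚ.+-identityʳ _) (ℚₚ.*-identityˡ _)))
      ... | c , f = contradiction (trans (sym one) (f T)) λ ()
      helper (suc d) b span e = ℚₚ.<-irrefl (sym e) (nat>0 d)

    -- Each polytabloid is an eigenvector with an eigenvalue of its own; one common value makes the
    -- class sum a scalar on their span. The explicit formula found later depends on the shape alone
    -- and so supplies this common value.
    η-scalar : ∀ k {c} → Tableau μ → (∀ T → Φ μ T k (rowOf μ T) ≡ c) → η V k ≡ c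
    η-scalar k {c} T₀ scalar = begin
      Defs.∑ (𝒮 n k) (χ V) ÷₀ χ V idₚ
        ≡⟨ cong₂ _÷₀_ (trans (Defs-∑ (𝒮 n k) (χ V)) (∑χ {𝒮 n k} {c} acts)) χ-id ⟩
      (c * nat dim) ÷₀ nat dim
        ≡⟨ *-÷₀-cancel c (nat dim) (dim≢0 T₀) ⟩
      c ∎
      where
      acts : ActsAs (𝒮 n k) c
      acts T T′ = begin
        ∑ (𝒮 n k) (λ σ → polytabloid μ T (_·ₜ_ μ (flip σ) T′))
          ≡⟨ ∑-filter (λ σ → #fixed σ ℕₚ.≟ k) (permutations n) _ ⟩
        ∑ (permutations n) (λ σ → ⟦ #fixed σ ℕₚ.≟ k ⟧ * polytabloid μ T (_·ₜ_ μ (flip σ) T′))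
          ≡⟨ ∑-cong (permutations n) (λ σ → cong (⟦ #fixed σ ℕₚ.≟ k ⟧ *_) (polytabloid-ϕ μ T (_·ₜ_ μ (flip σ) T′))) ⟩
        Φ μ T k (rowOf μ T′)
          ≡⟨ Φ-eigenvector μ T k T′ ⟩
        Φ μ T k (rowOf μ T) * ϕ μ T (rowOf μ T′)
          ≡⟨ cong₂ _*_ (scalar T) (sym (polytabloid-ϕ μ T T′)) ⟩
        c * polytabloid μ T T′ ∎

-- Dual numbers over ℚ

module DualNumbers where
  open Summation
  open Permutations

  infix 5 _+ε_

  record Dual : Set where
    constructor _+ε_
    field
      re du : ℚ

  open Dual public

  private
    _⊕_ _⊗_ : Dual → Dual → Dual
    (a +ε b) ⊕ (c +ε d) = (a ℚ.+ c) +ε (b ℚ.+ d)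
    (a +ε b) ⊗ (c +ε d) = (a ℚ.* c) +ε (a ℚ.* d ℚ.+ b ℚ.* c)

    open +-*-Solver

    isCommutativeSemiring : IsCommutativeSemiring _≡_ _⊕_ _⊗_ (0ℚ +ε 0ℚ) (1ℚ +ε 0ℚ)
    isCommutativeSemiring = isCommutativeSemiringˡ record
      { +-isCommutativeMonoid = record
        { isMonoid = record
          { isSemigroup = record
            { isMagma = record { isEquivalence = isEquivalence ; ∙-cong = cong₂ _⊕_ }
            ; assoc = λ (a +ε b) (c +ε d) (e +ε f) → cong₂ _+ε_ (ℚₚ.+-assoc a c e) (ℚₚ.+-assoc b d f)
            }
          ; identity = (λ (a +ε b) → cong₂ _+ε_ (ℚₚ.+-identityˡ a) (ℚₚ.+-identityˡ b))
                     , (λ (a +ε b) → cong₂ _+ε_ (ℚₚ.+-identityʳ a) (ℚₚ.+-identityʳ b))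
          }
        ; comm = λ (a +ε b) (c +ε d) → cong₂ _+ε_ (ℚₚ.+-comm a c) (ℚₚ.+-comm b d)
        }
      ; *-isCommutativeMonoid = record
        { isMonoid = record
          { isSemigroup = record
            { isMagma = record { isEquivalence = isEquivalence ; ∙-cong = cong₂ _⊗_ }
            ; assoc = λ (a +ε b) (c +ε d) (e +ε f) → cong₂ _+ε_ (ℚₚ.*-assoc a c e)
                (solve 6 (λ a b c d e f →
                   (a :* c) :* f :+ (a :* d :+ b :* c) :* e := a :* (c :* f :+ d :* e) :+ b :* (c :* e))
                   refl a b c d e f)
            }
          ; identity = (λ (a +ε b) → cong₂ _+ε_ (ℚₚ.*-identityˡ a)
                         (solve 2 (λ a b → con 1ℚ :* b :+ con 0ℚ :* a := b) refl a b))
                     , (λ (a +ε b) → cong₂ _+ε_ (ℚₚ.*-identityʳ a)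
                         (solve 2 (λ a b → a :* con 0ℚ :+ b :* con 1ℚ := b) refl a b))
          }
        ; comm = λ (a +ε b) (c +ε d) → cong₂ _+ε_ (ℚₚ.*-comm a c)
            (solve 4 (λ a b c d → a :* d :+ b :* c := c :* b :+ d :* a) refl a b c d)
        }
      ; distribʳ = λ (a +ε b) (c +ε d) (e +ε f) → cong₂ _+ε_ (ℚₚ.*-distribʳ-+ a c e)
          (solve 6 (λ a b c d e f →
             (c :+ e) :* b :+ (d :+ f) :* a := (c :* b :+ d :* a) :+ (e :* b :+ f :* a)) refl a b c d e f)
      ; zeroˡ = λ (a +ε b) → cong₂ _+ε_ (ℚₚ.*-zeroˡ a)
          (solve 2 (λ a b → con 0ℚ :* b :+ con 0ℚ :* a := con 0ℚ) refl a b)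
      }

  Dual-semiring : ≡-CommutativeSemiring
  Dual-semiring = record { isCommutativeSemiring = isCommutativeSemiring }

  module ΣD where
    open Sums Dual-semiring public
    open PermutationSums Dual-semiring public

  open ≡-CommutativeSemiring Dual-semiring public using (_+_; _*_; 0#; 1#)

  ι : ℚ → Dual
  ι a = a +ε 0ℚ

  ε -1D : Dual
  ε   = 0ℚ +ε 1ℚ
  -1D = ι (ℚ.- 1ℚ)

  ι-* : ∀ a b → ι (a ℚ.* b) ≡ ι a * ι b
  ι-* a b = cong (a ℚ.* b +ε_) (solve 2 (λ a b → con 0ℚ := a :* con 0ℚ :+ con 0ℚ :* b) refl a b)

  du-ι-* : ∀ a x → du (ι a * x) ≡ a ℚ.* du x
  du-ι-* a (c +ε d) = solve 3 (λ a c d → a :* d :+ con 0ℚ :* c := a :* d) refl a c d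

  du-∑ : ∀ {a} {A : Set a} (xs : List A) (f : A → Dual) →
    du (ΣD.∑ xs f) ≡ Σℚ.∑ xs (λ x → du (f x))
  du-∑ []       f = refl
  du-∑ (x ∷ xs) f = cong (du (f x) ℚ.+_) (du-∑ xs f)

  ⟦⟧-ι : ∀ {p} {P : Set p} (d : Dec P) → ΣD.⟦ d ⟧ ≡ ι Σℚ.⟦ d ⟧
  ⟦⟧-ι (yes _) = refl
  ⟦⟧-ι (no _)  = refl

  -- The reason for taking x = ε: the coefficient of ε retains exactly the pairs with one common
  -- fixed point.
  du-ε^ : ∀ k → du (ΣD.pow ε k) ≡ Σℚ.⟦ k ℕₚ.≟ 1 ⟧
  du-ε^ zero          = refl
  du-ε^ (suc zero)    = refl
  du-ε^ (suc (suc k)) = cong du (ε²x (ΣD.pow ε k))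
    where
    ε²x : ∀ x → ε * (ε * x) ≡ 0#
    ε²x (c +ε d) = cong₂ _+ε_
      (solve 2 (λ c d → con 0ℚ :* (con 0ℚ :* c) := con 0ℚ) refl c d)
      (solve 2 (λ c d → con 0ℚ :* (con 0ℚ :* d :+ con 1ℚ :* c) :+ con 1ℚ :* (con 0ℚ :* c) := con 0ℚ) refl c d)

-- Expanding the generating function over transversals

module TransversalExpansion where
  open Summation
  open Permutations
  open import Defs using (permutations)

  module _ {n : ℕ} where
    open Data.List.Membership.DecPropositional (Finₚ._≟_ {n}) public using (_∈?_)

  module MembershipSums (S : ≡-CommutativeSemiring) where
    open ≡-CommutativeSemiring S
    open Sums S

    ∑-∈ : ∀ {n} {xs : List (Fin n)} → Unique xs → (f : Fin n → R) →
      ∑ (allFin n) (λ z → ⟦ z ∈? xs ⟧ * f z) ≡ ∑ xs f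
    ∑-∈ {n} {[]}     []            f = ∑-zero (allFin n) λ z → zeroˡ (f z)
    ∑-∈ {n} {x ∷ xs} (x∉xs ∷ uniq) f = begin
      ∑ (allFin n) (λ z → ⟦ z ∈? (x ∷ xs) ⟧ * f z)
        ≡⟨ ∑-cong (allFin n) (λ z → trans (cong (_* f z) (split z)) (distribʳ (f z) _ _)) ⟩
      ∑ (allFin n) (λ z → ⟦ z Finₚ.≟ x ⟧ * f z + ⟦ z ∈? xs ⟧ * f z)
        ≡⟨ ∑-+ (allFin n) _ _ ⟩
      ∑ (allFin n) (λ z → ⟦ z Finₚ.≟ x ⟧ * f z) + ∑ (allFin n) (λ z → ⟦ z ∈? xs ⟧ * f z)
        ≡⟨ cong₂ _+_ (∑-allFin-only x f) (∑-∈ uniq f) ⟩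
      f x + ∑ xs f ∎
      where
      open ≡-Reasoning
      split : ∀ z → ⟦ z ∈? (x ∷ xs) ⟧ ≡ ⟦ z Finₚ.≟ x ⟧ + ⟦ z ∈? xs ⟧
      split z = by-cases (z Finₚ.≟ x)
        where
        by-cases : Dec (z ≡ x) → ⟦ z ∈? (x ∷ xs) ⟧ ≡ ⟦ z Finₚ.≟ x ⟧ + ⟦ z ∈? xs ⟧
        by-cases (yes e) = trans (⟦⟧-yes (z ∈? (x ∷ xs)) (here e))
          (sym (trans (cong₂ _+_ (⟦⟧-yes (z Finₚ.≟ x) e)
                        (⟦⟧-no (z ∈? xs) λ z∈xs → All.lookup x∉xs z∈xs (sym e)))
                      (+-identityʳ 1#)))
        by-cases (no z≢x) = trans
          (⟦⟧-cong (z ∈? (x ∷ xs)) (z ∈? xs) (λ { (here e) → contradiction e z≢x ; (there p) → p }) there)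
          (sym (trans (cong (_+ ⟦ z ∈? xs ⟧) (⟦⟧-no (z Finₚ.≟ x) z≢x)) (+-identityˡ _)))

  module TransversalSums (S : ≡-CommutativeSemiring)
    {n : ℕ} (row col : Fin n → ℕ) (y : ≡-CommutativeSemiring.R S) where

    open ≡-CommutativeSemiring S
    open Sums S

    free? : (x : Fin n) (us : List (Fin n)) → Dec (¬ Any (λ z → col x ≡ col z) us)
    free? x us = ¬? (Any.any? (λ z → col x ℕₚ.≟ col z) us)

    rowCount : Fin n → List (Fin n) → R
    rowCount x us = ∑ us λ z → ⟦ row z ℕₚ.≟ row x ⟧

    -- The sum over all ways to extend the transversal us by cells of xs.
    transversals : List (Fin n) → List (Fin n) → R
    transversals []       us = 1#
    transversals (x ∷ xs) us =
      y * transversals xs us + ⟦ free? x us ⟧ * ((1# + rowCount x us) * transversals xs (x ∷ us))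

  -- A semiring has no subtraction, so the element -1 and the fact that only zero equals its own
  -- negative come along with the sign.
  record SignCharacter (S : ≡-CommutativeSemiring) (n : ℕ) : Set where
    open ≡-CommutativeSemiring S
    field
      -1#          : R
      neg-fixed    : ∀ x → x ≡ -1# * x → x ≡ 0#
      sg           : Permutation′ n → R
      sg-cong      : ∀ {σ τ} → σ ≈ τ → sg σ ≡ sg τ
      sg-id        : sg idₚ ≡ 1#
      sg-transpose : ∀ q {x z} → x ≢ z → sg (q ∘ₚ transpose x z) ≡ -1# * sg q

  module Expansion {S : ≡-CommutativeSemiring} {n : ℕ} (signCharacter : SignCharacter S n)
    (row col : Fin n → ℕ) (y : ≡-CommutativeSemiring.R S) where

    open ≡-CommutativeSemiring S
    open SignCharacter signCharacter
    open Sums S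
    open PermutationSums S
    open MembershipSums S
    open TransversalSums S row col y
    open ≡-Reasoning

    Stabilises : (Fin n → ℕ) → List (Fin n) → Permutation′ n → Set
    Stabilises f vs p = (∀ x → f (p ⟨$⟩ʳ x) ≡ f x) × (∀ x → x ∈ vs ⊎ p ⟨$⟩ʳ x ≡ x)

    stabilises? : ∀ f vs p → Dec (Stabilises f vs p)
    stabilises? f vs p = (Finₚ.all? λ x → f (p ⟨$⟩ʳ x) ℕₚ.≟ f x) ×-dec
                         (Finₚ.all? λ x → (x ∈? vs) ⊎-dec ((p ⟨$⟩ʳ x) Finₚ.≟ x))

    stabilises-cong : ∀ f vs {σ τ} → σ ≈ τ → Stabilises f vs σ → Stabilises f vs τ
    stabilises-cong f vs e (s , m) =
      (λ x → trans (cong f (sym (e x))) (s x)) ,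
      (λ x → [ inj₁ , (λ h → inj₂ (trans (sym (e x)) h)) ]′ (m x))

    stabilises-⊆ : ∀ f {vs ws} p → (∀ {x} → x ∈ vs → x ∈ ws) → Stabilises f vs p → Stabilises f ws p
    stabilises-⊆ f p sub (s , m) = s , (λ x → [ inj₁ ∘ sub , inj₂ ]′ (m x))

    ⟦stabilises⟧-cong : ∀ f vs {σ τ} → σ ≈ τ → ⟦ stabilises? f vs σ ⟧ ≡ ⟦ stabilises? f vs τ ⟧
    ⟦stabilises⟧-cong f vs {σ} {τ} e = ⟦⟧-cong (stabilises? f vs σ) (stabilises? f vs τ)
      (stabilises-cong f vs {σ} {τ} e) (stabilises-cong f vs {τ} {σ} (λ i → sym (e i)))

    module _ (f : Fin n → ℕ) (vs : List (Fin n)) {x z : Fin n} (fx≡fz : f x ≡ f z) where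

      stabilises-transpose : (∀ {u} → u ∉ vs → u ≢ x × u ≢ z) → ∀ p →
        Stabilises f vs p → Stabilises f vs (p ∘ₚ transpose x z)
      stabilises-transpose away p (s , m) =
        (λ u → trans (transpose-preserves f fx≡fz (p ⟨$⟩ʳ u)) (s u)) , fixed
        where
        fixed : ∀ u → u ∈ vs ⊎ transpose x z ⟨$⟩ʳ (p ⟨$⟩ʳ u) ≡ u
        fixed u with u ∈? vs | m u
        ... | yes u∈ | _       = inj₁ u∈
        ... | no u∉  | inj₁ u∈ = contradiction u∈ u∉
        ... | no u∉  | inj₂ e  = inj₂ (trans (cong (transpose x z ⟨$⟩ʳ_) e)
                                   (transpose-other (proj₁ (away u∉)) (proj₂ (away u∉))))

      stabilises-transpose⁻ : (∀ {u} → u ∉ vs → u ≢ x × u ≢ z) → ∀ p →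
        Stabilises f vs (p ∘ₚ transpose x z) → Stabilises f vs p
      stabilises-transpose⁻ away p (s , m) =
        (λ u → trans (sym (transpose-preserves f fx≡fz (p ⟨$⟩ʳ u))) (s u)) , fixed
        where
        fixed : ∀ u → u ∈ vs ⊎ p ⟨$⟩ʳ u ≡ u
        fixed u with u ∈? vs | m u
        ... | yes u∈ | _       = inj₁ u∈
        ... | no u∉  | inj₁ u∈ = contradiction u∈ u∉
        ... | no u∉  | inj₂ e  = inj₂ (permute-injective (transpose x z) (trans e
                                   (sym (transpose-other (proj₁ (away u∉)) (proj₂ (away u∉))))))

    stabilises-∷ : ∀ f {x vs} → x ∉ vs → ∀ p →
      ⟦ stabilises? f (x ∷ vs) p ⟧ * ⟦ (p ⟨$⟩ʳ x) Finₚ.≟ x ⟧ ≡ ⟦ stabilises? f vs p ⟧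
    stabilises-∷ f {x} {vs} x∉vs p =
      trans (sym (⟦⟧-× (stabilises? f (x ∷ vs) p) ((p ⟨$⟩ʳ x) Finₚ.≟ x)))
            (⟦⟧-cong (stabilises? f (x ∷ vs) p ×-dec ((p ⟨$⟩ʳ x) Finₚ.≟ x)) (stabilises? f vs p) to from)
      where
      to : Stabilises f (x ∷ vs) p × p ⟨$⟩ʳ x ≡ x → Stabilises f vs p
      to ((s , m) , e) = s , λ u → [ (λ { (here refl) → inj₂ e ; (there u∈) → inj₁ u∈ }) , inj₂ ]′ (m u)
      from : Stabilises f vs p → Stabilises f (x ∷ vs) p × p ⟨$⟩ʳ x ≡ x
      from (s , m) = stabilises-⊆ f p there (s , m)
                   , [ (λ x∈ → contradiction x∈ x∉vs) , id ]′ (m x)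

    -- For a list without repetitions, `N` is the product of the factorials uᵢ!, and `D` is 1 on
    -- transversals and 0 on all other lists.
    N D : List (Fin n) → R
    N us = ∑ (permutations n) λ p → ⟦ stabilises? row us p ⟧
    D us = ∑ (permutations n) λ q → ⟦ stabilises? col us q ⟧ * sg q

    N-[] : N [] ≡ 1#
    N-[] = trans (∑-cong (permutations n) λ p → ⟦⟧-cong (stabilises? row [] p) (p ≈? idₚ)
             (λ (_ , m) x → [ (λ ()) , id ]′ (m x)) (λ e → (λ x → cong row (e x)) , inj₂ ∘ e))
           (∑-permutations-≈ (idₚ {n}))

    -- Split by the image z of `x`, which must be `x` or an entry of `us` in the same row. Composing
    -- with the transposition of `x` and z identifies each class with the permutations fixing `x`.
    -- The factor is the one by which uᵢ! grows.
    N-∷ : ∀ {x us} → Unique (x ∷ us) →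
      N (x ∷ us) ≡ (1# + ∑ us (λ z → ⟦ row z ℕₚ.≟ row x ⟧)) * N us
    N-∷ {x} {us} uniq@(x∉ ∷ _) = begin
      ∑ (permutations n) (λ p → ⟦ stabilises? row (x ∷ us) p ⟧)
        ≡⟨ ∑-cong (permutations n) (λ p → trans (sym (*-identityʳ _))
             (trans (cong (⟦ stabilises? row (x ∷ us) p ⟧ *_) (sym (∑-allFin-≟′ (p ⟨$⟩ʳ x))))
                    (sym (∑-*ˡ (allFin n) _ _)))) ⟩
      ∑ (permutations n) (λ p → ∑ (allFin n) λ z → g z p)
        ≡⟨ ∑-swap (permutations n) (allFin n) _ ⟩
      ∑ (allFin n) (λ z → ∑ (permutations n) (g z))
        ≡⟨ ∑-cong (allFin n) inner ⟩
      ∑ (allFin n) (λ z → (⟦ z ∈? (x ∷ us) ⟧ * ⟦ row z ℕₚ.≟ row x ⟧) * N us)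
        ≡⟨ ∑-*ʳ (allFin n) (N us) _ ⟩
      ∑ (allFin n) (λ z → ⟦ z ∈? (x ∷ us) ⟧ * ⟦ row z ℕₚ.≟ row x ⟧) * N us
        ≡⟨ cong (_* N us) (∑-∈ uniq (λ z → ⟦ row z ℕₚ.≟ row x ⟧)) ⟩
      (⟦ row x ℕₚ.≟ row x ⟧ + ∑ us (λ z → ⟦ row z ℕₚ.≟ row x ⟧)) * N us
        ≡⟨ cong (λ w → (w + ∑ us (λ z → ⟦ row z ℕₚ.≟ row x ⟧)) * N us) (⟦⟧-yes (row x ℕₚ.≟ row x) refl) ⟩
      (1# + ∑ us (λ z → ⟦ row z ℕₚ.≟ row x ⟧)) * N us ∎
      where
      g : Fin n → Permutation′ n → R
      g z p = ⟦ stabilises? row (x ∷ us) p ⟧ * ⟦ (p ⟨$⟩ʳ x) Finₚ.≟ z ⟧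

      x∉us : x ∉ us
      x∉us x∈us = All.lookup x∉ x∈us refl

      g-ext : ∀ z → Extensional (g z)
      g-ext z {σ} {τ} e = cong₂ _*_ (⟦stabilises⟧-cong row (x ∷ us) {σ} {τ} e)
                                    (cong (λ w → ⟦ w Finₚ.≟ z ⟧) (e x))

      inner : ∀ z → ∑ (permutations n) (g z) ≡ (⟦ z ∈? (x ∷ us) ⟧ * ⟦ row z ℕₚ.≟ row x ⟧) * N us
      inner z with z ∈? (x ∷ us) | row z ℕₚ.≟ row x
      ... | no z∉ | d = trans (∑-zero (permutations n) g≡0)
          (sym (trans (cong (_* N us) (zeroˡ ⟦ d ⟧)) (zeroˡ (N us))))
        where
        g≡0 : ∀ p → g z p ≡ 0#
        g≡0 p = trans (⟦⟧*-cong (stabilises? row (x ∷ us) p) (λ (_ , m) →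
          ⟦⟧-no ((p ⟨$⟩ʳ x) Finₚ.≟ z) λ e → [ z∉ , (λ pz≡z → z∉ (here (sym (permute-injective p (trans e (sym pz≡z)))))) ]′ (m z)))
          (zeroʳ _)
      ... | yes _ | no row≢ = trans (∑-zero (permutations n) g≡0)
          (sym (trans (cong (_* N us) (zeroʳ 1#)) (zeroˡ (N us))))
        where
        g≡0 : ∀ p → g z p ≡ 0#
        g≡0 p = trans (⟦⟧*-cong (stabilises? row (x ∷ us) p) (λ (s , _) →
          ⟦⟧-no ((p ⟨$⟩ʳ x) Finₚ.≟ z) λ e → row≢ (trans (cong row (sym e)) (s x))))
          (zeroʳ _)
      ... | yes z∈ | yes row≡ = begin
        ∑ (permutations n) (g z)
          ≡⟨ sym (∑-permutations-∘ʳ t (g z) (λ {σ} {τ} → g-ext z {σ} {τ})) ⟩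
        ∑ (permutations n) (λ p → g z (p ∘ₚ t))
          ≡⟨ ∑-cong (permutations n) (λ p → trans (cong₂ _*_ (sym (shift p)) (sym (fix p)))
               (stabilises-∷ row x∉us p)) ⟩
        N us
          ≡⟨ sym (trans (cong (_* N us) (*-identityˡ 1#)) (*-identityˡ (N us))) ⟩
        (1# * 1#) * N us ∎
        where
        t = transpose x z
        away : ∀ {u} → u ∉ x ∷ us → u ≢ x × u ≢ z
        away u∉ = (λ { refl → u∉ (here refl) }) , (λ { refl → u∉ z∈ })
        shift : ∀ p → ⟦ stabilises? row (x ∷ us) p ⟧ ≡ ⟦ stabilises? row (x ∷ us) (p ∘ₚ t) ⟧
        shift p = ⟦⟧-cong (stabilises? row (x ∷ us) p) (stabilises? row (x ∷ us) (p ∘ₚ t))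
          (stabilises-transpose row (x ∷ us) (sym row≡) away p)
          (stabilises-transpose⁻ row (x ∷ us) (sym row≡) away p)
        fix : ∀ p → ⟦ (p ⟨$⟩ʳ x) Finₚ.≟ x ⟧ ≡ ⟦ ((p ∘ₚ t) ⟨$⟩ʳ x) Finₚ.≟ z ⟧
        fix p = ⟦⟧-cong ((p ⟨$⟩ʳ x) Finₚ.≟ x) (((p ∘ₚ t) ⟨$⟩ʳ x) Finₚ.≟ z)
          (λ e → trans (cong (t ⟨$⟩ʳ_) e) (transpose-left x z))
          (λ e → permute-injective t (trans e (sym (transpose-left x z))))

    -- Composition with the transposition of `x` and `z` permutes the summands and changes every
    -- sign.
    D-conflict : ∀ {us x z} → x ∈ us → z ∈ us → x ≢ z → col x ≡ col z → D us ≡ 0#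
    D-conflict {us} {x} {z} x∈ z∈ x≢z col≡ = neg-fixed (D us) (begin
      D us
        ≡⟨ sym (∑-permutations-∘ʳ t g (λ {σ} {τ} → g-ext {σ} {τ})) ⟩
      ∑ (permutations n) (λ q → g (q ∘ₚ t))
        ≡⟨ ∑-cong (permutations n) (λ q → trans (cong₂ _*_ (sym (shift q)) (sg-transpose q x≢z))
             (*-swapˡ ⟦ stabilises? col us q ⟧ -1# (sg q))) ⟩
      ∑ (permutations n) (λ q → -1# * g q)
        ≡⟨ ∑-*ˡ (permutations n) -1# g ⟩
      -1# * D us ∎)
      where
      t = transpose x z
      g : Permutation′ n → R
      g q = ⟦ stabilises? col us q ⟧ * sg q
      g-ext : Extensional g
      g-ext {σ} {τ} e = cong₂ _*_ (⟦stabilises⟧-cong col us {σ} {τ} e) (sg-cong {σ} {τ} e)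
      away : ∀ {u} → u ∉ us → u ≢ x × u ≢ z
      away u∉ = (λ { refl → u∉ x∈ }) , (λ { refl → u∉ z∈ })
      shift : ∀ p → ⟦ stabilises? col us p ⟧ ≡ ⟦ stabilises? col us (p ∘ₚ t) ⟧
      shift p = ⟦⟧-cong (stabilises? col us p) (stabilises? col us (p ∘ₚ t))
        (stabilises-transpose col us col≡ away p)
        (stabilises-transpose⁻ col us col≡ away p)

    Transversal : List (Fin n) → Set
    Transversal = AllPairs (λ x z → col x ≢ col z)

    transversal-injective : ∀ {us} → Transversal us → ∀ {x z} → x ∈ us → z ∈ us → col x ≡ col z → x ≡ z
    transversal-injective (h ∷ t) (here refl) (here refl) e = refl
    transversal-injective (h ∷ t) (here refl) (there z∈)  e = contradiction e (All.lookup h z∈)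
    transversal-injective (h ∷ t) (there x∈)  (here refl) e = contradiction (sym e) (All.lookup h x∈)
    transversal-injective (h ∷ t) (there x∈)  (there z∈)  e = transversal-injective t x∈ z∈ e

    -- Every entry of `us` is alone in its column there, so a column permutation supported on `us`
    -- moves nothing.
    D-transversal : ∀ {us} → Transversal us → D us ≡ 1#
    D-transversal {us} tr = trans
      (∑-cong (permutations n) λ q → cong (_* sg q)
        (⟦⟧-cong (stabilises? col us q) (q ≈? idₚ) (isId q)
          (λ e → (λ x → cong col (e x)) , inj₂ ∘ e)))
      (trans (∑-permutations-only-id sg (λ {σ} {τ} → sg-cong {σ} {τ})) sg-id)
      where
      isId : ∀ q → Stabilises col us q → q ≈ idₚ
      isId q (s , m) x with m x
      ... | inj₂ e = e
      ... | inj₁ x∈ with m (q ⟨$⟩ʳ x)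
      ...   | inj₂ e   = permute-injective q e
      ...   | inj₁ qx∈ = transversal-injective tr qx∈ x∈ (s x)

    common? : (p q : Permutation′ n) (x : Fin n) → Dec (p ⟨$⟩ʳ x ≡ x × q ⟨$⟩ʳ x ≡ x)
    common? p q x = ((p ⟨$⟩ʳ x) Finₚ.≟ x) ×-dec ((q ⟨$⟩ʳ x) Finₚ.≟ x)

    weight : List (Fin n) → Permutation′ n → Permutation′ n → R
    weight xs p q = ∏ xs λ x → 1# + y * ⟦ common? p q x ⟧

    -- An intermediate stage of the expansion: the entries of `xs` still carry their factor 1 + y
    -- [common fixed point], while those of `us` have been chosen as unconstrained. All other
    -- entries are fixed by both permutations.
    W : List (Fin n) → List (Fin n) → R
    W xs us = ∑ (permutations n) λ p → ∑ (permutations n) λ q →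
      (⟦ stabilises? row (xs ++ us) p ⟧ * ⟦ stabilises? col (xs ++ us) q ⟧) * (sg q * weight xs p q)

    W-[] : ∀ us → W [] us ≡ N us * D us
    W-[] us = begin
      ∑ (permutations n) (λ p → ∑ (permutations n) λ q → (A p * B q) * (sg q * 1#))
        ≡⟨ ∑-cong (permutations n) (λ p → trans
             (∑-cong (permutations n) λ q → trans (cong (A p * B q *_) (*-identityʳ (sg q))) (*-assoc (A p) (B q) (sg q)))
             (∑-*ˡ (permutations n) (A p) (λ q → B q * sg q))) ⟩
      ∑ (permutations n) (λ p → A p * D us)
        ≡⟨ ∑-*ʳ (permutations n) (D us) A ⟩
      N us * D us ∎
      where
      A B : Permutation′ n → R
      A p = ⟦ stabilises? row us p ⟧
      B q = ⟦ stabilises? col us q ⟧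

    -- Either x stays unconstrained, or it is a common fixed point.
    W-∷ : ∀ {x xs us} → x ∉ xs ++ us → W (x ∷ xs) us ≡ y * W xs us + W xs (x ∷ us)
    W-∷ {x} {xs} {us} x∉ = begin
      W (x ∷ xs) us
        ≡⟨ ∑-cong (permutations n) (λ p → trans (∑-cong (permutations n) (summand p))
             (trans (∑-+ (permutations n) _ _) (cong (_+ ∑ (permutations n) (G p)) (∑-*ˡ (permutations n) y (F p))))) ⟩
      ∑ (permutations n) (λ p → y * ∑ (permutations n) (F p) + ∑ (permutations n) (G p))
        ≡⟨ ∑-+ (permutations n) _ _ ⟩
      ∑ (permutations n) (λ p → y * ∑ (permutations n) (F p)) + W xs (x ∷ us)
        ≡⟨ cong (_+ W xs (x ∷ us)) (∑-*ˡ (permutations n) y _) ⟩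
      y * W xs us + W xs (x ∷ us) ∎
      where
      F G : Permutation′ n → Permutation′ n → R
      F p q = (⟦ stabilises? row (xs ++ us) p ⟧ * ⟦ stabilises? col (xs ++ us) q ⟧) * (sg q * weight xs p q)
      G p q = (⟦ stabilises? row (xs ++ x ∷ us) p ⟧ * ⟦ stabilises? col (xs ++ x ∷ us) q ⟧) * (sg q * weight xs p q)

      move : ∀ {u} → u ∈ x ∷ xs ++ us → u ∈ xs ++ x ∷ us
      move (here e) = ∈-++⁺ʳ xs (here e)
      move (there u∈) with ∈-++⁻ xs u∈
      ... | inj₁ u∈xs = ∈-++⁺ˡ u∈xs
      ... | inj₂ u∈us = ∈-++⁺ʳ xs (there u∈us)

      move⁻ : ∀ {u} → u ∈ xs ++ x ∷ us → u ∈ x ∷ xs ++ us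
      move⁻ u∈ with ∈-++⁻ xs u∈
      ... | inj₁ u∈xs         = there (∈-++⁺ˡ u∈xs)
      ... | inj₂ (here e)     = here e
      ... | inj₂ (there u∈us) = there (∈-++⁺ʳ xs u∈us)

      moved : ∀ f p → ⟦ stabilises? f (x ∷ xs ++ us) p ⟧ ≡ ⟦ stabilises? f (xs ++ x ∷ us) p ⟧
      moved f p = ⟦⟧-cong (stabilises? f (x ∷ xs ++ us) p) (stabilises? f (xs ++ x ∷ us) p)
        (stabilises-⊆ f p move) (stabilises-⊆ f p move⁻)

      summand : ∀ p q →
        (⟦ stabilises? row (x ∷ xs ++ us) p ⟧ * ⟦ stabilises? col (x ∷ xs ++ us) q ⟧) *
          (sg q * ((1# + y * ⟦ common? p q x ⟧) * weight xs p q)) ≡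
        y * F p q + G p q
      summand p q = begin
        (A * B) * (s * ((1# + y * ⟦ common? p q x ⟧) * w))
          ≡⟨ cong (λ c → (A * B) * (s * ((1# + y * c) * w)))
               (⟦⟧-× ((p ⟨$⟩ʳ x) Finₚ.≟ x) ((q ⟨$⟩ʳ x) Finₚ.≟ x)) ⟩
        (A * B) * (s * ((1# + y * (a * b)) * w))
          ≡⟨ rearrange A B s a b w ⟩
        y * (((A * a) * (B * b)) * (s * w)) + (A * B) * (s * w)
          ≡⟨ cong₂ (λ u v → y * (u * (s * w)) + v * (s * w))
               (cong₂ _*_ (stabilises-∷ row x∉ p) (stabilises-∷ col x∉ q))
               (cong₂ _*_ (moved row p) (moved col q)) ⟩
        y * F p q + G p q ∎
        where
        A = ⟦ stabilises? row (x ∷ xs ++ us) p ⟧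
        B = ⟦ stabilises? col (x ∷ xs ++ us) q ⟧
        a = ⟦ (p ⟨$⟩ʳ x) Finₚ.≟ x ⟧
        b = ⟦ (q ⟨$⟩ʳ x) Finₚ.≟ x ⟧
        s = sg q
        w = weight xs p q
        rearrange : ∀ A B s a b w → (A * B) * (s * ((1# + y * (a * b)) * w)) ≡
          y * (((A * a) * (B * b)) * (s * w)) + (A * B) * (s * w)
        rearrange A B s a b w = trans
          (solve 8 (λ A B s a b w y o →
            (A :* B) :* (s :* ((o :+ y :* (a :* b)) :* w)) :=
            y :* (((A :* a) :* (B :* b)) :* (s :* w)) :+ (A :* B) :* (s :* (o :* w)))
            refl A B s a b w y 1#)
          (cong (λ v → y * (((A * a) * (B * b)) * (s * w)) + (A * B) * (s * v)) (*-identityˡ w))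
          where open Solver

    private
      Fresh : List (Fin n) → List (Fin n) → Set
      Fresh us = All (_∉ us)

      fresh-∉ : {x : Fin n} {xs us : List (Fin n)} → All (x ≢_) xs → x ∉ us → x ∉ xs ++ us
      fresh-∉ {xs = xs} x∉xs x∉us x∈ with ∈-++⁻ xs x∈
      ... | inj₁ p = All.lookup x∉xs p refl
      ... | inj₂ p = x∉us p

      fresh-∷ : {x : Fin n} {xs us : List (Fin n)} → All (x ≢_) xs → Fresh us xs → Fresh (x ∷ us) xs
      fresh-∷ x∉xs fresh = All.zipWith (λ (x≢v , v∉) → λ { (here e) → x≢v (sym e) ; (there p) → v∉ p }) (x∉xs , fresh)

    -- Two chosen entries of one column stay chosen in every later stage, so each final term
    -- contains a vanishing `D`.
    W-conflict : ∀ {xs us x z} → Unique xs → Fresh us xs → x ∈ us → z ∈ us → x ≢ z → col x ≡ col z →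
      W xs us ≡ 0#
    W-conflict {[]} {us} _ _ x∈ z∈ x≢z e =
      trans (W-[] us) (trans (cong (N us *_) (D-conflict x∈ z∈ x≢z e)) (zeroʳ (N us)))
    W-conflict {v ∷ xs} (v∉xs ∷ uniq) (v∉us ∷ fresh) x∈ z∈ x≢z e = trans (W-∷ (fresh-∉ v∉xs v∉us))
      (trans (cong₂ _+_
               (trans (cong (y *_) (W-conflict uniq fresh x∈ z∈ x≢z e)) (zeroʳ y))
               (W-conflict uniq (fresh-∷ v∉xs fresh) (there x∈) (there z∈) x≢z e))
             (+-identityˡ 0#))

    -- `W-∷` follows the recursion of `transversals`: choosing an entry in an occupied column gives
    -- zero, and choosing a free one multiplies `N` by 1 plus the count of its row.
    W-transversals : ∀ {xs us} → Unique xs → Fresh us xs → Transversal us →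
      W xs us ≡ N us * transversals xs us
    W-transversals {[]} {us} _ _ tr = trans (W-[] us) (cong (N us *_) (D-transversal tr))
    W-transversals {x ∷ xs} {us} (x∉xs ∷ uniq) (x∉us ∷ fresh) tr = begin
      W (x ∷ xs) us
        ≡⟨ W-∷ (fresh-∉ x∉xs x∉us) ⟩
      y * W xs us + W xs (x ∷ us)
        ≡⟨ cong₂ _+_ (trans (cong (y *_) (W-transversals uniq fresh tr)) (*-swapˡ y (N us) _)) second ⟩
      N us * (y * transversals xs us) + N us * (⟦ free? x us ⟧ * ((1# + rowCount x us) * transversals xs (x ∷ us)))
        ≡⟨ sym (distribˡ (N us) _ _) ⟩
      N us * transversals (x ∷ xs) us ∎
      where
      second : W xs (x ∷ us) ≡ N us * (⟦ free? x us ⟧ * ((1# + rowCount x us) * transversals xs (x ∷ us)))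
      second with Any.any? (λ z → col x ℕₚ.≟ col z) us
      ... | yes hit with find hit
      ...   | z , z∈ , e = trans
        (W-conflict uniq (fresh-∷ x∉xs fresh) (here refl) (there z∈) (λ { refl → x∉us z∈ }) e)
        (sym (trans (cong (N us *_) (zeroˡ ((1# + rowCount x us) * transversals xs (x ∷ us)))) (zeroʳ (N us))))
      second | no miss = begin
        W xs (x ∷ us)
          ≡⟨ W-transversals uniq (fresh-∷ x∉xs fresh) tr′ ⟩
        N (x ∷ us) * transversals xs (x ∷ us)
          ≡⟨ cong (_* transversals xs (x ∷ us))
               (trans (N-∷ (AllPairs.map (λ ne e → ne (cong col e)) tr′)) (*-comm _ (N us))) ⟩
        (N us * (1# + rowCount x us)) * transversals xs (x ∷ us)
          ≡⟨ *-assoc (N us) (1# + rowCount x us) (transversals xs (x ∷ us)) ⟩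
        N us * ((1# + rowCount x us) * transversals xs (x ∷ us))
          ≡⟨ cong (N us *_) (sym (*-identityˡ ((1# + rowCount x us) * transversals xs (x ∷ us)))) ⟩
        N us * (1# * ((1# + rowCount x us) * transversals xs (x ∷ us))) ∎
        where
        tr′ : Transversal (x ∷ us)
        tr′ = Allₚ.¬Any⇒All¬ us miss ∷ tr

    preserves? : (f : Fin n → ℕ) (p : Permutation′ n) → Dec (∀ x → f (p ⟨$⟩ʳ x) ≡ f x)
    preserves? f p = Finₚ.all? λ x → f (p ⟨$⟩ʳ x) ℕₚ.≟ f x

    #common : (p q : Permutation′ n) → ℕ
    #common p q = Σℕ.∑ (allFin n) λ z → Σℕ.⟦ common? p q z ⟧

    ∑-transversals : ∀ {xs} → Unique xs → (∀ x → x ∈ xs) →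
      ∑ (permutations n) (λ p → ∑ (permutations n) λ q →
        (⟦ preserves? row p ⟧ * ⟦ preserves? col q ⟧) * (sg q * pow (1# + y) (#common p q))) ≡
      transversals xs []
    ∑-transversals {xs} uniq covers = begin
      _
        ≡⟨ ∑-cong (permutations n) (λ p → ∑-cong (permutations n) λ q →
             cong₂ _*_ (cong₂ _*_ (free row p) (free col q)) (cong (sg q *_) (sym (weight-pow p q)))) ⟩
      W xs []
        ≡⟨ W-transversals uniq (All.universal (λ _ ()) xs) [] ⟩
      N [] * transversals xs []
        ≡⟨ trans (cong (_* transversals xs []) N-[]) (*-identityˡ _) ⟩
      transversals xs [] ∎
      where
      free : (f : Fin n → ℕ) (p : Permutation′ n) → ⟦ preserves? f p ⟧ ≡ ⟦ stabilises? f (xs ++ []) p ⟧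
      free f p = ⟦⟧-cong (preserves? f p) (stabilises? f (xs ++ []) p)
        (λ s → s , λ x → inj₁ (∈-++⁺ˡ (covers x))) proj₁

      pow-⟦⟧ : ∀ {P : Set} (d : Dec P) → 1# + y * ⟦ d ⟧ ≡ pow (1# + y) Σℕ.⟦ d ⟧
      pow-⟦⟧ (yes _) = trans (cong (1# +_) (*-identityʳ y)) (sym (*-identityʳ (1# + y)))
      pow-⟦⟧ (no _)  = trans (cong (1# +_) (zeroʳ y)) (+-identityʳ 1#)

      weight-∑ : (xs : List (Fin n)) (p q : Permutation′ n) → weight xs p q ≡ pow (1# + y) (Σℕ.∑ xs λ x → Σℕ.⟦ common? p q x ⟧)
      weight-∑ []       p q = refl
      weight-∑ (x ∷ xs) p q = trans (cong₂ _*_ (pow-⟦⟧ (common? p q x)) (weight-∑ xs p q))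
                                    (sym (pow-+ (1# + y) Σℕ.⟦ common? p q x ⟧ _))

      weight-pow : (p q : Permutation′ n) → weight xs p q ≡ pow (1# + y) (#common p q)
      weight-pow p q = trans (weight-∑ xs p q) (cong (pow (1# + y)) (trans
        (sym (MembershipSums.∑-∈ ℕ-semiring uniq _))
        (Σℕ.∑-cong (allFin n) λ z → trans (cong (ℕ._* Σℕ.⟦ common? p q z ⟧) (Σℕ.⟦⟧-yes (z ∈? xs) (covers z)))
                                          (ℕₚ.+-identityʳ _))))

-- Summing over transversals row by row

module RowExpansion where
  open Summation
  open Permutations
  open TransversalExpansion

  head₀ : List ℕ → ℕ
  head₀ []      = 0
  head₀ (ℓ ∷ _) = ℓ

  head₀≤ : ∀ {ℓ μ} → Linked _≥_ (ℓ ∷ μ) → head₀ μ ℕ.≤ ℓ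
  head₀≤ [-]     = ℕ.z≤n
  head₀≤ (p ∷ _) = p

  module RowSums (S : ≡-CommutativeSemiring) (y : ≡-CommutativeSemiring.R S) where
    open ≡-CommutativeSemiring S
    open Sums S
    open ≡-Reasoning

    -- The sum over the ways to choose cells from f free cells of a row that
    -- already contains u chosen cells, when m cells are chosen in total and
    -- Φ gives the contribution of the remaining rows.
    rowSum : (ℕ → R) → ℕ → ℕ → ℕ → R
    rowSum Φ zero    u m = Φ m
    rowSum Φ (suc f) u m = y * rowSum Φ f u m + nat (suc u) * rowSum Φ f (suc u) (suc m)

    -- The list starts at the top but the sum starts at the bottom, so the top row is absorbed into
    -- the continuation. If the rows below have chosen m cells, these block m cells of the row of
    -- length `ℓ`, because lower rows are no longer than it; each blocked cell gives a factor `y`.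
    rowsSum : List ℕ → (ℕ → R) → R
    rowsSum []      Φ = Φ 0
    rowsSum (ℓ ∷ μ) Φ = rowsSum μ λ m → pow y m * rowSum Φ (ℓ ∸ m) 0 m

    -- rowSum Φ f u m is the expectation of tᵘ(y + t)ᶠ / u! for an
    -- exponential variable t (a choice of v cells standing for Φ (m + v)),
    -- and these are the two cases of integration by parts.
    rowSum-parts-suc : ∀ Φ f u m →
      rowSum Φ (suc f) (suc u) m ≡ rowSum Φ (suc f) u m + nat (suc f) * rowSum Φ f (suc u) (suc m)
    rowSum-parts-suc Φ zero u m = begin
      y * Φ m + (1# + nat (suc u)) * Φ (suc m)
        ≡⟨ solve 4 (λ o v a b → a :+ (o :+ v) :* b := (a :+ v :* b) :+ (o :* b)) refl 1# (nat (suc u)) (y * Φ m) (Φ (suc m)) ⟩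
      (y * Φ m + nat (suc u) * Φ (suc m)) + 1# * Φ (suc m)
        ≡⟨ cong (λ w → (y * Φ m + nat (suc u) * Φ (suc m)) + w * Φ (suc m)) (sym (+-identityʳ 1#)) ⟩
      (y * Φ m + nat (suc u) * Φ (suc m)) + (1# + 0#) * Φ (suc m) ∎
      where open Solver
    rowSum-parts-suc Φ (suc f) u m = begin
      y * a + nat (suc (suc u)) * b
        ≡⟨ cong₂ (λ v w → y * v + nat (suc (suc u)) * w) (rowSum-parts-suc Φ f u m) (rowSum-parts-suc Φ f (suc u) (suc m)) ⟩
      y * (c + F * d) + (1# + U) * (e + F * g)
        ≡⟨ solve 8 (λ y o U F c d e g → y :* (c :+ F :* d) :+ (o :+ U) :* (e :+ F :* g) :=
             (y :* c :+ U :* e) :+ (o :* e :+ F :* (y :* d :+ (o :+ U) :* g))) refl y 1# U F c d e g ⟩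
      (y * c + U * e) + (1# * e + F * e)
        ≡⟨ cong ((y * c + U * e) +_) (sym (distribʳ e 1# F)) ⟩
      (y * c + U * e) + nat (suc (suc f)) * e ∎
      where
      open Solver
      a = rowSum Φ (suc f) (suc u) m
      b = rowSum Φ (suc f) (suc (suc u)) (suc m)
      c = rowSum Φ (suc f) u m
      d = rowSum Φ f (suc u) (suc m)
      e = rowSum Φ (suc f) (suc u) (suc m)
      g = rowSum Φ f (suc (suc u)) (suc (suc m))
      F = nat (suc f)
      U = nat (suc u)

    rowSum-parts-zero : ∀ Φ f m →
      rowSum Φ (suc f) 0 m ≡ pow y (suc f) * Φ m + nat (suc f) * rowSum Φ f 0 (suc m)
    rowSum-parts-zero Φ zero m = cong (λ w → w * Φ m + (1# + 0#) * Φ (suc m)) (sym (*-identityʳ y))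
    rowSum-parts-zero Φ (suc f) m = begin
      y * rowSum Φ (suc f) 0 m + (1# + 0#) * rowSum Φ (suc f) 1 (suc m)
        ≡⟨ cong₂ (λ v w → y * v + w) (rowSum-parts-zero Φ f m)
             (trans (cong (_* rowSum Φ (suc f) 1 (suc m)) (+-identityʳ 1#)) (trans (*-identityˡ _) (rowSum-parts-suc Φ f 0 (suc m)))) ⟩
      y * (P * a + F * b) + ((y * b + (1# + 0#) * g) + F * g)
        ≡⟨ cong (λ w → y * (P * a + F * b) + ((y * b + w * g) + F * g)) (+-identityʳ 1#) ⟩
      y * (P * a + F * b) + ((y * b + 1# * g) + F * g)
        ≡⟨ cong (λ w → y * (P * a + F * b) + ((w + 1# * g) + F * g)) (cong (y *_) (sym (*-identityˡ b))) ⟩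
      y * (P * a + F * b) + ((y * (1# * b) + 1# * g) + F * g)
        ≡⟨ solve 7 (λ y o P F a b g → y :* (P :* a :+ F :* b) :+ ((y :* (o :* b) :+ o :* g) :+ F :* g) :=
             (y :* P) :* a :+ (o :+ F) :* (y :* b :+ g)) refl y 1# P F a b g ⟩
      (y * P) * a + (1# + F) * (y * b + g)
        ≡⟨ cong (λ w → (y * P) * a + (1# + F) * (y * b + w)) (sym (trans (cong (_* g) (+-identityʳ 1#)) (*-identityˡ g))) ⟩
      (y * P) * a + (1# + F) * (y * b + (1# + 0#) * g) ∎
      where
      open Solver
      P = pow y (suc f)
      F = nat (suc f)
      a = Φ m
      b = rowSum Φ f 0 (suc m)
      g = rowSum Φ f 1 (suc (suc m))

  module RowByRow (S : ≡-CommutativeSemiring)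
    {n : ℕ} (row col : Fin n → ℕ) (y : ≡-CommutativeSemiring.R S) where

    open ≡-CommutativeSemiring S
    open Sums S
    open TransversalSums S row col y
    open RowSums S y

    Transversal : List (Fin n) → Set
    Transversal = AllPairs (λ x z → col x ≢ col z)

    Within : ℕ → ℕ → List (Fin n) → Set
    Within ℓ o us = Transversal us × All (λ z → col z ℕ.< ℓ × o ℕ.≤ row z) us

    record Row (o ℓ : ℕ) (cs : List (Fin n)) : Set where
      field
        located  : All (λ x → row x ≡ o × col x ℕ.< ℓ) cs
        distinct : Transversal cs
        complete : ∀ {c} → c ℕ.< ℓ → Σℕ.∑ cs (λ x → Σℕ.⟦ col x ℕₚ.≟ c ⟧) ≡ 1
        size     : length cs ≡ ℓ

    data Rows : ℕ → List ℕ → List (List (Fin n)) → Set where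
      []  : ∀ {o} → Rows o [] []
      _∷_ : ∀ {o ℓ μ cs css} → Row o ℓ cs → Rows (suc o) μ css → Rows o (ℓ ∷ μ) (cs ∷ css)

    bottomUp : List (List (Fin n)) → List (Fin n)
    bottomUp []         = []
    bottomUp (cs ∷ css) = bottomUp css ++ cs

    private
      meets? : (x : Fin n) (us : List (Fin n)) → Dec (Any (λ z → col x ≡ col z) us)
      meets? x us = Any.any? (λ z → col x ℕₚ.≟ col z) us

      #free #used : List (Fin n) → List (Fin n) → ℕ
      #free cs us = Σℕ.∑ cs λ x → Σℕ.⟦ free? x us ⟧
      #used cs us = Σℕ.∑ cs λ x → Σℕ.⟦ meets? x us ⟧

      #inRow : ℕ → List (Fin n) → ℕ
      #inRow o us = Σℕ.∑ us λ z → Σℕ.⟦ row z ℕₚ.≟ o ⟧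

      nat-∑ : ∀ o us → ∑ us (λ z → ⟦ row z ℕₚ.≟ o ⟧) ≡ nat (#inRow o us)
      nat-∑ o []       = refl
      nat-∑ o (z ∷ us) with row z ℕₚ.≟ o
      ... | yes _ = cong (1# +_) (nat-∑ o us)
      ... | no _  = trans (+-identityˡ _) (nat-∑ o us)

      #free-∷ : ∀ {x} cs us → All (λ c → col x ≢ col c) cs → #free cs (x ∷ us) ≡ #free cs us
      #free-∷ []       us []         = refl
      #free-∷ {x} (c ∷ cs) us (x≢c ∷ h) = cong₂ ℕ._+_
        (Σℕ.⟦⟧-cong (free? c (x ∷ us)) (free? c us) (λ f p → f (there p))
          (λ { f (here e) → x≢c (sym e) ; f (there p) → f p }))
        (#free-∷ cs us h)

      #used-∷ : ∀ {x} cs us → All (λ c → col x ≢ col c) cs → #used cs (x ∷ us) ≡ #used cs us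
      #used-∷ []       us []         = refl
      #used-∷ {x} (c ∷ cs) us (x≢c ∷ h) = cong₂ ℕ._+_
        (Σℕ.⟦⟧-cong (meets? c (x ∷ us)) (meets? c us)
          (λ { (here e) → contradiction (sym e) x≢c ; (there p) → p }) there)
        (#used-∷ cs us h)

      #free+#used : ∀ cs us → #free cs us ℕ.+ #used cs us ≡ length cs
      #free+#used []       us = refl
      #free+#used (c ∷ cs) us with meets? c us
      ... | yes _ = trans (ℕₚ.+-suc (#free cs us) (#used cs us)) (cong suc (#free+#used cs us))
      ... | no _  = cong suc (#free+#used cs us)

      ⟦meets⟧ : ∀ {us} → Transversal us → (x : Fin n) →
        Σℕ.⟦ meets? x us ⟧ ≡ Σℕ.∑ us (λ z → Σℕ.⟦ col x ℕₚ.≟ col z ⟧)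
      ⟦meets⟧ {[]} _ x = refl
      ⟦meets⟧ {z ∷ us} (h ∷ tr) x = by-cases (col x ℕₚ.≟ col z)
        where
        by-cases : Dec (col x ≡ col z) → Σℕ.⟦ meets? x (z ∷ us) ⟧ ≡
          Σℕ.⟦ col x ℕₚ.≟ col z ⟧ ℕ.+ Σℕ.∑ us (λ z → Σℕ.⟦ col x ℕₚ.≟ col z ⟧)
        by-cases (yes e) = trans (Σℕ.⟦⟧-yes (meets? x (z ∷ us)) (here e))
          (sym (cong₂ ℕ._+_ (Σℕ.⟦⟧-yes (col x ℕₚ.≟ col z) e)
            (trans (sym (⟦meets⟧ tr x)) (Σℕ.⟦⟧-no (meets? x us) (avoid h)))))
          where
          avoid : ∀ {ws} → All (λ w → col z ≢ col w) ws → ¬ Any (λ w → col x ≡ col w) ws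
          avoid (z≢w ∷ _) (here f)  = z≢w (trans (sym e) f)
          avoid (_ ∷ h)   (there p) = avoid h p
        by-cases (no x≢z) = trans
          (Σℕ.⟦⟧-cong (meets? x (z ∷ us)) (meets? x us)
            (λ { (here e) → contradiction e x≢z ; (there p) → p }) there)
          (trans (⟦meets⟧ tr x) (cong (ℕ._+ Σℕ.∑ us (λ z → Σℕ.⟦ col x ℕₚ.≟ col z ⟧))
                                      (sym (Σℕ.⟦⟧-no (col x ℕₚ.≟ col z) x≢z))))

      -- Count the pairs of a cell of the row and a chosen cell in the same column in two ways.
      #used-row : ∀ {o ℓ cs us o′} → Row o ℓ cs → Within ℓ o′ us → #used cs us ≡ length us
      #used-row {cs = cs} {us} r (tr , within) = begin
        #used cs us
          ≡⟨ Σℕ.∑-cong cs (⟦meets⟧ tr) ⟩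
        Σℕ.∑ cs (λ x → Σℕ.∑ us λ z → Σℕ.⟦ col x ℕₚ.≟ col z ⟧)
          ≡⟨ Σℕ.∑-swap cs us _ ⟩
        Σℕ.∑ us (λ z → Σℕ.∑ cs λ x → Σℕ.⟦ col x ℕₚ.≟ col z ⟧)
          ≡⟨ ones within ⟩
        length us ∎
        where
        open ≡-Reasoning
        ones : ∀ {vs} → All (λ z → col z ℕ.< _ × _ ℕ.≤ row z) vs →
          Σℕ.∑ vs (λ z → Σℕ.∑ cs λ x → Σℕ.⟦ col x ℕₚ.≟ col z ⟧) ≡ length vs
        ones []             = refl
        ones ((p , _) ∷ ps) = cong₂ ℕ._+_ (Row.complete r p) (ones ps)

    -- The cells of a row lie in distinct columns, so choosing one of them blocks none of the
    -- others. Hence the numbers of used and free cells are all that matters.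
    transversals-row : ∀ {o ℓ rest Φ} →
      (∀ {us} → Within ℓ o us → transversals rest us ≡ Φ (length us)) →
      ∀ {cs us} → All (λ x → row x ≡ o × col x ℕ.< ℓ) cs → Transversal cs → Within ℓ o us →
      transversals (cs ++ rest) us ≡
      pow y (#used cs us) * rowSum Φ (#free cs us) (#inRow o us) (length us)
    transversals-row hyp [] _ w = trans (hyp w) (sym (*-identityˡ _))
    transversals-row {o} {ℓ} {rest} {Φ} hyp {x ∷ cs} {us} ((refl , x<ℓ) ∷ loc) (x∉ ∷ tr) w@(trus , within)
      with meets? x us
    ... | yes _ = begin
      y * transversals (cs ++ rest) us + 0# * _
        ≡⟨ trans (cong (y * transversals (cs ++ rest) us +_) (zeroˡ _)) (+-identityʳ _) ⟩
      y * transversals (cs ++ rest) us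
        ≡⟨ cong (y *_) (transversals-row hyp loc tr w) ⟩
      y * (pow y (#used cs us) * rowSum Φ (#free cs us) (#inRow o us) (length us))
        ≡⟨ sym (*-assoc y _ _) ⟩
      (y * pow y (#used cs us)) * rowSum Φ (#free cs us) (#inRow o us) (length us) ∎
      where open ≡-Reasoning
    ... | no x-free = begin
      y * transversals (cs ++ rest) us + 1# * ((1# + rowCount x us) * transversals (cs ++ rest) (x ∷ us))
        ≡⟨ cong₂ (λ v w → y * v + w) (transversals-row hyp loc tr w)
             (trans (*-identityˡ _) (cong₂ (λ v w → (1# + v) * w) (nat-∑ (row x) us) (transversals-row hyp loc tr w′))) ⟩
      y * (P * a) + (1# + nat k) * (pow y (#used cs (x ∷ us)) * rowSum Φ (#free cs (x ∷ us)) (#inRow (row x) (x ∷ us)) (suc (length us)))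
        ≡⟨ cong (λ v → y * (P * a) + (1# + nat k) * v)
             (cong₂ _*_ (cong (pow y) (#used-∷ cs us x∉))
               (cong₂ (λ f u → rowSum Φ f u (suc (length us))) (#free-∷ cs us x∉)
                 (cong (ℕ._+ #inRow (row x) us) (Σℕ.⟦⟧-yes (row x ℕₚ.≟ row x) refl)))) ⟩
      y * (P * a) + (1# + nat k) * (P * b)
        ≡⟨ cong₂ _+_ (*-swapˡ y P a) (*-swapˡ (1# + nat k) P b) ⟩
      P * (y * a) + P * ((1# + nat k) * b)
        ≡⟨ sym (distribˡ P _ _) ⟩
      P * (y * a + (1# + nat k) * b) ∎
      where
      open ≡-Reasoning
      w′ : Within ℓ (row x) (x ∷ us)
      w′ = Allₚ.¬Any⇒All¬ us x-free ∷ trus , (x<ℓ , ℕₚ.≤-refl) ∷ within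
      k = #inRow (row x) us
      P = pow y (#used cs us)
      a = rowSum Φ (#free cs us) k (length us)
      b = rowSum Φ (#free cs us) (suc k) (suc (length us))

    -- `rest` holds the rows above, whose contribution depends only on the number of cells chosen
    -- below. `transversals-row` passes this property on when one more row joins `rest`.
    transversals-rows : ∀ {o μ css rest Φ} → Rows o μ css → Linked _≥_ μ →
      (∀ {us} → Within (head₀ μ) o us → transversals rest us ≡ Φ (length us)) →
      transversals (bottomUp css ++ rest) [] ≡ rowsSum μ Φ
    transversals-rows [] _ hyp = hyp ([] , [])
    transversals-rows {o} {ℓ ∷ μ} {cs ∷ css} {rest} {Φ} (r ∷ rs) linked hyp = trans
      (cong (λ xs → transversals xs []) (Listₚ.++-assoc (bottomUp css) cs rest))
      (transversals-rows rs (Linked.tail linked) step)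
      where
      open Row r
      step : ∀ {us} → Within (head₀ μ) (suc o) us →
        transversals (cs ++ rest) us ≡ pow y (length us) * rowSum Φ (ℓ ∸ length us) 0 (length us)
      step {us} (tr , within) = trans (transversals-row hyp located distinct w)
        (cong₂ _*_ (cong (pow y) used)
          (cong₂ (λ f u → rowSum Φ f u (length us)) free none))
        where
        w : Within ℓ o us
        w = tr , All.map (λ (c , p) → ℕₚ.<-≤-trans c (head₀≤ linked) , ℕₚ.≤-trans (ℕₚ.n≤1+n o) p) within
        used : #used cs us ≡ length us
        used = #used-row r w
        free : #free cs us ≡ ℓ ∸ length us
        free = trans (sym (ℕₚ.m+n∸n≡m (#free cs us) (#used cs us)))
                     (cong₂ _∸_ (trans (#free+#used cs us) size) used)
        none : #inRow o us ≡ 0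
        none = above within
          where
          above : ∀ {vs} → All (λ z → col z ℕ.< head₀ μ × suc o ℕ.≤ row z) vs → #inRow o vs ≡ 0
          above []             = refl
          above {v ∷ vs} ((_ , p) ∷ ps) = cong₂ ℕ._+_ (Σℕ.⟦⟧-no (row v ℕₚ.≟ o) (λ e → ℕₚ.<⇒≢ p (sym e))) (above ps)

-- Linear functionals on polynomials and (1 - d/ds)⁻¹

module FunctionalCalculus where
  open Summation
  open RowExpansion

  iterate : ∀ {a} {A : Set a} → (A → A) → ℕ → A → A
  iterate f zero    x = x
  iterate f (suc k) x = f (iterate f k x)

  iterate-comm : ∀ {a} {A : Set a} (f : A → A) k x → iterate f k (f x) ≡ f (iterate f k x)
  iterate-comm f zero    x = refl
  iterate-comm f (suc k) x = cong f (iterate-comm f k x)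

  iterate-+ : ∀ {a} {A : Set a} (f : A → A) j k x → iterate f (j ℕ.+ k) x ≡ iterate f j (iterate f k x)
  iterate-+ f zero    k x = refl
  iterate-+ f (suc j) k x = cong f (iterate-+ f j k x)

  module Functionals (S : ≡-CommutativeSemiring) where
    open ≡-CommutativeSemiring S
    open Sums S

    -- A sequence ψ stands for the linear functional on polynomials in s with
    -- sᵏ/k! ↦ ψ k.  Precomposition with (1 - d/ds)⁻¹ is E, and precomposition
    -- of a functional E ψ with multiplication by s - 1 is E (A ψ).
    E A : (ℕ → R) → ℕ → R
    E ψ zero    = ψ zero
    E ψ (suc k) = E ψ k + ψ (suc k)

    A ψ zero    = nat 1 * ψ 1
    A ψ (suc k) = nat (suc (suc k)) * ψ (suc (suc k)) + E ψ k

    -- The value of the functional `φ` on G_λ. Each step of the recursion for G_λ moves (1 - d/ds)⁻¹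
    -- (s - 1)^(λ₁ - λ₂) from the polynomial to the functional, in a form without subtraction that
    -- makes sense over ℕ.
    evaluate : List ℕ → (ℕ → R) → R
    evaluate []      φ = φ 0
    evaluate (ℓ ∷ μ) φ = evaluate μ (E (iterate A (ℓ ∸ head₀ μ) φ))

    E-cong : ∀ {φ ψ} → φ ≗ ψ → E φ ≗ E ψ
    E-cong e zero    = e zero
    E-cong e (suc k) = cong₂ _+_ (E-cong e k) (e (suc k))

    A-cong : ∀ {φ ψ} → φ ≗ ψ → A φ ≗ A ψ
    A-cong e zero    = cong (nat 1 *_) (e 1)
    A-cong e (suc k) = cong₂ (λ v w → nat (suc (suc k)) * v + w) (e (suc (suc k))) (E-cong e k)

    iterate-cong : ∀ {f : (ℕ → R) → ℕ → R} → (∀ {φ ψ} → φ ≗ ψ → f φ ≗ f ψ) →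
      ∀ k {φ ψ} → φ ≗ ψ → iterate f k φ ≗ iterate f k ψ
    iterate-cong c zero    e = e
    iterate-cong c (suc k) e = c (iterate-cong c k e)

  module Transfer (S : ≡-CommutativeSemiring) (-1# y : ≡-CommutativeSemiring.R S)
    (1+-1≡0 : ≡-CommutativeSemiring._+_ S (≡-CommutativeSemiring.1# S) -1# ≡ ≡-CommutativeSemiring.0# S) where
    open ≡-CommutativeSemiring S
    open Sums S
    open RowSums S y
    open Functionals S
    open ≡-Reasoning

    private
      cancel : ∀ x → x + -1# * x ≡ 0#
      cancel x = begin
        x + -1# * x        ≡⟨ cong (_+ -1# * x) (sym (*-identityˡ x)) ⟩
        1# * x + -1# * x   ≡⟨ sym (distribʳ x 1# -1#) ⟩
        (1# + -1#) * x     ≡⟨ cong (_* x) 1+-1≡0 ⟩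
        0# * x             ≡⟨ zeroˡ x ⟩
        0#                 ∎

    -- Precomposition with multiplication by s - 1.
    Y : (ℕ → R) → ℕ → R
    Y ψ k = nat (suc k) * ψ (suc k) + -1# * ψ k

    Y-cong : ∀ {φ ψ} → φ ≗ ψ → Y φ ≗ Y ψ
    Y-cong e k = cong₂ (λ v w → nat (suc k) * v + -1# * w) (e (suc k)) (e k)

    YE≗EA : ∀ ψ → Y (E ψ) ≗ E (A ψ)
    YE≗EA ψ k = trans (expand k) (sym (EA k))
      where
      expand : ∀ k → Y (E ψ) k ≡ nat k * E ψ k + nat (suc k) * ψ (suc k)
      expand k = begin
        (1# + nat k) * (E ψ k + ψ (suc k)) + -1# * E ψ k
          ≡⟨ solve 5 (λ o m k e p → (o :+ k) :* (e :+ p) :+ m :* e := (k :* e :+ (o :+ k) :* p) :+ (o :* e :+ m :* e))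
               refl 1# -1# (nat k) (E ψ k) (ψ (suc k)) ⟩
        (nat k * E ψ k + nat (suc k) * ψ (suc k)) + (1# * E ψ k + -1# * E ψ k)
          ≡⟨ cong ((nat k * E ψ k + nat (suc k) * ψ (suc k)) +_)
               (trans (cong (_+ -1# * E ψ k) (*-identityˡ (E ψ k))) (cancel (E ψ k))) ⟩
        (nat k * E ψ k + nat (suc k) * ψ (suc k)) + 0#
          ≡⟨ +-identityʳ _ ⟩
        nat k * E ψ k + nat (suc k) * ψ (suc k) ∎
        where open Solver
      EA : ∀ k → E (A ψ) k ≡ nat k * E ψ k + nat (suc k) * ψ (suc k)
      EA zero    = sym (trans (cong (_+ nat 1 * ψ 1) (zeroˡ (ψ 0))) (+-identityˡ _))
      EA (suc k) = begin
        E (A ψ) k + (c * b + e)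
          ≡⟨ cong (_+ (c * b + e)) (EA k) ⟩
        (nat k * e + nat (suc k) * p) + (c * b + e)
          ≡⟨ cong (λ w → (nat k * e + nat (suc k) * p) + (c * b + w)) (sym (*-identityˡ e)) ⟩
        (nat k * e + (1# + nat k) * p) + (c * b + 1# * e)
          ≡⟨ solve 6 (λ o k e p c b → (k :* e :+ (o :+ k) :* p) :+ (c :* b :+ o :* e) :=
               (o :+ k) :* (e :+ p) :+ c :* b) refl 1# (nat k) e p c b ⟩
        nat (suc k) * (e + p) + c * b ∎
        where
        open Solver
        e = E ψ k
        p = ψ (suc k)
        b = ψ (suc (suc k))
        c = nat (suc (suc k))

    iterate-YE≗EA : ∀ a ψ → iterate Y a (E ψ) ≗ E (iterate A a ψ)
    iterate-YE≗EA zero    ψ k = refl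
    iterate-YE≗EA (suc a) ψ k = trans (Y-cong (iterate-YE≗EA a ψ) k) (YE≗EA (iterate A a ψ) k)

    -- Precomposition with d/ds.
    private
      B : (ℕ → R) → ℕ → R
      B ψ zero    = 0#
      B ψ (suc k) = ψ k

      -- The product rule for the derivative of (s - 1) p.
      YB : ∀ ψ k → Y (B ψ) k ≡ ψ k + B (Y ψ) k
      YB ψ zero = begin
        (1# + 0#) * ψ 0 + -1# * 0#  ≡⟨ cong₂ _+_ (trans (cong (_* ψ 0) (+-identityʳ 1#)) (*-identityˡ (ψ 0))) (zeroʳ -1#) ⟩
        ψ 0 + 0#                    ∎
      YB ψ (suc k) = begin
        (1# + c) * ψ (suc k) + -1# * ψ k        ≡⟨ cong (_+ -1# * ψ k) (distribʳ (ψ (suc k)) 1# c) ⟩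
        (1# * ψ (suc k) + c * ψ (suc k)) + -1# * ψ k  ≡⟨ +-assoc _ _ _ ⟩
        1# * ψ (suc k) + (c * ψ (suc k) + -1# * ψ k)  ≡⟨ cong (_+ Y ψ k) (*-identityˡ (ψ (suc k))) ⟩
        ψ (suc k) + Y ψ k                       ∎
        where c = nat (suc k)

      E≗ψ+BE : ∀ ψ k → E ψ k ≡ ψ k + B (E ψ) k
      E≗ψ+BE ψ zero    = sym (+-identityʳ _)
      E≗ψ+BE ψ (suc k) = +-comm _ _

      lower : ℕ → (ℕ → R) → ℕ → R
      lower zero    ψ k = 0#
      lower (suc f) ψ k = nat (suc f) * iterate Y f (E ψ) k

      -- With D = d/ds, apply (1 - D)⁻¹ = 1 + (1 - D)⁻¹ D to (s - 1)ᶠ p and differentiate the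
      -- product: `lower` comes from the derivative of (s - 1)ᶠ, and the last summand from that of
      -- p.
      YfE : ∀ f ψ k → iterate Y f (E ψ) k ≡ (iterate Y f ψ k + lower f ψ k) + B (iterate Y f (E ψ)) k
      YfE zero    ψ k = trans (E≗ψ+BE ψ k) (cong (_+ B (E ψ) k) (sym (+-identityʳ _)))
      YfE (suc f) ψ k = begin
        Y X k
          ≡⟨ Y-cong (YfE f ψ) k ⟩
        Y (λ j → (iterate Y f ψ j + lower f ψ j) + B X j) k
          ≡⟨ solve 8 (λ c m a₁ a₀ l₁ l₀ b₁ b₀ → c :* ((a₁ :+ l₁) :+ b₁) :+ m :* ((a₀ :+ l₀) :+ b₀) :=
               ((c :* a₁ :+ m :* a₀) :+ (c :* l₁ :+ m :* l₀)) :+ (c :* b₁ :+ m :* b₀))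
               refl (nat (suc k)) -1# (iterate Y f ψ (suc k)) (iterate Y f ψ k) (lower f ψ (suc k)) (lower f ψ k) (B X (suc k)) (B X k) ⟩
        (Y (iterate Y f ψ) k + Y (lower f ψ) k) + Y (B X) k
          ≡⟨ cong ((Y (iterate Y f ψ) k + Y (lower f ψ) k) +_) (YB X k) ⟩
        (Y (iterate Y f ψ) k + Y (lower f ψ) k) + (X k + B (Y X) k)
          ≡⟨ solve 4 (λ a b c d → (a :+ b) :+ (c :+ d) := (a :+ (c :+ b)) :+ d) refl _ (Y (lower f ψ) k) (X k) (B (Y X) k) ⟩
        (Y (iterate Y f ψ) k + (X k + Y (lower f ψ) k)) + B (Y X) k
          ≡⟨ cong (λ w → (Y (iterate Y f ψ) k + w) + B (Y X) k)
               (trans (cong₂ _+_ (sym (*-identityˡ (X k))) (Ylower f)) (sym (distribʳ (X k) 1# (nat f)))) ⟩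
        (Y (iterate Y f ψ) k + lower (suc f) ψ k) + B (Y X) k ∎
        where
        open Solver
        X = iterate Y f (E ψ)
        Ylower : ∀ f → Y (lower f ψ) k ≡ nat f * iterate Y f (E ψ) k
        Ylower zero    = trans (cong₂ _+_ (zeroʳ _) (zeroʳ -1#)) (trans (+-identityˡ 0#) (sym (zeroˡ _)))
        Ylower (suc f) = solve 5 (λ c m g a b → c :* (g :* a) :+ m :* (g :* b) := g :* (c :* a :+ m :* b))
          refl (nat (suc k)) -1# (nat (suc f)) (iterate Y f (E ψ) (suc k)) (iterate Y f (E ψ) k)

    -- At p = 1 the term with the derivative of p disappears. What remains has the form of
    -- `rowSum-parts-zero`.
    iterate-YE-parts : ∀ f ψ →
      iterate Y (suc f) (E ψ) 0 ≡ iterate Y (suc f) ψ 0 + nat (suc f) * iterate Y f (E ψ) 0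
    iterate-YE-parts f ψ = trans (YfE (suc f) ψ 0) (+-identityʳ _)

    -- `Φ m` is the contribution of the rows down to the one of length `ℓ` when m cells are chosen
    -- below it, and `k` counts the cells of these rows outside the first. The recursions
    -- `rowSum-parts-zero` and `iterate-YE-parts` agree term by term, which carries the hypothesis
    -- on to the next row.
    rowsSum-evaluate : ∀ {ℓ μ} → Linked _≥_ (ℓ ∷ μ) → ∀ k Φ φ →
      (∀ m → m ℕ.≤ head₀ μ → Φ m ≡ pow y (k ℕ.+ m) * iterate Y (ℓ ∸ m) (E φ) 0) →
      rowsSum μ Φ ≡ pow y (k ℕ.+ ListAction.sum μ) * evaluate (ℓ ∷ μ) φ
    rowsSum-evaluate {ℓ} {[]} _ k Φ φ hyp = trans (hyp 0 ℕ.z≤n)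
      (cong (pow y (k ℕ.+ 0) *_) (iterate-YE≗EA ℓ φ 0))
    rowsSum-evaluate {ℓ} {ℓ′ ∷ μ} (ℓ′≤ℓ ∷ linked) k Φ φ hyp = trans
      (rowsSum-evaluate linked (k ℕ.+ ℓ′) _ φ′ next)
      (cong (λ e → pow y e * evaluate (ℓ′ ∷ μ) φ′) (ℕₚ.+-assoc k ℓ′ (ListAction.sum μ)))
      where
      φ′ = E (iterate A (ℓ ∸ ℓ′) φ)

      value : ∀ f m → f ℕ.+ m ≡ ℓ′ → Φ m ≡ pow y (k ℕ.+ m) * iterate Y f φ′ 0
      value f m e = trans (hyp m (subst (m ℕ.≤_) e (ℕₚ.m≤n+m m f))) (cong (pow y (k ℕ.+ m) *_) (begin
        iterate Y (ℓ ∸ m) (E φ) 0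
          ≡⟨ cong (λ j → iterate Y j (E φ) 0) split ⟩
        iterate Y (f ℕ.+ (ℓ ∸ ℓ′)) (E φ) 0
          ≡⟨ cong (λ g → g 0) (iterate-+ Y f (ℓ ∸ ℓ′) (E φ)) ⟩
        iterate Y f (iterate Y (ℓ ∸ ℓ′) (E φ)) 0
          ≡⟨ iterate-cong Y-cong f (iterate-YE≗EA (ℓ ∸ ℓ′) φ) 0 ⟩
        iterate Y f φ′ 0 ∎))
        where
        split : ℓ ∸ m ≡ f ℕ.+ (ℓ ∸ ℓ′)
        split = begin
          ℓ ∸ m                        ≡⟨ cong (_∸ m) (sym (ℕₚ.m+[n∸m]≡n ℓ′≤ℓ)) ⟩
          (ℓ′ ℕ.+ (ℓ ∸ ℓ′)) ∸ m        ≡⟨ cong (λ j → (j ℕ.+ (ℓ ∸ ℓ′)) ∸ m) (trans (sym e) (ℕₚ.+-comm f m)) ⟩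
          (m ℕ.+ f ℕ.+ (ℓ ∸ ℓ′)) ∸ m   ≡⟨ cong (_∸ m) (ℕₚ.+-assoc m f (ℓ ∸ ℓ′)) ⟩
          (m ℕ.+ (f ℕ.+ (ℓ ∸ ℓ′))) ∸ m ≡⟨ ℕₚ.m+n∸m≡n m (f ℕ.+ (ℓ ∸ ℓ′)) ⟩
          f ℕ.+ (ℓ ∸ ℓ′)               ∎

      processed : ∀ f m → f ℕ.+ m ≡ ℓ′ → rowSum Φ f 0 m ≡ pow y (k ℕ.+ ℓ′) * iterate Y f (E φ′) 0
      processed zero    m refl = value zero m refl
      processed (suc f) m e = begin
        rowSum Φ (suc f) 0 m
          ≡⟨ rowSum-parts-zero Φ f m ⟩
        pow y (suc f) * Φ m + nat (suc f) * rowSum Φ f 0 (suc m)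
          ≡⟨ cong₂ (λ v w → pow y (suc f) * v + nat (suc f) * w) (value (suc f) m e)
               (processed f (suc m) (trans (ℕₚ.+-suc f m) e)) ⟩
        pow y (suc f) * (pow y (k ℕ.+ m) * a) + nat (suc f) * (pow y (k ℕ.+ ℓ′) * b)
          ≡⟨ cong₂ _+_ (trans (sym (*-assoc _ _ a)) (cong (_* a)
               (trans (sym (pow-+ y (suc f) (k ℕ.+ m))) (cong (pow y) exponent))))
               (*-swapˡ (nat (suc f)) _ b) ⟩
        pow y (k ℕ.+ ℓ′) * a + pow y (k ℕ.+ ℓ′) * (nat (suc f) * b)
          ≡⟨ sym (distribˡ (pow y (k ℕ.+ ℓ′)) a (nat (suc f) * b)) ⟩
        pow y (k ℕ.+ ℓ′) * (a + nat (suc f) * b)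
          ≡⟨ cong (pow y (k ℕ.+ ℓ′) *_) (sym (iterate-YE-parts f φ′)) ⟩
        pow y (k ℕ.+ ℓ′) * iterate Y (suc f) (E φ′) 0 ∎
        where
        a = iterate Y (suc f) φ′ 0
        b = iterate Y f (E φ′) 0
        exponent : suc f ℕ.+ (k ℕ.+ m) ≡ k ℕ.+ ℓ′
        exponent = begin
          suc f ℕ.+ (k ℕ.+ m)  ≡⟨ ℕₚ.+-comm (suc f) (k ℕ.+ m) ⟩
          k ℕ.+ m ℕ.+ suc f    ≡⟨ ℕₚ.+-assoc k m (suc f) ⟩
          k ℕ.+ (m ℕ.+ suc f)  ≡⟨ cong (k ℕ.+_) (trans (ℕₚ.+-comm m (suc f)) e) ⟩
          k ℕ.+ ℓ′             ∎

      next : ∀ m → m ℕ.≤ head₀ μ →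
        pow y m * rowSum Φ (ℓ′ ∸ m) 0 m ≡ pow y (k ℕ.+ ℓ′ ℕ.+ m) * iterate Y (ℓ′ ∸ m) (E φ′) 0
      next m m≤ = begin
        pow y m * rowSum Φ (ℓ′ ∸ m) 0 m
          ≡⟨ cong (pow y m *_) (processed (ℓ′ ∸ m) m (ℕₚ.m∸n+n≡m (ℕₚ.≤-trans m≤ (head₀≤ linked)))) ⟩
        pow y m * (pow y (k ℕ.+ ℓ′) * a)
          ≡⟨ sym (*-assoc (pow y m) (pow y (k ℕ.+ ℓ′)) a) ⟩
        (pow y m * pow y (k ℕ.+ ℓ′)) * a
          ≡⟨ cong (_* a) (trans (sym (pow-+ y m (k ℕ.+ ℓ′))) (cong (pow y) (ℕₚ.+-comm m (k ℕ.+ ℓ′)))) ⟩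
        pow y (k ℕ.+ ℓ′ ℕ.+ m) * a ∎
        where a = iterate Y (ℓ′ ∸ m) (E φ′) 0

    -- The hypotheses say that ψ is evaluation at s = 1 + y.
    rowsSum-1 : ∀ {ℓ μ} → Linked _≥_ (ℓ ∷ μ) → ∀ ψ → ψ 0 ≡ 1# → (∀ k → Y ψ k ≡ y * ψ k) →
      rowsSum (ℓ ∷ μ) (λ _ → 1#) ≡ pow y (ListAction.sum μ) * evaluate (ℓ ∷ μ) ψ
    rowsSum-1 {ℓ} linked ψ ψ0≡1 Yψ≡yψ = rowsSum-evaluate linked 0 _ ψ
      (λ m _ → cong (pow y m *_) (top (ℓ ∸ m) m))
      where
      power : ∀ f k → iterate Y f ψ k ≡ pow y f * ψ k
      power zero    k = sym (*-identityˡ (ψ k))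
      power (suc f) k = begin
        Y (iterate Y f ψ) k      ≡⟨ Y-cong (power f) k ⟩
        Y (λ j → pow y f * ψ j) k
          ≡⟨ solve 5 (λ c m p a b → c :* (p :* a) :+ m :* (p :* b) := p :* (c :* a :+ m :* b))
               refl (nat (suc k)) -1# (pow y f) (ψ (suc k)) (ψ k) ⟩
        pow y f * Y ψ k          ≡⟨ cong (pow y f *_) (Yψ≡yψ k) ⟩
        pow y f * (y * ψ k)      ≡⟨ *-swapˡ (pow y f) y (ψ k) ⟩
        y * (pow y f * ψ k)      ≡⟨ sym (*-assoc y (pow y f) (ψ k)) ⟩
        (y * pow y f) * ψ k      ∎
        where open Solver

      top : ∀ f m → rowSum (λ _ → 1#) f 0 m ≡ iterate Y f (E ψ) 0
      top zero    m = sym ψ0≡1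
      top (suc f) m = trans (rowSum-parts-zero (λ _ → 1#) f m)
        (trans (cong₂ _+_ (sym (trans (power (suc f) 0) (cong (pow y (suc f) *_) ψ0≡1)))
                          (cong (nat (suc f) *_) (top f (suc m))))
               (sym (iterate-YE-parts f ψ)))

-- Comparing G_λ(0) with G_λ′(0) over the natural numbers

module Inequalities where
  open Permutations
  open RowExpansion
  open FunctionalCalculus
  open import Data.Nat.Base hiding (parity)
  open import Data.Nat.Properties
  open Functionals ℕ-semiring
  open Σℕ using (nat)

  -- As a functional, `δ j` is the j-th derivative at 0.
  δ : ℕ → ℕ → ℕ
  δ zero    zero    = 1
  δ zero    (suc k) = 0
  δ (suc j) zero    = 0
  δ (suc j) (suc k) = δ j k

  δ-diagonal : ∀ j → δ j j ≡ 1
  δ-diagonal zero    = refl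
  δ-diagonal (suc j) = δ-diagonal j

  δ≤1 : ∀ j k → δ j k ≤ 1
  δ≤1 zero    zero    = ≤-refl
  δ≤1 zero    (suc k) = z≤n
  δ≤1 (suc j) zero    = z≤n
  δ≤1 (suc j) (suc k) = δ≤1 j k

  infix 4 _≤̇_
  infixl 6 _∔_

  _≤̇_ : (φ ψ : ℕ → ℕ) → Set
  φ ≤̇ ψ = ∀ k → φ k ≤ ψ k

  _∔_ : (φ ψ : ℕ → ℕ) → ℕ → ℕ
  (φ ∔ ψ) k = φ k + ψ k

  E-mono : ∀ {φ ψ} → φ ≤̇ ψ → E φ ≤̇ E ψ
  E-mono h zero    = h zero
  E-mono h (suc k) = +-mono-≤ (E-mono h k) (h (suc k))

  A-mono : ∀ {φ ψ} → φ ≤̇ ψ → A φ ≤̇ A ψ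
  A-mono h zero    = *-monoʳ-≤ (nat 1) (h 1)
  A-mono h (suc k) = +-mono-≤ (*-monoʳ-≤ (nat (suc (suc k))) (h (suc (suc k)))) (E-mono h k)

  iterate-A-mono : ∀ a {φ ψ} → φ ≤̇ ψ → iterate A a φ ≤̇ iterate A a ψ
  iterate-A-mono zero    h = h
  iterate-A-mono (suc a) h = A-mono (iterate-A-mono a h)

  evaluate-mono : ∀ μ {φ ψ} → φ ≤̇ ψ → evaluate μ φ ≤ evaluate μ ψ
  evaluate-mono []      h = h 0
  evaluate-mono (ℓ ∷ μ) h = evaluate-mono μ (E-mono (iterate-A-mono (ℓ ∸ head₀ μ) h))

  ≤̇E : ∀ φ → φ ≤̇ E φ
  ≤̇E φ zero    = ≤-refl
  ≤̇E φ (suc k) = m≤n+m (φ (suc k)) (E φ k)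

  evaluate-cong : ∀ μ {φ ψ} → φ ≗ ψ → evaluate μ φ ≡ evaluate μ ψ
  evaluate-cong []      h = h 0
  evaluate-cong (ℓ ∷ μ) h = evaluate-cong μ (E-cong (iterate-cong A-cong (ℓ ∸ head₀ μ) h))

  E-∔ : ∀ φ ψ → E (φ ∔ ψ) ≗ E φ ∔ E ψ
  E-∔ φ ψ zero    = refl
  E-∔ φ ψ (suc k) = trans (cong (_+ (φ (suc k) + ψ (suc k))) (E-∔ φ ψ k))
                          (Σℕ.+-exchange (E φ k) (E ψ k) (φ (suc k)) (ψ (suc k)))

  A-∔ : ∀ φ ψ → A (φ ∔ ψ) ≗ A φ ∔ A ψ
  A-∔ φ ψ zero    = *-distribˡ-+ (nat 1) (φ 1) (ψ 1)
  A-∔ φ ψ (suc k) = trans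
    (cong₂ _+_ (*-distribˡ-+ (nat (suc (suc k))) (φ (suc (suc k))) (ψ (suc (suc k)))) (E-∔ φ ψ k))
    (Σℕ.+-exchange (nat (suc (suc k)) * φ (suc (suc k))) (nat (suc (suc k)) * ψ (suc (suc k))) (E φ k) (E ψ k))

  iterate-A-∔ : ∀ a φ ψ → iterate A a (φ ∔ ψ) ≗ iterate A a φ ∔ iterate A a ψ
  iterate-A-∔ zero    φ ψ k = refl
  iterate-A-∔ (suc a) φ ψ k = trans (A-cong (iterate-A-∔ a φ ψ) k) (A-∔ (iterate A a φ) (iterate A a ψ) k)

  evaluate-∔ : ∀ μ φ ψ → evaluate μ (φ ∔ ψ) ≡ evaluate μ φ + evaluate μ ψ
  evaluate-∔ []      φ ψ = refl
  evaluate-∔ (ℓ ∷ μ) φ ψ = trans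
    (evaluate-cong μ λ k → trans (E-cong (iterate-A-∔ a φ ψ) k) (E-∔ (iterate A a φ) (iterate A a ψ) k))
    (evaluate-∔ μ (E (iterate A a φ)) (E (iterate A a ψ)))
    where a = ℓ ∸ head₀ μ

  -- G_μ(0) and G_μ′(0).
  P₀ P₁ : List ℕ → ℕ
  P₀ μ = evaluate μ (δ 0)
  P₁ μ = evaluate μ (δ 1)

  data Even : ℕ → Set
  data Odd  : ℕ → Set
  data Even where
    zero : Even 0
    suc  : ∀ {a} → Odd a → Even (suc a)
  data Odd where
    suc  : ∀ {a} → Even a → Odd (suc a)

  even⊎odd : ∀ a → Even a ⊎ Odd a
  even⊎odd zero = inj₁ zero
  even⊎odd (suc a) with even⊎odd a
  ... | inj₁ e = inj₂ (suc e)
  ... | inj₂ o = inj₁ (suc o)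

  private
    Aδ₀ Aδ₁ : ℕ → ℕ → ℕ
    Aδ₀ a = iterate A a (δ 0)
    Aδ₁ a = iterate A a (δ 1)

  Eδ₀ : ∀ k → E (δ 0) k ≡ 1
  Eδ₀ zero    = refl
  Eδ₀ (suc k) = trans (+-identityʳ _) (Eδ₀ k)

  -- p(0) - p′(0) is the value of p - p′ at 0, and `E` precomposes with the inverse of 1 - d/ds.
  Eδ₀≗Eδ₁∔δ₀ : E (δ 0) ≗ E (δ 1) ∔ δ 0
  Eδ₀≗Eδ₁∔δ₀ zero          = refl
  Eδ₀≗Eδ₁∔δ₀ (suc zero)    = refl
  Eδ₀≗Eδ₁∔δ₀ (suc (suc k)) = trans (+-identityʳ _) (trans (Eδ₀≗Eδ₁∔δ₀ (suc k))
    (cong (_+ 0) (sym (+-identityʳ (E (δ 1) (suc k))))))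

  -- A (δ 0) - A (δ 1) = -(δ 0 - δ 1).
  A-δ : A (δ 0) ∔ δ 0 ≗ A (δ 1) ∔ δ 1
  A-δ zero          = refl
  A-δ (suc zero)    = cong (λ z → z + 1 + 0) (*-zeroʳ (nat 2))
  A-δ (suc (suc k)) = cong₂ (λ v w → v + w + 0) {nat (3 + k) * 0} refl (Eδ k)
    where
    Eδ : ∀ k → E (δ 0) (suc k) ≡ E (δ 1) (suc k)
    Eδ k = trans (Eδ₀≗Eδ₁∔δ₀ (suc k)) (+-identityʳ _)

  private
    +-rotate : ∀ y e d f → (y + e) + (d + f) ≡ (y + f) + (e + d)
    +-rotate = solve-∀

  -- By `A-δ` the operator `A` negates the difference of `δ 0` and `δ 1`, so the parity of a decides
  -- its sign. Cancelling a common summand takes the place of subtraction.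
  even-difference : ∀ {a} → Even a → Aδ₀ a ∔ δ 1 ≗ Aδ₁ a ∔ δ 0
  odd-difference  : ∀ {a} → Odd a  → Aδ₀ a ∔ δ 0 ≗ Aδ₁ a ∔ δ 1

  even-difference zero k = +-comm (δ 0 k) (δ 1 k)
  even-difference {suc a} (suc o) k = +-cancelʳ-≡ (A (δ 0) k + δ 0 k) _ _ (begin
    (x + δ 1 k) + (A (δ 0) k + δ 0 k)  ≡⟨ Σℕ.+-exchange x (δ 1 k) (A (δ 0) k) (δ 0 k) ⟩
    (x + A (δ 0) k) + (δ 1 k + δ 0 k)  ≡⟨ cong (_+ (δ 1 k + δ 0 k)) applied ⟩
    (y + A (δ 1) k) + (δ 1 k + δ 0 k)  ≡⟨ +-rotate y (A (δ 1) k) (δ 1 k) (δ 0 k) ⟩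
    (y + δ 0 k) + (A (δ 1) k + δ 1 k)  ≡⟨ cong ((y + δ 0 k) +_) (sym (A-δ k)) ⟩
    (y + δ 0 k) + (A (δ 0) k + δ 0 k)  ∎)
    where
    open ≡-Reasoning
    x = Aδ₀ (suc a) k
    y = Aδ₁ (suc a) k
    applied : x + A (δ 0) k ≡ y + A (δ 1) k
    applied = trans (sym (A-∔ (Aδ₀ a) (δ 0) k)) (trans (A-cong (odd-difference o) k) (A-∔ (Aδ₁ a) (δ 1) k))

  odd-difference {suc a} (suc e) k = +-cancelʳ-≡ (A (δ 1) k + δ 1 k) _ _ (begin
    (x + δ 0 k) + (A (δ 1) k + δ 1 k)  ≡⟨ Σℕ.+-exchange x (δ 0 k) (A (δ 1) k) (δ 1 k) ⟩
    (x + A (δ 1) k) + (δ 0 k + δ 1 k)  ≡⟨ cong (_+ (δ 0 k + δ 1 k)) applied ⟩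
    (y + A (δ 0) k) + (δ 0 k + δ 1 k)  ≡⟨ +-rotate y (A (δ 0) k) (δ 0 k) (δ 1 k) ⟩
    (y + δ 1 k) + (A (δ 0) k + δ 0 k)  ≡⟨ cong ((y + δ 1 k) +_) (A-δ k) ⟩
    (y + δ 1 k) + (A (δ 1) k + δ 1 k)  ∎)
    where
    open ≡-Reasoning
    x = Aδ₀ (suc a) k
    y = Aδ₁ (suc a) k
    applied : x + A (δ 1) k ≡ y + A (δ 0) k
    applied = trans (sym (A-∔ (Aδ₀ a) (δ 1) k)) (trans (A-cong (even-difference e) k) (A-∔ (Aδ₁ a) (δ 0) k))

  module _ (ℓ : ℕ) (μ : List ℕ) where
    private
      a = ℓ ∸ head₀ μ
      e₁ = evaluate μ (E (δ 1))

      Eδ₀-split : evaluate μ (E (δ 0)) ≡ e₁ + P₀ μ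
      Eδ₀-split = trans (evaluate-cong μ Eδ₀≗Eδ₁∔δ₀) (evaluate-∔ μ (E (δ 1)) (δ 0))

      transport : ∀ {φ φ′ ψ ψ′ : ℕ → ℕ} → φ ∔ φ′ ≗ ψ ∔ ψ′ →
        evaluate μ (E φ) + evaluate μ (E φ′) ≡ evaluate μ (E ψ) + evaluate μ (E ψ′)
      transport {φ} {φ′} {ψ} {ψ′} h = trans (sym (join φ φ′)) (trans (evaluate-cong μ (E-cong h)) (join ψ ψ′))
        where
        join : ∀ φ φ′ → evaluate μ (E (φ ∔ φ′)) ≡ evaluate μ (E φ) + evaluate μ (E φ′)
        join φ φ′ = trans (evaluate-cong μ (E-∔ φ φ′)) (evaluate-∔ μ (E φ) (E φ′))

    P₀-even : Even a → P₀ (ℓ ∷ μ) ≡ P₁ (ℓ ∷ μ) + P₀ μ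
    P₀-even e = +-cancelʳ-≡ e₁ _ _ (begin
      P₀ (ℓ ∷ μ) + e₁                     ≡⟨ transport (even-difference e) ⟩
      P₁ (ℓ ∷ μ) + evaluate μ (E (δ 0))   ≡⟨ cong (P₁ (ℓ ∷ μ) +_) Eδ₀-split ⟩
      P₁ (ℓ ∷ μ) + (e₁ + P₀ μ)             ≡⟨ arith (P₁ (ℓ ∷ μ)) e₁ (P₀ μ) ⟩
      P₁ (ℓ ∷ μ) + P₀ μ + e₁               ∎)
      where
      open ≡-Reasoning
      arith : ∀ x y z → x + (y + z) ≡ x + z + y
      arith = solve-∀

    P₀-odd : Odd a → P₀ (ℓ ∷ μ) + P₀ μ ≡ P₁ (ℓ ∷ μ)
    P₀-odd o = +-cancelʳ-≡ e₁ _ _ (begin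
      P₀ (ℓ ∷ μ) + P₀ μ + e₁               ≡⟨ arith (P₀ (ℓ ∷ μ)) (P₀ μ) e₁ ⟩
      P₀ (ℓ ∷ μ) + (e₁ + P₀ μ)             ≡⟨ cong (P₀ (ℓ ∷ μ) +_) (sym Eδ₀-split) ⟩
      P₀ (ℓ ∷ μ) + evaluate μ (E (δ 0))   ≡⟨ transport (odd-difference o) ⟩
      P₁ (ℓ ∷ μ) + e₁                     ∎)
      where
      open ≡-Reasoning
      arith : ∀ x y z → x + y + z ≡ x + (z + y)
      arith = solve-∀

  private
    ≤nat* : ∀ c x → x ≤ nat (suc c) * x
    ≤nat* c x = m≤m+n x (nat c * x)

    δ₀-least : ∀ {φ} → 1 ≤ φ 0 → δ 0 ≤̇ φ
    δ₀-least h zero    = h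
    δ₀-least h (suc k) = z≤n

    2δ₀-least : ∀ {φ} → 2 ≤ φ 0 → δ 0 ∔ δ 0 ≤̇ φ
    2δ₀-least h zero    = h
    2δ₀-least h (suc k) = z≤n

  -- `A (δ 0)` is 0 at 0, but `A (A (δ 0))` is 1 there.
  even-A-δ₀ : ∀ {a} → Even a → δ 0 ≤̇ Aδ₀ a
  even-A-δ₀ zero          k = ≤-refl
  even-A-δ₀ (suc (suc e)) k = ≤-trans (δ₀-least {A (A (δ 0))} ≤-refl k) (A-mono (A-mono (even-A-δ₀ e)) k)

  odd-A-δ₀ : ∀ {a} → Odd a → A (δ 0) ≤̇ Aδ₀ a
  odd-A-δ₀ (suc e) = A-mono (even-A-δ₀ e)

  -- The value of `A (A (A (δ 0)))` at 0 is 2.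
  odd-A-δ₀-2 : ∀ {a} → Odd a → δ 0 ∔ δ 0 ≤̇ Aδ₀ (suc (suc a))
  odd-A-δ₀-2 o k = ≤-trans (2δ₀-least {A (A (A (δ 0)))} ≤-refl k) (A-mono (A-mono (odd-A-δ₀ o)) k)

  δ₀≤Aδ₁ : δ 0 ≤̇ A (δ 1)
  δ₀≤Aδ₁ = δ₀-least {A (δ 1)} ≤-refl

  δ≤Aδ : ∀ j → δ j ≤̇ A (δ (suc j))
  δ≤Aδ j zero    = ≤nat* 0 (δ j 0)
  δ≤Aδ j (suc k) = ≤-trans (≤nat* (suc k) (δ j (suc k))) (m≤m+n _ _)

  δ≤iterate-Aδ : ∀ a b → δ b ≤̇ iterate A a (δ (a + b))
  δ≤iterate-Aδ zero    b k = ≤-refl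
  δ≤iterate-Aδ (suc a) b k = ≤-trans (δ≤Aδ b k) (A-mono
    (λ j → subst (λ i → δ (suc b) j ≤ iterate A a (δ i) j) (+-suc a b) (δ≤iterate-Aδ a (suc b) j)) k)

  δ-suc≤Aδ₀ : ∀ j → δ (suc j) ≤̇ A (δ 0)
  δ-suc≤Aδ₀ j zero    = z≤n
  δ-suc≤Aδ₀ j (suc k) = ≤-trans (δ≤1 j k) (≤-trans (≤-reflexive (sym (Eδ₀ k))) (m≤n+m (E (δ 0) k) _))

  -- `A (δ 0)` is the indicator of k ≥ 1, and `E` takes partial sums.
  EAδ₀ : ∀ k → E (A (δ 0)) k ≡ k
  EAδ₀ zero    = refl
  EAδ₀ (suc k) = trans (cong₂ _+_ (EAδ₀ k) (cong₂ _+_ (*-zeroʳ (nat (suc (suc k)))) (Eδ₀ k))) (+-comm k 1)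

  -- G_λ is monic of degree λ₁, so the true value is λ₁!. The bound 1 passes from row to row by
  -- monotonicity.
  leading : ∀ {ℓ μ} → Linked _≥_ (ℓ ∷ μ) → 1 ≤ evaluate (ℓ ∷ μ) (δ ℓ)
  leading-below : ∀ {ℓ μ φ} → Linked _≥_ (ℓ ∷ μ) → δ (head₀ μ) ≤̇ φ → 1 ≤ evaluate μ (E φ)

  leading {ℓ} {μ} linked = leading-below linked λ k →
    subst (λ i → δ (head₀ μ) k ≤ iterate A (ℓ ∸ head₀ μ) (δ i) k) (m∸n+n≡m (head₀≤ linked))
          (δ≤iterate-Aδ (ℓ ∸ head₀ μ) (head₀ μ) k)

  leading-below {μ = []}     _      h = h 0
  leading-below {μ = ℓ ∷ μ} {φ} linked h = ≤-trans (leading (Linked.tail linked))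
    (evaluate-mono (ℓ ∷ μ) (λ k → ≤-trans (h k) (≤̇E φ k)))

  -- The exception is G = s for a single cell. Otherwise the functional that reaches `μ` dominates
  -- `δ (head₀ μ)`, and `leading` applies.
  P₀-positive : ∀ {ℓ μ} → Linked _≥_ (ℓ ∷ μ) → 1 ≤ ℓ → ℓ ∷ μ ≢ 1 ∷ [] → All (1 ≤_) μ → 1 ≤ P₀ (ℓ ∷ μ)
  P₀-positive {ℓ} {μ} linked 1≤ℓ ≢1 pos = by-gap (ℓ ∸ head₀ μ) refl
    where
    level : ∀ μ → Linked _≥_ (ℓ ∷ μ) → ℓ ∸ head₀ μ ≡ 0 → 1 ≤ evaluate μ (E (δ 0))
    level []      _      e = contradiction (subst (1 ≤_) e 1≤ℓ) λ ()
    level (b ∷ ν) linked e = ≤-trans (leading (Linked.tail linked))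
      (evaluate-mono (b ∷ ν) (λ k → ≤-trans (δ≤1 b k) (≤-reflexive (sym (Eδ₀ k)))))

    single : ∀ μ → All (1 ≤_) μ → head₀ μ ≡ 0 → μ ≡ []
    single []      _       _ = refl
    single (b ∷ ν) (q ∷ _) e = contradiction (subst (1 ≤_) e q) λ ()

    strict : ∀ a j → ℓ ∸ head₀ μ ≡ suc a → a + head₀ μ ≡ j → 1 ≤ evaluate μ (E (iterate A (suc a) (δ 0)))
    strict a zero    e f = contradiction (cong₂ _∷_ ℓ≡1 μ≡[]) ≢1
      where
      μ≡[] = single μ pos (m+n≡0⇒n≡0 a f)
      ℓ≡1 : ℓ ≡ 1
      ℓ≡1 = trans (sym (cong (λ ν → ℓ ∸ head₀ ν) μ≡[])) (trans e (cong suc (m+n≡0⇒m≡0 a f)))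
    strict a (suc j) e f = leading-below linked λ k → ≤-trans
      (δ≤iterate-Aδ a (head₀ μ) k)
      (≤-trans (iterate-A-mono a (λ i → subst (λ z → δ z i ≤ A (δ 0) i) (sym f) (δ-suc≤Aδ₀ j i)) k)
               (≤-reflexive (cong (λ g → g k) (iterate-comm A a (δ 0)))))

    by-gap : ∀ a → ℓ ∸ head₀ μ ≡ a → 1 ≤ P₀ (ℓ ∷ μ)
    by-gap zero    e = subst (λ a → 1 ≤ evaluate μ (E (iterate A a (δ 0)))) (sym e) (level μ linked e)
    by-gap (suc a) e = subst (λ a → 1 ≤ evaluate μ (E (iterate A a (δ 0)))) (sym e) (strict a _ e refl)

  -- The slack that keeps the induction in P₀≤ going; it is only available when
  -- the first row has at least two cells.
  bonus : ℕ → ℕ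
  bonus (suc (suc _)) = 1
  bonus _             = 0

  bonus-mono : ∀ {a b} → a ≤ b → bonus a ≤ bonus b
  bonus-mono {zero}        _             = z≤n
  bonus-mono {suc zero}    _             = z≤n
  bonus-mono {suc (suc a)} (s≤s (s≤s _)) = ≤-refl

  -- By EAδ₀, this is P₀ of μ with a row of μ₁ + 1 cells put on top.
  U : List ℕ → ℕ
  U μ = evaluate μ (λ k → k)

  δ₁≤id : δ 1 ≤̇ (λ k → k)
  δ₁≤id zero    = z≤n
  δ₁≤id (suc k) = ≤-trans (δ≤1 0 k) (s≤s z≤n)

  -- For b ≥ 2 the functionals `δ 1` and twice `δ b` have disjoint supports and together stay below
  -- k ↦ k; each `δ b` is worth at least 1 by `leading`. This is the origin of the factor 2.
  P₁+bonus≤U : ∀ {b ν} → Linked _≥_ (b ∷ ν) → P₁ (b ∷ ν) + 2 * bonus b ≤ U (b ∷ ν)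
  P₁+bonus≤U {zero}        {ν} _ = ≤-trans (≤-reflexive (+-identityʳ _)) (evaluate-mono (0 ∷ ν) δ₁≤id)
  P₁+bonus≤U {suc zero}    {ν} _ = ≤-trans (≤-reflexive (+-identityʳ _)) (evaluate-mono (1 ∷ ν) δ₁≤id)
  P₁+bonus≤U {suc (suc b)} {ν} linked = begin
    P₁ μ + 2                                                   ≤⟨ +-monoʳ-≤ (P₁ μ) (+-mono-≤ (leading linked) (leading linked)) ⟩
    P₁ μ + (evaluate μ (δ (2 + b)) + evaluate μ (δ (2 + b)))   ≡⟨ cong (P₁ μ +_) (sym (evaluate-∔ μ (δ (2 + b)) (δ (2 + b)))) ⟩
    P₁ μ + evaluate μ (δ (2 + b) ∔ δ (2 + b))                  ≡⟨ sym (evaluate-∔ μ (δ 1) (δ (2 + b) ∔ δ (2 + b))) ⟩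
    evaluate μ (δ 1 ∔ (δ (2 + b) ∔ δ (2 + b)))                ≤⟨ evaluate-mono μ below ⟩
    U μ                                                       ∎
    where
    open ≤-Reasoning
    μ = suc (suc b) ∷ ν
    below : δ 1 ∔ (δ (2 + b) ∔ δ (2 + b)) ≤̇ (λ k → k)
    below zero          = z≤n
    below (suc zero)    = ≤-refl
    below (suc (suc k)) = ≤-trans (+-mono-≤ (δ≤1 b k) (δ≤1 b k)) (s≤s (s≤s z≤n))

  -- For gap 0 this is `δ 1` below `E (δ 1)`. For a larger gap one `A` turns `δ 1` into something
  -- above `δ 0`, and the odd number of remaining ones, followed by `E`, exceeds k ↦ k; so `U` of
  -- the lower rows lies in between.
  P₁-antitone : ∀ {ℓ b ν} → Linked _≥_ (ℓ ∷ b ∷ ν) → Even (ℓ ∸ b) →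
    P₁ (b ∷ ν) + 2 * bonus b ≤ P₁ (ℓ ∷ b ∷ ν) + 2 * bonus ℓ
  P₁-antitone {ℓ} {b} {ν} (b≤ℓ ∷ linked) even = by-gap (ℓ ∸ b) refl even
    where
    by-gap : ∀ a → ℓ ∸ b ≡ a → Even a → P₁ (b ∷ ν) + 2 * bonus b ≤ P₁ (ℓ ∷ b ∷ ν) + 2 * bonus ℓ
    by-gap zero e zero = +-mono-≤
      (subst (λ a → P₁ (b ∷ ν) ≤ evaluate (b ∷ ν) (E (Aδ₁ a))) (sym e) (evaluate-mono (b ∷ ν) (≤̇E (δ 1))))
      (*-monoʳ-≤ 2 (bonus-mono b≤ℓ))
    by-gap (suc a) e (suc o) = ≤-trans (P₁+bonus≤U linked) (≤-trans
      (subst (λ a → U (b ∷ ν) ≤ evaluate (b ∷ ν) (E (Aδ₁ a))) (sym e) (evaluate-mono (b ∷ ν) λ k →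
        ≤-trans (≤-reflexive (sym (EAδ₀ k))) (E-mono (λ j → ≤-trans (odd-A-δ₀ o j)
          (≤-trans (iterate-A-mono a δ₀≤Aδ₁ j) (≤-reflexive (cong (λ g → g j) (iterate-comm A a (δ 1)))))) k)))
      (m≤m+n _ _))

  sum-positive : ∀ {b ν} → 1 ≤ b → ∃ λ m → ListAction.sum (b ∷ ν) ≡ suc m
  sum-positive {suc b} {ν} _ = b + ListAction.sum ν , refl

  -- Prepares the case λ₁ = λ₂ + 1, with the present shape in the role of the lower rows. An odd gap
  -- gives `P₀` ≤ `P₁` outright. For an even gap `P₀` is `P₁` plus the `P₀` of the rows below: the
  -- first summand uses up one of the `m` copies, and the induction hypothesis pays for the second.
  P₀≤ : ∀ {ℓ ν} → Linked _≥_ (ℓ ∷ ν) → All (1 ≤_) (ℓ ∷ ν) → ∀ m → ListAction.sum (ℓ ∷ ν) ≡ suc m →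
    P₀ (ℓ ∷ ν) + bonus ℓ ≤ m * (P₁ (ℓ ∷ ν) + 2 * bonus ℓ)
  P₀≤ {ℓ} {ν} linked (1≤ℓ ∷ pos) m size = by-parity (even⊎odd (ℓ ∸ head₀ ν))
    where
    open ≤-Reasoning

    odd-case : ∀ ℓ ν m → Linked _≥_ (ℓ ∷ ν) → All (1 ≤_) ν → 1 ≤ ℓ → ListAction.sum (ℓ ∷ ν) ≡ suc m →
      P₀ (ℓ ∷ ν) ≤ P₁ (ℓ ∷ ν) → Odd (ℓ ∸ head₀ ν) → P₀ (ℓ ∷ ν) + bonus ℓ ≤ m * (P₁ (ℓ ∷ ν) + 2 * bonus ℓ)
    -- For a single cell G = s, so `P₀` computes to 0.
    odd-case (suc zero)     []              m _ _ _ _ _ _ = z≤n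
    odd-case (suc zero)     (suc zero ∷ ν)  m _ _ _ _ _ ()
    odd-case (suc zero)     (suc (suc _) ∷ ν) m (s≤s () ∷ _) _ _ _ _ _
    odd-case (suc zero)     (zero ∷ ν)      m _ (() ∷ _) _ _ _ _
    odd-case (suc (suc ℓ))  ν m _ _ _ size p≤s _ = begin
      P₀ μ + 1            ≤⟨ +-mono-≤ p≤s (s≤s z≤n) ⟩
      P₁ μ + 2            ≡⟨ sym (*-identityˡ (P₁ μ + 2)) ⟩
      1 * (P₁ μ + 2)      ≤⟨ *-monoˡ-≤ (P₁ μ + 2) (≤-trans (s≤s z≤n) (≤-reflexive (suc-injective size))) ⟩
      m * (P₁ μ + 2)      ∎
      where
      μ = suc (suc ℓ) ∷ ν

    even-case : ∀ ν → Linked _≥_ (ℓ ∷ ν) → All (1 ≤_) ν → ListAction.sum (ℓ ∷ ν) ≡ suc m →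
      P₀ (ℓ ∷ ν) ≡ P₁ (ℓ ∷ ν) + P₀ ν → Even (ℓ ∸ head₀ ν) →
      P₀ (ℓ ∷ ν) + bonus ℓ ≤ m * (P₁ (ℓ ∷ ν) + 2 * bonus ℓ)
    even-case [] _ _ size p≡ even = single ℓ 1≤ℓ even size p≡
      where
      single : ∀ ℓ → 1 ≤ ℓ → Even ℓ → ListAction.sum (ℓ ∷ []) ≡ suc m → P₀ (ℓ ∷ []) ≡ P₁ (ℓ ∷ []) + 1 →
        P₀ (ℓ ∷ []) + bonus ℓ ≤ m * (P₁ (ℓ ∷ []) + 2 * bonus ℓ)
      single (suc zero) _ (suc ())
      single (suc (suc ℓ)) _ _ size p≡ = begin
        P₀ μ + 1            ≡⟨ cong (_+ 1) p≡ ⟩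
        P₁ μ + 1 + 1        ≡⟨ +-assoc (P₁ μ) 1 1 ⟩
        P₁ μ + 2            ≡⟨ sym (*-identityˡ (P₁ μ + 2)) ⟩
        1 * (P₁ μ + 2)      ≤⟨ *-monoˡ-≤ (P₁ μ + 2) (≤-trans (s≤s z≤n) (≤-reflexive (suc-injective size))) ⟩
        m * (P₁ μ + 2)      ∎
        where
        μ = suc (suc ℓ) ∷ []
    even-case (b ∷ ν) linked (1≤b ∷ pos) size p≡ even with sum-positive {b} {ν} 1≤b
    ... | m′ , size′ = begin
      P₀ μ + bonus ℓ                                     ≡⟨ cong (_+ bonus ℓ) p≡ ⟩
      P₁ μ + P₀ (b ∷ ν) + bonus ℓ                         ≤⟨ bound (P₁ μ) (P₀ (b ∷ ν)) (bonus ℓ) (bonus b) ⟩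
      (P₁ μ + 2 * bonus ℓ) + (P₀ (b ∷ ν) + bonus b)       ≤⟨ +-monoʳ-≤ _ (P₀≤ (Linked.tail linked) (1≤b ∷ pos) m′ size′) ⟩
      (P₁ μ + 2 * bonus ℓ) + m′ * (P₁ (b ∷ ν) + 2 * bonus b) ≤⟨ +-monoʳ-≤ _ (*-monoʳ-≤ m′ (P₁-antitone linked even)) ⟩
      suc m′ * (P₁ μ + 2 * bonus ℓ)                      ≤⟨ *-monoˡ-≤ (P₁ μ + 2 * bonus ℓ) m′<m ⟩
      m * (P₁ μ + 2 * bonus ℓ)                           ∎
      where
      μ = ℓ ∷ b ∷ ν
      bound : ∀ s p e f → s + p + e ≤ (s + 2 * e) + (p + f)
      bound s p e f = ≤-trans (m≤m+n _ (e + f)) (≤-reflexive (arith s p e f))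
        where
        arith : ∀ s p e f → s + p + e + (e + f) ≡ (s + 2 * e) + (p + f)
        arith = solve-∀
      m′<m : suc m′ ≤ m
      m′<m = s≤s⁻¹ (≤-trans (+-monoˡ-≤ (suc m′) 1≤ℓ) (≤-reflexive (trans (cong (ℓ +_) (sym size′)) size)))

    by-parity : Even (ℓ ∸ head₀ ν) ⊎ Odd (ℓ ∸ head₀ ν) → P₀ (ℓ ∷ ν) + bonus ℓ ≤ m * (P₁ (ℓ ∷ ν) + 2 * bonus ℓ)
    by-parity (inj₁ e) = even-case ν linked pos size (P₀-even ℓ ν e) e
    by-parity (inj₂ o) = odd-case ℓ ν m linked pos 1≤ℓ size (≤-trans (m≤m+n (P₀ (ℓ ∷ ν)) (P₀ ν)) (≤-reflexive (P₀-odd ℓ ν o))) o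

  sum-ones : ∀ m → ListAction.sum (replicate m 1) ≡ m
  sum-ones zero    = refl
  sum-ones (suc m) = cong suc (sum-ones m)

  ones : ∀ {ν} → Linked _≥_ (1 ∷ ν) → All (1 ≤_) ν → ν ≡ replicate (ListAction.sum ν) 1
  ones [-]                  []        = refl
  ones (s≤s z≤n ∷ linked) (_ ∷ pos)   = cong (1 ∷_) (ones linked pos)

  -- G of this column is s + m: the bottom cell gives s, and each further row applies (1 - d/ds)⁻¹,
  -- which adds 1.
  evaluate-column : ∀ m φ → evaluate (replicate (suc m) 1) φ ≡ m * φ 0 + φ 1
  evaluate-column zero    φ = +-identityʳ (φ 1)
  evaluate-column (suc m) φ = trans (evaluate-column m (E φ)) (arith m (φ 0) (φ 1))
    where
    arith : ∀ m x y → m * x + (x + y) ≡ suc m * x + y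
    arith = solve-∀

  P₀-column : ∀ m → P₀ (replicate (suc m) 1) ≡ m
  P₀-column m = trans (evaluate-column m (δ 0)) (arith m)
    where
    arith : ∀ m → m * 1 + 0 ≡ m
    arith = solve-∀

  P₀-hook : ∀ m → P₀ (2 ∷ replicate (suc m) 1) ≡ 1
  P₀-hook m = trans (evaluate-column m (E (A (δ 0)))) (cong (_+ 1) (*-zeroʳ m))

  P₁-hook : ∀ m → P₁ (2 ∷ replicate (suc m) 1) ≡ suc m
  P₁-hook m = trans (sym (P₀-odd 2 (replicate (suc m) 1) (suc zero))) (cong₂ _+_ (P₀-hook m) (P₀-column m))

  Exceptional : ℕ → List ℕ → Set
  Exceptional ℓ μ = μ ≡ 1 ∷ [] ⊎ ℓ ∷ μ ≡ 2 ∷ replicate (ListAction.sum μ) 1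

  -- Over a single cell, whose `P₀` is 0, either parity gives `P₀` = `P₁`. For the hook `P₀` is 1
  -- and `P₁` is the number of cells below the first row.
  exceptional-balance : ∀ {ℓ b ν} → 1 ≤ b → Exceptional ℓ (b ∷ ν) →
    ListAction.sum (b ∷ ν) * P₀ (ℓ ∷ b ∷ ν) ≡ P₁ (ℓ ∷ b ∷ ν)
  exceptional-balance {ℓ} _ (inj₁ refl) = trans (+-identityʳ _) (by-parity (even⊎odd (ℓ ∸ 1)))
    where
    by-parity : Even (ℓ ∸ 1) ⊎ Odd (ℓ ∸ 1) → P₀ (ℓ ∷ 1 ∷ []) ≡ P₁ (ℓ ∷ 1 ∷ [])
    by-parity (inj₁ e) = trans (P₀-even ℓ (1 ∷ []) e) (+-identityʳ _)
    by-parity (inj₂ o) = trans (sym (+-identityʳ _)) (P₀-odd ℓ (1 ∷ []) o)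
  exceptional-balance {ℓ} {b} {ν} 1≤b (inj₂ e) with sum-positive {b} {ν} 1≤b
  ... | m , size = begin
    ListAction.sum (b ∷ ν) * P₀ (ℓ ∷ b ∷ ν)  ≡⟨ cong₂ (λ k λ′ → k * P₀ λ′) size e′ ⟩
    suc m * P₀ (2 ∷ replicate (suc m) 1)     ≡⟨ cong (suc m *_) (P₀-hook m) ⟩
    suc m * 1                               ≡⟨ *-identityʳ (suc m) ⟩
    suc m                                   ≡⟨ sym (P₁-hook m) ⟩
    P₁ (2 ∷ replicate (suc m) 1)             ≡⟨ cong P₁ (sym e′) ⟩
    P₁ (ℓ ∷ b ∷ ν)                           ∎
    where
    open ≡-Reasoning
    e′ : ℓ ∷ b ∷ ν ≡ 2 ∷ replicate (suc m) 1
    e′ = trans e (cong (λ k → 2 ∷ replicate k 1) size)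

  -- Write λ for the shape and μ for its lower rows. An even gap makes `P₀` of λ exceed `P₁` by the
  -- positive `P₀` of μ. An odd gap of at least 3 makes `P₀` of λ at least twice that of μ. For gap
  -- 1, `P₀` of λ is `U` of μ, and `P₀≤` for μ closes the comparison.
  ordinary-balance : ∀ {ℓ b ν} → Linked _≥_ (ℓ ∷ b ∷ ν) → All (1 ≤_) (ℓ ∷ b ∷ ν) →
    ¬ Exceptional ℓ (b ∷ ν) → P₁ (ℓ ∷ b ∷ ν) < ListAction.sum (b ∷ ν) * P₀ (ℓ ∷ b ∷ ν)
  ordinary-balance {ℓ} {b} {ν} linked@(b≤ℓ ∷ linked′) (1≤ℓ ∷ pos@(1≤b ∷ posν)) ordinary
    with sum-positive {b} {ν} 1≤b
  ... | m , size = subst (λ k → P₁ λ′ < k * P₀ λ′) (sym size) (by-gap (ℓ ∸ b) refl (even⊎odd (ℓ ∸ b)))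
    where
    open ≤-Reasoning
    μ = b ∷ ν
    λ′ = ℓ ∷ μ

    μ≢1 : μ ≢ 1 ∷ []
    μ≢1 e = ordinary (inj₁ e)

    1≤m : 1 ≤ m
    1≤m = positive ν posν b 1≤b size μ≢1
      where
      positive : ∀ ν → All (1 ≤_) ν → ∀ b → 1 ≤ b → b + ListAction.sum ν ≡ suc m → b ∷ ν ≢ 1 ∷ [] → 1 ≤ m
      positive []      _       (suc zero)    _ _ ne = contradiction refl ne
      positive (c ∷ ν) (q ∷ _) (suc zero)    _ e _  = ≤-trans q (≤-trans (m≤m+n c _) (≤-reflexive (suc-injective e)))
      positive ν       _       (suc (suc b)) _ e _  = ≤-trans (s≤s z≤n) (≤-reflexive (suc-injective e))

    1≤pμ : 1 ≤ P₀ μ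
    1≤pμ = P₀-positive linked′ 1≤b μ≢1 posν

    double : 2 * P₀ λ′ ≤ suc m * P₀ λ′
    double = *-monoˡ-≤ (P₀ λ′) (s≤s 1≤m)

    by-gap : ∀ a → ℓ ∸ b ≡ a → Even (ℓ ∸ b) ⊎ Odd (ℓ ∸ b) → P₁ λ′ < suc m * P₀ λ′
    by-gap a _ (inj₁ e) = begin-strict
      P₁ λ′            <⟨ m<m+n (P₁ λ′) 1≤pμ ⟩
      P₁ λ′ + P₀ μ      ≡⟨ sym (P₀-even ℓ μ e) ⟩
      P₀ λ′            ≤⟨ m≤m+n (P₀ λ′) (m * P₀ λ′) ⟩
      suc m * P₀ λ′    ∎
    by-gap zero eq (inj₂ o) = contradiction (subst Odd eq o) λ ()
    by-gap (suc zero) eq (inj₂ o) = one-step b ν linked′ pos size refl ordinary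
      where
      p≡U : P₀ λ′ ≡ U μ
      p≡U = trans (cong (λ a → evaluate μ (E (iterate A a (δ 0)))) eq) (evaluate-cong μ EAδ₀)

      one-step : ∀ b′ ν′ → Linked _≥_ (b′ ∷ ν′) → All (1 ≤_) (b′ ∷ ν′) → ListAction.sum (b′ ∷ ν′) ≡ suc m →
        b′ ∷ ν′ ≡ μ → ¬ Exceptional ℓ (b′ ∷ ν′) → P₁ λ′ < suc m * P₀ λ′
      -- A lower part starting with 1 is a column, and gap 1 then gives the excluded hook.
      one-step (suc zero) ν′ linked″ (_ ∷ pos″) size″ refl ordinary″ =
        contradiction (inj₂ (cong₂ _∷_ ℓ≡2 (cong (1 ∷_) (ones linked″ pos″)))) ordinary″
        where
        ℓ≡2 : ℓ ≡ 2
        ℓ≡2 = trans (sym (m∸n+n≡m b≤ℓ)) (cong (_+ 1) eq)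
      one-step (suc (suc c)) ν′ linked″ pos″ size″ refl _ = begin-strict
        P₁ λ′                                ≡⟨ sym (P₀-odd ℓ μ o) ⟩
        P₀ λ′ + P₀ μ                          <⟨ +-monoʳ-< (P₀ λ′) (m<m+n (P₀ μ) (s≤s z≤n)) ⟩
        P₀ λ′ + (P₀ μ + 1)                    ≤⟨ +-monoʳ-≤ (P₀ λ′) (P₀≤ linked″ pos″ m size″) ⟩
        P₀ λ′ + m * (P₁ μ + 2)                ≤⟨ +-monoʳ-≤ (P₀ λ′) (*-monoʳ-≤ m (≤-trans (P₁+bonus≤U linked″) (≤-reflexive (sym p≡U)))) ⟩
        suc m * P₀ λ′                        ∎
    by-gap (suc (suc a)) eq (inj₂ o) = begin-strict
      P₁ λ′                    ≡⟨ sym (P₀-odd ℓ μ o) ⟩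
      P₀ λ′ + P₀ μ              <⟨ +-monoʳ-< (P₀ λ′) (≤-trans (m<m+n (P₀ μ) 1≤pμ) 2pμ≤p) ⟩
      P₀ λ′ + P₀ λ′             ≡⟨ cong (P₀ λ′ +_) (sym (+-identityʳ (P₀ λ′))) ⟩
      2 * P₀ λ′                ≤⟨ double ⟩
      suc m * P₀ λ′            ∎
      where
      odd : Odd a
      odd = strip (subst Odd eq o)
        where
        strip : Odd (suc (suc a)) → Odd a
        strip (suc (suc o)) = o
      2pμ≤p : P₀ μ + P₀ μ ≤ P₀ λ′
      2pμ≤p = begin
        P₀ μ + P₀ μ                      ≡⟨ sym (evaluate-∔ μ (δ 0) (δ 0)) ⟩
        evaluate μ (δ 0 ∔ δ 0)         ≤⟨ evaluate-mono μ (λ k → ≤-trans (odd-A-δ₀-2 odd k) (≤̇E (Aδ₀ (suc (suc a))) k)) ⟩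
        evaluate μ (E (Aδ₀ (suc (suc a)))) ≡⟨ cong (λ a → evaluate μ (E (Aδ₀ a))) (sym eq) ⟩
        P₀ λ′                           ∎

  -- `A (δ 1)` dominates `δ 0`, which reduces the claim to `P₀` of a row with one cell less. Two
  -- cells are too few: G = s² + 1 has derivative 0 at 0.
  P₁-row : ∀ ℓ → 1 ≤ P₁ (3 + ℓ ∷ [])
  P₁-row ℓ = ≤-trans
    (P₀-positive {2 + ℓ} {[]} [-] (s≤s z≤n) (λ ()) [])
    (≤-trans (iterate-A-mono (2 + ℓ) δ₀≤Aδ₁ 0) (≤-reflexive (cong (λ g → g 0) (iterate-comm A (2 + ℓ) (δ 1)))))

-- The eigenvalue as a sum over row and column permutations

module GeneratingFunction where
  open Summation
  open Permutations
  open Tableaux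
  open Polytabloids
  open DualNumbers
  open TransversalExpansion
  open RowExpansion
  open import Defs hiding (∑; _≈_)

  -- Cells of a bare list, so that recursion on the list is possible; `Cell μ` unfolds to
  -- `CellOf (parts μ)`.
  CellOf : List ℕ → Set
  CellOf ps = Σ (Fin (length ps)) λ i → Fin (lookup ps i)

  CellOf↔Fin : ∀ ps → CellOf ps ↔ Fin (ListAction.sum ps)
  CellOf↔Fin []       = mk↔ₛ′ (λ ()) (λ ()) (λ ()) (λ ())
  CellOf↔Fin (k ∷ ps) = mk↔ₛ′ to (from ∘ splitAt k) to∘from from∘to
    where
    rest = CellOf↔Fin ps
    m = ListAction.sum ps

    to : CellOf (k ∷ ps) → Fin (k ℕ.+ m)
    to (zero  , j) = j ↑ˡ m
    to (suc i , j) = k ↑ʳ Inverse.to rest (i , j)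

    from : Fin k ⊎ Fin m → CellOf (k ∷ ps)
    from (inj₁ j) = zero , j
    from (inj₂ x) = suc (proj₁ (Inverse.from rest x)) , proj₂ (Inverse.from rest x)

    to-from : ∀ x → to (from x) ≡ Fin.join k m x
    to-from (inj₁ j) = refl
    to-from (inj₂ x) = cong (k ↑ʳ_) (Inverse.strictlyInverseˡ rest x)

    to∘from : ∀ x → to (from (splitAt k x)) ≡ x
    to∘from x = trans (to-from (splitAt k x)) (Finₚ.join-splitAt k m x)

    from∘to : ∀ c → from (splitAt k (to c)) ≡ c
    from∘to (zero  , j) = cong from (Finₚ.splitAt-↑ˡ k j m)
    from∘to (suc i , j) = trans (cong from (Finₚ.splitAt-↑ʳ k m (Inverse.to rest (i , j))))
      (cong (λ c → suc (proj₁ c) , proj₂ c) (Inverse.strictlyInverseʳ rest (i , j)))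

  someTableau : ∀ {n} (μ : Partition n) → Tableau μ
  someTableau μ = subst (λ k → Cell μ ↔ Fin k) (size μ) (CellOf↔Fin (parts μ))

  -- Write a point as q x: it is fixed by p q⁻¹ when p x = q x. For a row permutation p and a column
  -- permutation q this common value shares both row and column with x, which gives the hypothesis.
  #fixed-common : ∀ {n} (p q : Permutation′ n) →
    (∀ x → p ⟨$⟩ʳ x ≡ q ⟨$⟩ʳ x → q ⟨$⟩ʳ x ≡ x) →
    #fixed (flip q ∘ₚ p) ≡
    Σℕ.∑ (allFin n) (λ x → Σℕ.⟦ ((p ⟨$⟩ʳ x) Finₚ.≟ x) ×-dec ((q ⟨$⟩ʳ x) Finₚ.≟ x) ⟧)
  #fixed-common {n} p q meet = begin
    #fixed (flip q ∘ₚ p)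
      ≡⟨ #fixed-∑ (flip q ∘ₚ p) ⟩
    Σℕ.∑ (allFin n) (λ i → Σℕ.⟦ (p ⟨$⟩ʳ (q ⟨$⟩ˡ i)) Finₚ.≟ i ⟧)
      ≡⟨ sym (Σℕ.∑-allFin-permute q _) ⟩
    Σℕ.∑ (allFin n) (λ x → Σℕ.⟦ (p ⟨$⟩ʳ (q ⟨$⟩ˡ (q ⟨$⟩ʳ x))) Finₚ.≟ (q ⟨$⟩ʳ x) ⟧)
      ≡⟨ Σℕ.∑-cong (allFin n) (λ x → Σℕ.⟦⟧-cong (_ Finₚ.≟ _)
           (((p ⟨$⟩ʳ x) Finₚ.≟ x) ×-dec ((q ⟨$⟩ʳ x) Finₚ.≟ x))
           (λ e → let e′ = trans (sym (back x)) e in trans e′ (meet x e′) , meet x e′)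
           (λ (e , f) → trans (back x) (trans e (sym f)))) ⟩
    Σℕ.∑ (allFin n) (λ x → Σℕ.⟦ ((p ⟨$⟩ʳ x) Finₚ.≟ x) ×-dec ((q ⟨$⟩ʳ x) Finₚ.≟ x) ⟧) ∎
    where
    open ≡-Reasoning
    back : ∀ x → p ⟨$⟩ʳ (q ⟨$⟩ˡ (q ⟨$⟩ʳ x)) ≡ p ⟨$⟩ʳ x
    back x = cong (p ⟨$⟩ʳ_) (inverseˡ q)

  -- Working with x = ε in the generating function over the number of common
  -- fixed points; y = x - 1.
  y : Dual
  y = (ℚ.- 1ℚ) +ε 1ℚ

  module _ {n : ℕ} (μ : Partition n) (T : Tableau μ) where

    private
      row col : Fin n → ℕ
      row x = toℕ (rowOf μ T x)
      col = columnOf μ T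

      neg-fixed : ∀ x → x ≡ -1D * x → x ≡ 0#
      neg-fixed (a +ε b) e = cong₂ _+ε_ (≡-neg⇒≡0 a (cong re e))
        (≡-neg⇒≡0 b (trans (cong du e) (du-ι-* (ℚ.- 1ℚ) (a +ε b))))

      sgn-transposed : ∀ (q : Permutation′ n) {x z} → x ≢ z →
        ι (sgn (q ∘ₚ transpose x z)) ≡ -1D * ι (sgn q)
      sgn-transposed q {x} {z} x≢z = trans
        (cong ι (trans (sgn-∘ q (transpose x z))
          (trans (cong (sgn q ℚ.*_) (sgn-transpose x≢z)) (ℚₚ.*-comm (sgn q) (ℚ.- 1ℚ)))))
        (ι-* (ℚ.- 1ℚ) (sgn q))

    private
      signCharacter : SignCharacter Dual-semiring n
      signCharacter = record
        { -1#          = -1D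
        ; neg-fixed    = neg-fixed
        ; sg           = λ q → ι (sgn q)
        ; sg-cong      = λ {σ} {τ} e → cong ι (sgn-cong {σ = σ} {τ} e)
        ; sg-id        = cong ι (sgn-id n)
        ; sg-transpose = sgn-transposed
        }

    open Expansion signCharacter row col y
      using (preserves?; #common; ∑-transversals)

    open RowByRow Dual-semiring row col y using (Row; Rows; []; _∷_; bottomUp; transversals-rows)
    open TransversalSums Dual-semiring row col y using (transversals)

    private
      R C : Permutation′ n → ℚ
      R p = Σℚ.⟦ preserves? row p ⟧
      C q = Σℚ.⟦ preserves? col q ⟧

      open ≡-Reasoning

      -- At the rows of `T` itself, `matches?` says that `q` followed by `σ` is a row permutation p;
      -- so `σ` is replaced by p q⁻¹.
      Φ-common : Φ μ T 1 (rowOf μ T) ≡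
        Σℚ.∑ (permutations n) (λ p → Σℚ.∑ (permutations n) λ q →
          (R p ℚ.* C q) ℚ.* (sgn q ℚ.* Σℚ.⟦ #common p q ℕₚ.≟ 1 ⟧))
      Φ-common = begin
        Φ μ T 1 (rowOf μ T)
          ≡⟨ Σℚ.∑-cong (permutations n) (λ σ → sym (Σℚ.∑-*ˡ (permutations n) Σℚ.⟦ #fixed σ ℕₚ.≟ 1 ⟧ _)) ⟩
        Σℚ.∑ (permutations n) (λ σ → Σℚ.∑ (permutations n) λ q → Σℚ.⟦ #fixed σ ℕₚ.≟ 1 ⟧ ℚ.*
          (C q ℚ.* (sgn q ℚ.* Σℚ.⟦ matches? μ T (λ x → rowOf μ T (σ ⟨$⟩ʳ x)) q ⟧)))
          ≡⟨ Σℚ.∑-swap (permutations n) (permutations n) _ ⟩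
        Σℚ.∑ (permutations n) (λ q → Σℚ.∑ (permutations n) λ σ → Σℚ.⟦ #fixed σ ℕₚ.≟ 1 ⟧ ℚ.*
          (C q ℚ.* (sgn q ℚ.* Σℚ.⟦ matches? μ T (λ x → rowOf μ T (σ ⟨$⟩ʳ x)) q ⟧)))
          ≡⟨ Σℚ.∑-cong (permutations n) inner ⟩
        Σℚ.∑ (permutations n) (λ q → Σℚ.∑ (permutations n) λ p →
          (R p ℚ.* C q) ℚ.* (sgn q ℚ.* Σℚ.⟦ #common p q ℕₚ.≟ 1 ⟧))
          ≡⟨ Σℚ.∑-swap (permutations n) (permutations n) _ ⟩
        Σℚ.∑ (permutations n) (λ p → Σℚ.∑ (permutations n) λ q →
          (R p ℚ.* C q) ℚ.* (sgn q ℚ.* Σℚ.⟦ #common p q ℕₚ.≟ 1 ⟧)) ∎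
        where
        inner : ∀ q →
          Σℚ.∑ (permutations n) (λ σ → Σℚ.⟦ #fixed σ ℕₚ.≟ 1 ⟧ ℚ.*
            (C q ℚ.* (sgn q ℚ.* Σℚ.⟦ matches? μ T (λ x → rowOf μ T (σ ⟨$⟩ʳ x)) q ⟧))) ≡
          Σℚ.∑ (permutations n) (λ p → (R p ℚ.* C q) ℚ.* (sgn q ℚ.* Σℚ.⟦ #common p q ℕₚ.≟ 1 ⟧))
        inner q = begin
          _ ≡⟨ Σℚ.∑-cong (permutations n) summand ⟩
          Σℚ.∑ (permutations n) (λ σ → G (q ∘ₚ σ))
            ≡⟨ Σℚ.∑-permutations-∘ˡ q G (λ {σ} {τ} → G-ext {σ} {τ}) ⟩
          Σℚ.∑ (permutations n) G
            ≡⟨ Σℚ.∑-cong (permutations n) common ⟩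
          _ ∎
          where
          G : Permutation′ n → ℚ
          G p = (R p ℚ.* C q) ℚ.* (sgn q ℚ.* Σℚ.⟦ #fixed (flip q ∘ₚ p) ℕₚ.≟ 1 ⟧)

          G-ext : Σℚ.Extensional G
          G-ext {σ} {τ} e = cong₂ (λ a b → (a ℚ.* C q) ℚ.* (sgn q ℚ.* Σℚ.⟦ b ℕₚ.≟ 1 ⟧))
            (Σℚ.⟦⟧-cong (preserves? row σ) (preserves? row τ)
              (λ h x → trans (cong row (sym (e x))) (h x)) (λ h x → trans (cong row (e x)) (h x)))
            (#fixed-cong {σ = flip q ∘ₚ σ} {flip q ∘ₚ τ} (λ i → e (q ⟨$⟩ˡ i)))

          summand : ∀ σ → Σℚ.⟦ #fixed σ ℕₚ.≟ 1 ⟧ ℚ.*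
            (C q ℚ.* (sgn q ℚ.* Σℚ.⟦ matches? μ T (λ x → rowOf μ T (σ ⟨$⟩ʳ x)) q ⟧)) ≡ G (q ∘ₚ σ)
          summand σ = trans
            (cong₂ (λ a b → Σℚ.⟦ a ℕₚ.≟ 1 ⟧ ℚ.* (C q ℚ.* (sgn q ℚ.* b)))
              (#fixed-cong {σ = σ} {flip q ∘ₚ (q ∘ₚ σ)} (λ i → cong (σ ⟨$⟩ʳ_) (sym (inverseʳ q {i}))))
              (Σℚ.⟦⟧-cong (matches? μ T (λ x → rowOf μ T (σ ⟨$⟩ʳ x)) q) (preserves? row (q ∘ₚ σ))
                (λ h x → cong toℕ (sym (h x))) (λ h x → Finₚ.toℕ-injective (sym (h x)))))
            (solve 4 (λ f c s r → f :* (c :* (s :* r)) := (r :* c) :* (s :* f)) refl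
              Σℚ.⟦ #fixed (flip q ∘ₚ (q ∘ₚ σ)) ℕₚ.≟ 1 ⟧ (C q) (sgn q) (R (q ∘ₚ σ)))
            where open +-*-Solver

          common : ∀ p → G p ≡ (R p ℚ.* C q) ℚ.* (sgn q ℚ.* Σℚ.⟦ #common p q ℕₚ.≟ 1 ⟧)
          common p = begin
            (R p ℚ.* C q) ℚ.* (sgn q ℚ.* Σℚ.⟦ #fixed (flip q ∘ₚ p) ℕₚ.≟ 1 ⟧)
              ≡⟨ cong (ℚ._* (sgn q ℚ.* Σℚ.⟦ #fixed (flip q ∘ₚ p) ℕₚ.≟ 1 ⟧))
                   (sym (Σℚ.⟦⟧-× (preserves? row p) (preserves? col q))) ⟩
            Σℚ.⟦ both ⟧ ℚ.* (sgn q ℚ.* Σℚ.⟦ #fixed (flip q ∘ₚ p) ℕₚ.≟ 1 ⟧)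
              ≡⟨ Σℚ.⟦⟧*-cong both (λ (r , c) → cong (λ k → sgn q ℚ.* Σℚ.⟦ k ℕₚ.≟ 1 ⟧)
                   (#fixed-common p q λ x e → position-injective μ T
                     (Finₚ.toℕ-injective (trans (cong row (sym e)) (r x))) (c x))) ⟩
            Σℚ.⟦ both ⟧ ℚ.* (sgn q ℚ.* Σℚ.⟦ #common p q ℕₚ.≟ 1 ⟧)
              ≡⟨ cong (ℚ._* (sgn q ℚ.* Σℚ.⟦ #common p q ℕₚ.≟ 1 ⟧))
                   (Σℚ.⟦⟧-× (preserves? row p) (preserves? col q)) ⟩
            (R p ℚ.* C q) ℚ.* (sgn q ℚ.* Σℚ.⟦ #common p q ℕₚ.≟ 1 ⟧) ∎
            where both = preserves? row p ×-dec preserves? col q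

      Φ-dual : Φ μ T 1 (rowOf μ T) ≡
        du (ΣD.∑ (permutations n) λ p → ΣD.∑ (permutations n) λ q →
          (ΣD.⟦ preserves? row p ⟧ * ΣD.⟦ preserves? col q ⟧) *
          (ι (sgn q) * ΣD.pow (1# + y) (#common p q)))
      Φ-dual = trans Φ-common (sym (trans (du-∑ (permutations n) _)
        (Σℚ.∑-cong (permutations n) λ p → trans (du-∑ (permutations n) _)
        (Σℚ.∑-cong (permutations n) λ q → summand p q))))
        where
        summand : ∀ p q →
          du ((ΣD.⟦ preserves? row p ⟧ * ΣD.⟦ preserves? col q ⟧) * (ι (sgn q) * ΣD.pow (1# + y) (#common p q))) ≡
          (R p ℚ.* C q) ℚ.* (sgn q ℚ.* Σℚ.⟦ #common p q ℕₚ.≟ 1 ⟧)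
        summand p q = begin
          -- `1# + y` computes to `ε`.
          du ((ΣD.⟦ preserves? row p ⟧ * ΣD.⟦ preserves? col q ⟧) * (ι (sgn q) * ΣD.pow ε (#common p q)))
            ≡⟨ cong (λ z → du (z * (ι (sgn q) * ΣD.pow ε (#common p q))))
                 (trans (cong₂ _*_ (⟦⟧-ι (preserves? row p)) (⟦⟧-ι (preserves? col q))) (sym (ι-* (R p) (C q)))) ⟩
          du (ι (R p ℚ.* C q) * (ι (sgn q) * ΣD.pow ε (#common p q)))
            ≡⟨ du-ι-* (R p ℚ.* C q) (ι (sgn q) * ΣD.pow ε (#common p q)) ⟩
          (R p ℚ.* C q) ℚ.* du (ι (sgn q) * ΣD.pow ε (#common p q))
            ≡⟨ cong ((R p ℚ.* C q) ℚ.*_) (trans (du-ι-* (sgn q) (ΣD.pow ε (#common p q))) (cong (sgn q ℚ.*_) (du-ε^ (#common p q)))) ⟩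
          (R p ℚ.* C q) ℚ.* (sgn q ℚ.* Σℚ.⟦ #common p q ℕₚ.≟ 1 ⟧) ∎

      rowsList : ∀ ps → ((i : Fin (length ps)) → Fin (lookup ps i) → Fin n) → List (List (Fin n))
      rowsList []       el = []
      rowsList (k ∷ ps) el = map (el zero) (allFin k) ∷ rowsList ps (λ i → el (suc i))

      rowsList-Rows : ∀ o ps (el : (i : Fin (length ps)) → Fin (lookup ps i) → Fin n) →
        (∀ i j → row (el i j) ≡ o ℕ.+ toℕ i) → (∀ i j → col (el i j) ≡ toℕ j) →
        Rows o ps (rowsList ps el)
      rowsList-Rows o []       el r c = []
      rowsList-Rows o (k ∷ ps) el r c =
        record
          { located  = Allₚ.map⁺ (All.universal (λ j →
              trans (r zero j) (ℕₚ.+-identityʳ o) , subst (ℕ._< k) (sym (c zero j)) (Finₚ.toℕ<n j)) (allFin k))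
          ; distinct = AllPairsₚ.map⁺ (AllPairs.map (λ {i} {j} i≢j e →
              i≢j (Finₚ.toℕ-injective (trans (sym (c zero i)) (trans e (c zero j))))) (Uniqueₚ.allFin⁺ k))
          ; complete = λ {d} d<k → trans (Σℕ.∑-map (el zero) (allFin k) _)
              (trans (Σℕ.∑-cong (allFin k) λ j → Σℕ.⟦⟧-cong (col (el zero j) ℕₚ.≟ d) (j Finₚ.≟ fromℕ< d<k)
                       (λ e → Finₚ.toℕ-injective (trans (sym (c zero j)) (trans e (sym (Finₚ.toℕ-fromℕ< d<k)))))
                       (λ e → trans (c zero j) (trans (cong toℕ e) (Finₚ.toℕ-fromℕ< d<k))))
                     (Σℕ.∑-allFin-≟ (fromℕ< d<k)))
          ; size     = trans (Listₚ.length-map (el zero) (allFin k)) (Listₚ.length-tabulate {n = k} (λ i → i))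
          }
        ∷ rowsList-Rows (suc o) ps (λ i → el (suc i))
            (λ i j → trans (r (suc i) j) (ℕₚ.+-suc o (toℕ i))) (λ i → c (suc i))

      rowsList-∈ : ∀ ps (el : (i : Fin (length ps)) → Fin (lookup ps i) → Fin n) i j →
        el i j ∈ bottomUp (rowsList ps el)
      rowsList-∈ (k ∷ ps) el zero    j =
        ∈-++⁺ʳ (bottomUp (rowsList ps (λ i → el (suc i)))) (∈-map⁺ (el zero) (∈-allFin j))
      rowsList-∈ (k ∷ ps) el (suc i) j = ∈-++⁺ˡ (rowsList-∈ ps (λ i → el (suc i)) i j)

      Rows-unique : ∀ {o ps css} → Rows o ps css →
        Unique (bottomUp css) × All (λ x → o ℕ.≤ row x) (bottomUp css)
      Rows-unique []       = [] , []
      Rows-unique {o} (r ∷ rs) with Rows-unique rs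
      ... | uniq , above =
        Uniqueₚ.++⁺ uniq (AllPairs.map (λ ne e → ne (cong col e)) (Row.distinct r))
          (λ (v∈ , v∈′) → ℕₚ.<⇒≢ (All.lookup above v∈) (sym (proj₁ (All.lookup (Row.located r) v∈′)))) ,
        Allₚ.++⁺ (All.map (ℕₚ.≤-trans (ℕₚ.n≤1+n o)) above)
                 (All.map (λ (e , _) → ℕₚ.≤-reflexive (sym e)) (Row.located r))

      el : (i : Fin (#parts μ)) → Fin (lookup (parts μ) i) → Fin n
      el i j = Inverse.to T (i , j)

      css = rowsList (parts μ) el

      css-Rows : Rows 0 (parts μ) css
      css-Rows = rowsList-Rows 0 (parts μ) el (λ i j → cong toℕ (rowOf-to μ T (i , j)))
                                              (λ i j → columnOf-to μ T (i , j))

      covers : ∀ x → x ∈ bottomUp css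
      covers x = subst (_∈ bottomUp css) (Inverse.strictlyInverseˡ T x)
        (rowsList-∈ (parts μ) el (proj₁ (Inverse.from T x)) (proj₂ (Inverse.from T x)))

    Φ-rowsSum : Φ μ T 1 (rowOf μ T) ≡ du (RowSums.rowsSum Dual-semiring y (parts μ) (λ _ → 1#))
    Φ-rowsSum = trans Φ-dual (cong du (trans (∑-transversals (proj₁ (Rows-unique css-Rows)) covers)
      (trans (cong (λ xs → transversals xs []) (sym (Listₚ.++-identityʳ (bottomUp css))))
             (transversals-rows css-Rows (sorted μ) (λ _ → refl)))))

-- The formula for the eigenvalue and its sign

module EigenvalueFormula where
  open Summation
  open Permutations
  open Polytabloids
  open Trace
  open DualNumbers
  open RowExpansion
  open FunctionalCalculus
  open Inequalities
  open GeneratingFunction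
  open import Defs hiding (∑; _≈_)

  natℚ : ℕ → ℚ
  natℚ = Σℚ.nat

  natℚ>0 : ∀ {k} → 1 ℕ.≤ k → 0ℚ ℚ.< natℚ k
  natℚ>0 {suc k} _ = nat>0 k

  -- Evaluation of a polynomial in s at s = ε.
  ψ : ℕ → Dual
  ψ zero          = 1#
  ψ (suc zero)    = ε
  ψ (suc (suc k)) = 0#

  private
    module Nat  = Functionals ℕ-semiring
    module Du   = Functionals Dual-semiring
    open Transfer Dual-semiring -1D y refl using (Y; rowsSum-1)

    Yψ : ∀ k → Y ψ k ≡ y * ψ k
    Yψ zero          = refl
    Yψ (suc zero)    = refl
    Yψ (suc (suc k)) = trans (cong (_+ -1D * 0#) (ΣD.zeroʳ (ΣD.nat (3 ℕ.+ k)))) refl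

    pair : ℕ → ℕ → Dual
    pair a b = natℚ a +ε natℚ b

    pair-+ : ∀ a b c d → pair (a ℕ.+ c) (b ℕ.+ d) ≡ pair a b + pair c d
    pair-+ a b c d = cong₂ _+ε_ (Σℚ.nat-+ a c) (Σℚ.nat-+ b d)

    natD : ∀ k → ΣD.nat k ≡ ι (natℚ k)
    natD zero    = refl
    natD (suc k) = cong (1# +_) (natD k)

    natℕ : ∀ k → Σℕ.nat k ≡ k
    natℕ zero    = refl
    natℕ (suc k) = cong suc (natℕ k)

    pair-* : ∀ k a b → pair (Σℕ.nat k ℕ.* a) (Σℕ.nat k ℕ.* b) ≡ ΣD.nat k * pair a b
    pair-* k a b = trans
      (cong₂ _+ε_ (trans (cong (λ j → natℚ (j ℕ.* a)) (natℕ k)) (Σℚ.nat-* k a))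
                  (trans (cong (λ j → natℚ (j ℕ.* b)) (natℕ k)) (trans (Σℚ.nat-* k b)
                    (solve 3 (λ k a b → k :* b := k :* b :+ con 0ℚ :* a) refl (natℚ k) (natℚ a) (natℚ b)))))
      (cong (_* pair a b) (sym (natD k)))
      where open +-*-Solver

    -- `evaluate` has natural coefficients, so it acts on the two components of a dual number
    -- separately. On `ψ` it gives G_λ(0) + G_λ′(0) ε, with both components computed in ℕ.
    Paired : (ℕ → Dual) → (f g : ℕ → ℕ) → Set
    Paired φ f g = ∀ k → φ k ≡ pair (f k) (g k)

    E-pair : ∀ {φ f g} → Paired φ f g → Paired (Du.E φ) (Nat.E f) (Nat.E g)
    E-pair h zero = h zero
    E-pair {φ} {f} {g} h (suc k) = trans (cong₂ _+_ (E-pair h k) (h (suc k)))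
      (sym (pair-+ (Nat.E f k) (Nat.E g k) (f (suc k)) (g (suc k))))

    A-pair : ∀ {φ f g} → Paired φ f g → Paired (Du.A φ) (Nat.A f) (Nat.A g)
    A-pair {φ} {f} {g} h zero    = trans (cong (ΣD.nat 1 *_) (h 1)) (sym (pair-* 1 (f 1) (g 1)))
    A-pair {φ} {f} {g} h (suc k) = trans
      (cong₂ _+_ (trans (cong (ΣD.nat (2 ℕ.+ k) *_) (h (2 ℕ.+ k))) (sym (pair-* (2 ℕ.+ k) (f (2 ℕ.+ k)) (g (2 ℕ.+ k)))))
                 (E-pair h k))
      (sym (pair-+ (Σℕ.nat (2 ℕ.+ k) ℕ.* f (2 ℕ.+ k)) (Σℕ.nat (2 ℕ.+ k) ℕ.* g (2 ℕ.+ k)) (Nat.E f k) (Nat.E g k)))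

    iterate-A-pair : ∀ a {φ f g} → Paired φ f g →
      Paired (iterate Du.A a φ) (iterate Nat.A a f) (iterate Nat.A a g)
    iterate-A-pair zero    h = h
    iterate-A-pair (suc a) h = A-pair (iterate-A-pair a h)

    evaluate-pair : ∀ μ {φ f g} → Paired φ f g → Du.evaluate μ φ ≡ pair (Nat.evaluate μ f) (Nat.evaluate μ g)
    evaluate-pair []      h = h 0
    evaluate-pair (ℓ ∷ μ) h = evaluate-pair μ (E-pair (iterate-A-pair (ℓ ∸ head₀ μ) h))

    ψ-pair : Paired ψ (δ 0) (δ 1)
    ψ-pair zero          = refl
    ψ-pair (suc zero)    = refl
    ψ-pair (suc (suc k)) = refl

    -1^ : ℕ → ℚ
    -1^ = Σℚ.pow (ℚ.- 1ℚ)

    -- Since y = -(1 - ε), its m-th power is (-1)ᵐ (1 - m ε).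
    y^ : ∀ m a b → ΣD.pow y m * (a +ε b) ≡ (-1^ m ℚ.* a) +ε (-1^ m ℚ.* (b ℚ.- natℚ m ℚ.* a))
    y^ zero a b = cong₂ _+ε_ refl
      (solve 2 (λ a b → con 1ℚ :* b :+ con 0ℚ :* a := con 1ℚ :* (b :- con 0ℚ :* a)) refl a b)
      where open +-*-Solver
    y^ (suc m) a b = trans (ΣD.*-assoc y (ΣD.pow y m) (a +ε b)) (trans (cong (y *_) (y^ m a b))
      (cong₂ _+ε_ (sym (ℚₚ.*-assoc (ℚ.- 1ℚ) (-1^ m) a))
        (solve 4 (λ g a b k → con (ℚ.- 1ℚ) :* (g :* (b :- k :* a)) :+ con 1ℚ :* (g :* a) :=
           (con (ℚ.- 1ℚ) :* g) :* (b :- (con 1ℚ :+ k) :* a)) refl (-1^ m) a b (natℚ m))))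
      where open +-*-Solver

  η₁ : ∀ {n} (μ : Partition n) (V : SpechtRepresentation μ) {ℓ ν} → parts μ ≡ ℓ ∷ ν →
    η V 1 ≡ Σℚ.pow (ℚ.- 1ℚ) (ListAction.sum ν) ℚ.* (natℚ (P₁ (ℓ ∷ ν)) ℚ.- natℚ (ListAction.sum ν) ℚ.* natℚ (P₀ (ℓ ∷ ν)))
  η₁ μ V {ℓ} {ν} e = η-scalar V 1 (someTableau μ) λ T → begin
    Φ μ T 1 (rowOf μ T)
      ≡⟨ Φ-rowsSum μ T ⟩
    du (RowSums.rowsSum Dual-semiring y (parts μ) (λ _ → 1#))
      ≡⟨ cong (λ ps → du (RowSums.rowsSum Dual-semiring y ps (λ _ → 1#))) e ⟩
    du (RowSums.rowsSum Dual-semiring y (ℓ ∷ ν) (λ _ → 1#))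
      ≡⟨ cong du (rowsSum-1 (subst (Linked _≥_) e (sorted μ)) ψ refl Yψ) ⟩
    du (ΣD.pow y (ListAction.sum ν) * Du.evaluate (ℓ ∷ ν) ψ)
      ≡⟨ cong du (trans (cong (ΣD.pow y (ListAction.sum ν) *_) (evaluate-pair (ℓ ∷ ν) ψ-pair))
                        (y^ (ListAction.sum ν) (natℚ (P₀ (ℓ ∷ ν))) (natℚ (P₁ (ℓ ∷ ν))))) ⟩
    -1^ (ListAction.sum ν) ℚ.* (natℚ (P₁ (ℓ ∷ ν)) ℚ.- natℚ (ListAction.sum ν) ℚ.* natℚ (P₀ (ℓ ∷ ν))) ∎
    where open ≡-Reasoning

  signum-neg : ∀ x → signum (ℚ.- x) ≡ -1ℤ ℤ.* signum x
  signum-neg (mkℚ +0       _ _) = refl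
  signum-neg (mkℚ +[1+ _ ] _ _) = refl
  signum-neg (mkℚ -[1+ _ ] _ _) = refl

  signum-pos : ∀ {x} → 0ℚ ℚ.< x → signum x ≡ 1ℤ
  signum-pos {mkℚ +[1+ _ ] _ _} _ = refl
  signum-pos {mkℚ +0 _ _}       h with ℚ.positive h
  ... | ()
  signum-pos {mkℚ -[1+ _ ] _ _} h with ℚ.positive h
  ... | ()

  signum-alternating : ∀ k {x} → 0ℚ ℚ.< x → signum (-1^ k ℚ.* x) ≡ -1ℤ ℤ.^ k
  signum-alternating zero    h = trans (cong signum (ℚₚ.*-identityˡ _)) (signum-pos h)
  signum-alternating (suc k) {x} h = begin
    signum ((ℚ.- 1ℚ) ℚ.* -1^ k ℚ.* x)
      ≡⟨ cong signum (solve 2 (λ g x → con (ℚ.- 1ℚ) :* g :* x := :- (g :* x)) refl (-1^ k) x) ⟩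
    signum (ℚ.- (-1^ k ℚ.* x))
      ≡⟨ signum-neg (-1^ k ℚ.* x) ⟩
    -1ℤ ℤ.* signum (-1^ k ℚ.* x)
      ≡⟨ cong (-1ℤ ℤ.*_) (signum-alternating k h) ⟩
    -1ℤ ℤ.^ suc k ∎
    where
    open ≡-Reasoning
    open +-*-Solver

  -1ℤ^≢0 : ∀ k → -1ℤ ℤ.^ k ≢ 0ℤ
  -1ℤ^≢0 k = [ (λ e f → contradiction (trans (sym e) f) λ ()) , (λ e f → contradiction (trans (sym e) f) λ ()) ]′ (unit k)
    where
    unit : ∀ k → -1ℤ ℤ.^ k ≡ 1ℤ ⊎ -1ℤ ℤ.^ k ≡ -1ℤ
    unit zero    = inj₁ refl
    unit (suc k) = [ (λ e → inj₂ (cong (-1ℤ ℤ.*_) e)) , (λ e → inj₁ (cong (-1ℤ ℤ.*_) e)) ]′ (unit k)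

  module _ (S m P : ℕ) where

    balance-zero : m ℕ.* P ≡ S → ∀ g → g ℚ.* (natℚ S ℚ.- natℚ m ℚ.* natℚ P) ≡ 0ℚ
    balance-zero e g = trans (cong (λ z → g ℚ.* (natℚ S ℚ.- z)) (trans (sym (Σℚ.nat-* m P)) (cong natℚ e)))
      (trans (cong (g ℚ.*_) (ℚₚ.+-inverseʳ (natℚ S))) (ℚₚ.*-zeroʳ g))

    balance-sign : S ℕ.< m ℕ.* P → ∀ k →
      signum (-1^ (suc k) ℚ.* (natℚ S ℚ.- natℚ m ℚ.* natℚ P)) ≡ -1ℤ ℤ.^ k
    balance-sign S<mP k = trans (cong signum flipped) (signum-alternating k (nat>0 d))
      where
      d = m ℕ.* P ∸ suc S
      e : S ℕ.+ suc d ≡ m ℕ.* P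
      e = trans (ℕₚ.+-suc S d) (ℕₚ.m+[n∸m]≡n S<mP)
      flipped : -1^ (suc k) ℚ.* (natℚ S ℚ.- natℚ m ℚ.* natℚ P) ≡ -1^ k ℚ.* natℚ (suc d)
      flipped = trans
        (cong (λ z → -1^ (suc k) ℚ.* (natℚ S ℚ.- z))
          (trans (sym (Σℚ.nat-* m P)) (trans (cong natℚ (sym e)) (Σℚ.nat-+ S (suc d)))))
        (solve 3 (λ g a b → (con (ℚ.- 1ℚ) :* g) :* (a :- (a :+ b)) := g :* b) refl (-1^ k) (natℚ S) (natℚ (suc d)))
        where open +-*-Solver

-- The cells below the first row, and the cases of one row and of several rows

open Summation
open Permutations using (module Σℕ; module Σℚ; length-filter)
open Inequalities using (P₀; P₁; P₁-row; Exceptional; exceptional-balance; ordinary-balance)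
open GeneratingFunction using (CellOf)
open EigenvalueFormula
open import Defs
open import Data.Integer.Base using (-1ℤ; _^_)
open import Data.List.Base using ([]; _∷_; replicate)
open import Data.Nat.Base using (ℕ; _≤_; _∸_)
open import Data.Product.Base using (_×_)
open import Data.Rational.Base using (0ℚ; _<_)
open import Data.Sum.Base using (_⊎_)
open import Function.Bundles using (_⇔_)
open import Relation.Binary.PropositionalEquality using (_≡_; _≢_)

-- At `parts μ` this unfolds to `#cellsUnderFirstRow μ`; depending on the list alone, it can be
-- rewritten along an equation for `parts μ`.
#cellsBelow : List ℕ → ℕ
#cellsBelow ps = length (filter (λ (i , _) → 1 ℕₚ.≤? toℕ i) cellList)
  where
  cellList : List (CellOf ps)
  cellList = concatMap (λ i → map (i ,_) (allFin _)) (allFin _)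

#cellsBelow-∷ : ∀ ℓ ν → #cellsBelow (ℓ ∷ ν) ≡ ListAction.sum ν
#cellsBelow-∷ ℓ ν = begin
  #cellsBelow (ℓ ∷ ν)
    ≡⟨ length-filter (λ (i , _) → 1 ℕₚ.≤? toℕ i) (concatMap row (allFin (suc r))) ⟩
  Σℕ.∑ (concatMap row (allFin (suc r))) below
    ≡⟨ Σℕ.∑-concatMap row (allFin (suc r)) below ⟩
  Σℕ.∑ (allFin (suc r)) (λ i → Σℕ.∑ (row i) below)
    ≡⟨ Σℕ.∑-cong (allFin (suc r)) (λ i → Σℕ.∑-map (cell i) (allFin (lookup (ℓ ∷ ν) i)) below) ⟩
  Σℕ.∑ (allFin (suc r)) (λ i → Σℕ.∑ (allFin (lookup (ℓ ∷ ν) i)) λ _ → Σℕ.⟦ 1 ℕₚ.≤? toℕ i ⟧)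
    ≡⟨ Σℕ.∑-allFin-suc r (λ i → Σℕ.∑ (allFin (lookup (ℓ ∷ ν) i)) λ _ → Σℕ.⟦ 1 ℕₚ.≤? toℕ i ⟧) ⟩
  Σℕ.∑ (allFin ℓ) (λ _ → 0) ℕ.+ Σℕ.∑ (allFin r) (λ i → Σℕ.∑ (allFin (lookup ν i)) λ _ → 1)
    ≡⟨ cong₂ ℕ._+_ (Σℕ.∑-zero (allFin ℓ) λ _ → refl) (total ν) ⟩
  ListAction.sum ν ∎
  where
  open ≡-Reasoning
  r = length ν

  cell : (i : Fin (suc r)) → Fin (lookup (ℓ ∷ ν) i) → CellOf (ℓ ∷ ν)
  cell i j = i , j

  row : (i : Fin (suc r)) → List (CellOf (ℓ ∷ ν))
  row i = map (cell i) (allFin (lookup (ℓ ∷ ν) i))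

  below : CellOf (ℓ ∷ ν) → ℕ
  below (i , _) = Σℕ.⟦ 1 ℕₚ.≤? toℕ i ⟧

  count : ∀ {a} {A : Set a} (xs : List A) → Σℕ.∑ xs (λ _ → 1) ≡ length xs
  count []       = refl
  count (x ∷ xs) = cong suc (count xs)

  total : ∀ ν → Σℕ.∑ (allFin (length ν)) (λ i → Σℕ.∑ (allFin (lookup ν i)) λ _ → 1) ≡ ListAction.sum ν
  total []      = refl
  total (k ∷ ν) = trans (Σℕ.∑-allFin-suc (length ν) (λ i → Σℕ.∑ (allFin (lookup (k ∷ ν) i)) λ _ → 1))
    (cong₂ ℕ._+_ (trans (count (allFin k)) (Listₚ.length-tabulate {n = k} (λ i → i))) (total ν))

Claim : ∀ {n} (μ : Partition n) → SpechtRepresentation μ → Set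
Claim {n} μ V =
    (η V 1 ≡ 0ℚ ⇔ (parts μ ≡ (n ∸ 1) ∷ 1 ∷ [] ⊎ parts μ ≡ 2 ∷ replicate (n ∸ 2) 1))
    × (#parts μ ≡ 1 → parts μ ≢ 2 ∷ [] → 0ℚ < η V 1)
    × (2 ≤ #parts μ → parts μ ≢ (n ∸ 1) ∷ 1 ∷ [] → parts μ ≢ 2 ∷ replicate (n ∸ 2) 1 →
        signum (η V 1) ≡ -1ℤ ^ (n ∸ firstPart μ ∸ 1)
        × signum (η V 1) ≡ -1ℤ ^ (#cellsUnderFirstRow μ ∸ 1))

module _ {n : ℕ} (2≤n : 2 ≤ n) (μ : Partition n) (V : SpechtRepresentation μ) where

  single-row : ∀ {ℓ} → parts μ ≡ ℓ ∷ [] → Claim μ V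
  single-row {ℓ} e = cases n refl 2≤n
    where
    ℓ≡n : ℓ ≡ n
    ℓ≡n = trans (sym (ℕₚ.+-identityʳ ℓ)) (trans (cong ListAction.sum (sym e)) (size μ))

    η≡s : η V 1 ≡ natℚ (P₁ (ℓ ∷ []))
    η≡s = trans (η₁ μ V e) (solve 2 (λ a b → con 1ℚ :* (a :- con 0ℚ :* b) := a) refl
            (natℚ (P₁ (ℓ ∷ []))) (natℚ (P₀ (ℓ ∷ []))))
      where open +-*-Solver

    not-long : 2 ≤ #parts μ → ∀ {A : Set} → A
    not-long h = contradiction (subst (λ ps → 2 ≤ length ps) e h) λ { (s≤s ()) }

    cases : ∀ k → k ≡ n → 2 ≤ k → Claim μ V
    cases (suc zero) _ (s≤s ())
    cases (suc (suc zero)) refl _ =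
        -- For n = 2 the single row (2) is itself (2,1ⁿ⁻²), and its `P₁` computes to 0.
        mk⇔ (λ _ → inj₂ parts≡2) (λ _ → trans η≡s (cong (λ ℓ → natℚ (P₁ (ℓ ∷ []))) ℓ≡n))
      , (λ _ ≢2 → contradiction parts≡2 ≢2)
      , (λ h → not-long h)
      where
      parts≡2 : parts μ ≡ 2 ∷ []
      parts≡2 = trans e (cong (_∷ []) ℓ≡n)
    cases (suc (suc (suc k))) refl _ =
        mk⇔ (λ η≡0 → contradiction (sym η≡0) (ℚₚ.<⇒≢ 0<η)) not-exceptional
      , (λ _ _ → 0<η)
      , (λ h → not-long h)
      where
      0<η : 0ℚ < η V 1
      0<η = subst (0ℚ <_) (sym (trans η≡s (cong (λ ℓ → natℚ (P₁ (ℓ ∷ []))) ℓ≡n))) (natℚ>0 (P₁-row k))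
      not-exceptional : parts μ ≡ (2 ℕ.+ k) ∷ 1 ∷ [] ⊎ parts μ ≡ 2 ∷ replicate (suc k) 1 → η V 1 ≡ 0ℚ
      not-exceptional (inj₁ f) = contradiction (trans (sym e) f) λ ()
      not-exceptional (inj₂ f) = contradiction (trans (sym e) f) λ ()

  several-rows : ∀ {ℓ b ν} → parts μ ≡ ℓ ∷ b ∷ ν → Claim μ V
  several-rows {ℓ} {b} {ν} e =
      mk⇔ zero⇒exceptional exceptional⇒zero
    , (λ one → contradiction (trans (sym (cong length e)) one) λ ())
    , (λ _ ≢₁ ≢₂ → signs (λ { (inj₁ f) → ≢₁ (to₁ f) ; (inj₂ f) → ≢₂ (to₂ f) }))
    where
    m = ListAction.sum (b ∷ ν)

    linked : Linked _≥_ (ℓ ∷ b ∷ ν)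
    linked = subst (Linked _≥_) e (sorted μ)

    pos : All (1 ≤_) (ℓ ∷ b ∷ ν)
    pos = subst (All (1 ≤_)) e (positive μ)

    1≤b : 1 ≤ b
    1≤b = All.head (All.tail pos)

    n≡ : n ≡ ℓ ℕ.+ m
    n≡ = trans (sym (size μ)) (cong ListAction.sum e)

    to₁ : b ∷ ν ≡ 1 ∷ [] → parts μ ≡ (n ∸ 1) ∷ 1 ∷ []
    to₁ refl = trans e (cong (_∷ 1 ∷ []) (sym (trans (cong (_∸ 1) n≡) (ℕₚ.m+n∸n≡m ℓ 1))))

    tail-sum : ∀ {k} → ℓ ≡ 2 → replicate (n ∸ 2) k ≡ replicate m k
    tail-sum {k} ℓ≡2 = cong (λ j → replicate j k) (trans (cong (_∸ 2) n≡) (cong (λ j → j ℕ.+ m ∸ 2) ℓ≡2))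

    to₂ : ℓ ∷ b ∷ ν ≡ 2 ∷ replicate m 1 → parts μ ≡ 2 ∷ replicate (n ∸ 2) 1
    to₂ f = trans e (trans f (cong (2 ∷_) (sym (tail-sum (Listₚ.∷-injectiveˡ f)))))

    from : parts μ ≡ (n ∸ 1) ∷ 1 ∷ [] ⊎ parts μ ≡ 2 ∷ replicate (n ∸ 2) 1 → Exceptional ℓ (b ∷ ν)
    from (inj₁ f) = inj₁ (Listₚ.∷-injectiveʳ (trans (sym e) f))
    from (inj₂ f) = inj₂ (trans (sym e) (trans f (cong (2 ∷_) (tail-sum (Listₚ.∷-injectiveˡ (trans (sym e) f))))))

    exceptional? : Dec (Exceptional ℓ (b ∷ ν))
    exceptional? = (Listₚ.≡-dec ℕₚ._≟_ (b ∷ ν) (1 ∷ [])) ⊎-dec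
                   (Listₚ.≡-dec ℕₚ._≟_ (ℓ ∷ b ∷ ν) (2 ∷ replicate m 1))

    exceptional⇒zero : _ → η V 1 ≡ 0ℚ
    exceptional⇒zero f = trans (η₁ μ V e)
      (balance-zero (P₁ (ℓ ∷ b ∷ ν)) m (P₀ (ℓ ∷ b ∷ ν)) (exceptional-balance 1≤b (from f)) (Σℚ.pow (ℚ.- 1ℚ) m))

    sign-m : ¬ Exceptional ℓ (b ∷ ν) → signum (η V 1) ≡ -1ℤ ^ (m ∸ 1)
    sign-m ordinary = trans (cong signum (η₁ μ V e)) (at m refl (ordinary-balance linked pos ordinary))
      where
      S = P₁ (ℓ ∷ b ∷ ν)
      P = P₀ (ℓ ∷ b ∷ ν)
      at : ∀ k → m ≡ k → S ℕ.< k ℕ.* P →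
        signum (Σℚ.pow (ℚ.- 1ℚ) k ℚ.* (natℚ S ℚ.- natℚ k ℚ.* natℚ P)) ≡ -1ℤ ^ (k ∸ 1)
      at (suc k) _ S<mP = balance-sign S (suc k) P S<mP k

    signs : ¬ Exceptional ℓ (b ∷ ν) →
      signum (η V 1) ≡ -1ℤ ^ (n ∸ firstPart μ ∸ 1) × signum (η V 1) ≡ -1ℤ ^ (#cellsUnderFirstRow μ ∸ 1)
    signs ordinary =
        trans (sign-m ordinary) (cong (λ k → -1ℤ ^ (k ∸ 1)) (sym below))
      , trans (sign-m ordinary) (cong (λ k → -1ℤ ^ (k ∸ 1)) (sym (trans (cong #cellsBelow e) (#cellsBelow-∷ ℓ (b ∷ ν)))))
      where
      below : n ∸ firstPart μ ≡ m
      below = trans (cong₂ _∸_ n≡ (cong (fromMaybe 0 ∘ List.head) e)) (ℕₚ.m+n∸m≡n ℓ m)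

    zero⇒exceptional : η V 1 ≡ 0ℚ → _
    zero⇒exceptional η≡0 with exceptional?
    ... | yes (inj₁ f) = inj₁ (to₁ f)
    ... | yes (inj₂ f) = inj₂ (to₂ f)
    ... | no ordinary  = contradiction (trans (sym (sign-m ordinary)) (cong signum η≡0)) (-1ℤ^≢0 (m ∸ 1))

theorem1p3 : (n : ℕ) → 2 ≤ n → (μ : Partition n) (V : SpechtRepresentation μ) →
    (η V 1 ≡ 0ℚ ⇔ (parts μ ≡ (n ∸ 1) ∷ 1 ∷ [] ⊎ parts μ ≡ 2 ∷ replicate (n ∸ 2) 1))
    × (#parts μ ≡ 1 → parts μ ≢ 2 ∷ [] → 0ℚ < η V 1)
    × (2 ≤ #parts μ → parts μ ≢ (n ∸ 1) ∷ 1 ∷ [] → parts μ ≢ 2 ∷ replicate (n ∸ 2) 1 →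
    signum (η V 1) ≡ -1ℤ ^ (n ∸ firstPart μ ∸ 1)
    × signum (η V 1) ≡ -1ℤ ^ (#cellsUnderFirstRow μ ∸ 1))
theorem1p3 n 2≤n μ V = by-shape (parts μ) refl
  where
  by-shape : ∀ ps → parts μ ≡ ps → Claim μ V
  by-shape []          e = contradiction (subst (2 ≤_) (trans (sym (size μ)) (cong ListAction.sum e)) 2≤n) λ ()
  by-shape (ℓ ∷ [])    e = single-row 2≤n μ V e
  by-shape (ℓ ∷ b ∷ ν) e = several-rows 2≤n μ V e
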